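{- Let $k\ge 0$ be a fixed integer, let $D=\left\lfloor\frac{1+\sqrt{1+8k}}{2}\right\rfloor$, and let $p=p(n)$ be such that $$\frac{(\log n)^{2D}\log\log n}{n}\ll p\ll 1 .$$ Let $R$ be a random subset of the cyclic group $C_n$ obtained by choosing each element of $C_n$ independently with probability $p$, and let $N^R_{n-1-k}$ be the number of zero-sum free sequences of length $n-1-k$ contained in $R$. Then, asymptotically almost surely, $$N^R_{n-1-k}=p\,\varphi(n)+O_k\left(p^2\varphi(n)+\sqrt{p\,\varphi(n)}\,(\log n)^D\right),$$ where the constant in $O_k$ depends only on $k$ and $\varphi(n)$ denotes the number of generators of $C_n$.
   Context: $C_n$ is the cyclic group of order $n$, written additively. A sequence of length $\ell$ over $C_n$ is an unordered collection with repetition allowed (a multiset) $S=a_1\cdot a_2\cdot\ldots\cdot a_\ell$ of $\ell$ elements of $C_n$. A subsequence of $S$ is a sequence $T$ in which the multiplicity of each $a\in C_n$ is at most its multiplicity in $S$. $S$ is a zero-sum sequence if $a_1+\dots+a_\ell=0$, and $S$ is zero-sum free if it contains no (nonempty) zero-sum subsequence. $S$ is contained in $A\subset C_n$ if every element occurring in $S$ lies in $A$. For functions of $n$, $f\ll g$ (equivalently $g\gg f$) means $f/g\to0$ as $n\to\infty$. "Asymptotically almost surely" means with probability tending to $1$ as $n\to\infty$; a statement "a.a.s. $X=a+O_k(b)$" means that there is a constant $c_k$ depending only on $k$ such that $\Pr[|X-a|\le c_k b]\to1$ as $n\to\infty$. -}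

module Defs where

open import Data.Bool using (Bool; true)
import Data.Integer as ℤ
open import Data.Fin using (Fin; toℕ; fromℕ<)
open import Data.Fin.Properties using (all?; any?; nonZeroIndex; toℕ-fromℕ<)
open import Data.Fin.Subset using (Subset; inside; outside; _∈_)
open import Data.Fin.Subset.Properties using (_∈?_)
open import Data.List as List using (List; []; _∷_; _++_; filter; filterᵇ; concatMap; upTo; allFin)
open import Data.List.Membership.Propositional.Properties using (∈-concatMap⁺; ∈-map⁺; ∈-upTo⁺)
import Data.List.Membership.Propositional as Mem
open import Data.List.Relation.Unary.All as All using (All)
import Data.List.Relation.Unary.Any as Any
open import Data.Nat as ℕ using (ℕ; zero; suc; _!)
import Data.Nat.Properties as ℕ
open import Data.Nat.Divisibility using (_∣_; _∣?_)
open import Data.Nat.DivMod using (_%_; m%n<n; m%n%n≡m%n; %-distribˡ-*)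
open import Data.Product using (∃; _×_; _,_)
open import Data.Rational as ℚ using (ℚ; 0ℚ; 1ℚ; ½)
import Data.Rational.Properties as ℚ
open import Data.Rational.Solver using (module +-*-Solver)
open import Data.Sum using (inj₁; inj₂)
open import Data.Vec as Vec using (Vec; []; _∷_; lookup; tabulate; zipWith; replicate)
open import Data.Vec.Relation.Binary.Pointwise.Inductive using (Pointwise; []; _∷_; decidable)
open import Relation.Binary.PropositionalEquality
open import Relation.Nullary using (¬_; Dec)
open import Relation.Nullary.Decidable using (map′; ¬?; _×-dec_; _→-dec_)

-- Real numbers: Cauchy sequences of rationals, up to _≃_.
-- All operations act termwise on the sequences.

EventuallyClose : (ℕ → ℚ) → ℚ → Set
EventuallyClose x ε = ∃ λ N → ∀ m n → N ℕ.≤ m → N ℕ.≤ n → ℚ.∣ x m ℚ.- x n ∣ ℚ.≤ ε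

IsCauchy : (ℕ → ℚ) → Set
IsCauchy x = ∀ ε → 0ℚ ℚ.< ε → EventuallyClose x ε

record ℝ : Set where
  constructor mkℝ
  field
    seq    : ℕ → ℚ
    cauchy : IsCauchy seq

open ℝ public

private
  module Identities where
    open +-*-Solver

    +-interchange : ∀ a b c d → (a ℚ.+ b) ℚ.- (c ℚ.+ d) ≡ (a ℚ.- c) ℚ.+ (b ℚ.- d)
    +-interchange = solve 4 (λ a b c d → (a :+ b) :- (c :+ d) := (a :- c) :+ (b :- d)) refl

    *-difference : ∀ a b c d →
      a ℚ.* b ℚ.- c ℚ.* d ≡ a ℚ.* (b ℚ.- d) ℚ.+ d ℚ.* (a ℚ.- c)
    *-difference =
      solve 4 (λ a b c d → a :* b :- c :* d := a :* (b :- d) :+ d :* (a :- c)) refl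

    neg-difference : ∀ a b → (ℚ.- a) ℚ.- (ℚ.- b) ≡ ℚ.- (a ℚ.- b)
    neg-difference = solve 2 (λ a b → (:- a) :- (:- b) := :- (a :- b)) refl

    minus-plus : ∀ a b → a ≡ (a ℚ.- b) ℚ.+ b
    minus-plus = solve 2 (λ a b → a := (a :- b) :+ b) refl

    plus-minus : ∀ a b → (a ℚ.+ b) ℚ.- b ≡ a
    plus-minus = solve 2 (λ a b → (a :+ b) :- b := a) refl

    neg-minus : ∀ a b → ℚ.- (a ℚ.- b) ≡ b ℚ.- a
    neg-minus = solve 2 (λ a b → :- (a :- b) := b :- a) refl

  open Identities

  halve-pos : ∀ {ε} → 0ℚ ℚ.< ε → 0ℚ ℚ.< ½ ℚ.* ε
  halve-pos {ε} ε>0 = subst (ℚ._< ½ ℚ.* ε) (ℚ.*-zeroʳ ½) (ℚ.*-monoʳ-<-pos ½ ε>0)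

  halves : ∀ ε → ½ ℚ.* ε ℚ.+ ½ ℚ.* ε ≡ ε
  halves ε = trans (sym (ℚ.*-distribʳ-+ ε ½ ½)) (ℚ.*-identityˡ ε)

  +-cauchy : ∀ x y → IsCauchy x → IsCauchy y → IsCauchy (λ n → x n ℚ.+ y n)
  +-cauchy x y cx cy ε ε>0
    with cx (½ ℚ.* ε) (halve-pos ε>0) | cy (½ ℚ.* ε) (halve-pos ε>0)
  ... | N , hx | M , hy = N ℕ.⊔ M , λ m n N≤m N≤n → begin
    ℚ.∣ (x m ℚ.+ y m) ℚ.- (x n ℚ.+ y n) ∣
      ≡⟨ cong ℚ.∣_∣ (+-interchange (x m) (y m) (x n) (y n)) ⟩
    ℚ.∣ (x m ℚ.- x n) ℚ.+ (y m ℚ.- y n) ∣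
      ≤⟨ ℚ.∣p+q∣≤∣p∣+∣q∣ (x m ℚ.- x n) (y m ℚ.- y n) ⟩
    ℚ.∣ x m ℚ.- x n ∣ ℚ.+ ℚ.∣ y m ℚ.- y n ∣
      ≤⟨ ℚ.+-mono-≤
           (hx m n (ℕ.m⊔n≤o⇒m≤o N M N≤m) (ℕ.m⊔n≤o⇒m≤o N M N≤n))
           (hy m n (ℕ.m⊔n≤o⇒n≤o N M N≤m) (ℕ.m⊔n≤o⇒n≤o N M N≤n)) ⟩
    ½ ℚ.* ε ℚ.+ ½ ℚ.* ε
      ≡⟨ halves ε ⟩
    ε ∎
    where
    open ℚ.≤-Reasoning

  neg-cauchy : ∀ x → IsCauchy x → IsCauchy (λ n → ℚ.- x n)
  neg-cauchy x cx ε ε>0 with cx ε ε>0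
  ... | N , hx = N , λ m n N≤m N≤n → begin
    ℚ.∣ (ℚ.- x m) ℚ.- (ℚ.- x n) ∣
      ≡⟨ cong ℚ.∣_∣ (neg-difference (x m) (x n)) ⟩
    ℚ.∣ ℚ.- (x m ℚ.- x n) ∣  ≡⟨ ℚ.∣-p∣≡∣p∣ (x m ℚ.- x n) ⟩
    ℚ.∣ x m ℚ.- x n ∣        ≤⟨ hx m n N≤m N≤n ⟩
    ε ∎
    where
    open ℚ.≤-Reasoning

  ∣a∣≤∣a-b∣+∣b∣ : ∀ a b → ℚ.∣ a ∣ ℚ.≤ ℚ.∣ a ℚ.- b ∣ ℚ.+ ℚ.∣ b ∣
  ∣a∣≤∣a-b∣+∣b∣ a b = begin
    ℚ.∣ a ∣                        ≡⟨ cong ℚ.∣_∣ (minus-plus a b) ⟩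
    ℚ.∣ (a ℚ.- b) ℚ.+ b ∣          ≤⟨ ℚ.∣p+q∣≤∣p∣+∣q∣ (a ℚ.- b) b ⟩
    ℚ.∣ a ℚ.- b ∣ ℚ.+ ℚ.∣ b ∣      ∎
    where
    open ℚ.≤-Reasoning

  ∣-∣-diff : ∀ a b → ℚ.∣ a ∣ ℚ.- ℚ.∣ b ∣ ℚ.≤ ℚ.∣ a ℚ.- b ∣
  ∣-∣-diff a b = begin
    ℚ.∣ a ∣ ℚ.- ℚ.∣ b ∣                       ≤⟨ ℚ.+-monoˡ-≤ (ℚ.- ℚ.∣ b ∣) (∣a∣≤∣a-b∣+∣b∣ a b) ⟩
    (ℚ.∣ a ℚ.- b ∣ ℚ.+ ℚ.∣ b ∣) ℚ.- ℚ.∣ b ∣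
      ≡⟨ plus-minus ℚ.∣ a ℚ.- b ∣ ℚ.∣ b ∣ ⟩
    ℚ.∣ a ℚ.- b ∣                             ∎
    where
    open ℚ.≤-Reasoning

  ∣a-b∣-sym : ∀ a b → ℚ.∣ a ℚ.- b ∣ ≡ ℚ.∣ b ℚ.- a ∣
  ∣a-b∣-sym a b = trans
    (cong ℚ.∣_∣ (sym (neg-minus b a)))
    (ℚ.∣-p∣≡∣p∣ (b ℚ.- a))

  ∣∣-cauchy : ∀ x → IsCauchy x → IsCauchy (λ n → ℚ.∣ x n ∣)
  ∣∣-cauchy x cx ε ε>0 with cx ε ε>0
  ... | N , hx = N , λ m n N≤m N≤n → ℚ.≤-trans (lip (x m) (x n)) (hx m n N≤m N≤n)
    where
    open ℚ.≤-Reasoning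
    lip : ∀ a b → ℚ.∣ ℚ.∣ a ∣ ℚ.- ℚ.∣ b ∣ ∣ ℚ.≤ ℚ.∣ a ℚ.- b ∣
    lip a b with ℚ.∣p∣≡p∨∣p∣≡-p (ℚ.∣ a ∣ ℚ.- ℚ.∣ b ∣)
    ... | inj₁ eq = ℚ.≤-trans (ℚ.≤-reflexive eq) (∣-∣-diff a b)
    ... | inj₂ eq = begin
      ℚ.∣ ℚ.∣ a ∣ ℚ.- ℚ.∣ b ∣ ∣   ≡⟨ eq ⟩
      ℚ.- (ℚ.∣ a ∣ ℚ.- ℚ.∣ b ∣)
        ≡⟨ neg-minus ℚ.∣ a ∣ ℚ.∣ b ∣ ⟩
      ℚ.∣ b ∣ ℚ.- ℚ.∣ a ∣         ≤⟨ ∣-∣-diff b a ⟩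
      ℚ.∣ b ℚ.- a ∣               ≡⟨ ∣a-b∣-sym b a ⟩
      ℚ.∣ a ℚ.- b ∣               ∎

  EventuallyBounded : (ℕ → ℚ) → ℚ → Set
  EventuallyBounded x B = ∃ λ N → ∀ n → N ℕ.≤ n → ℚ.∣ x n ∣ ℚ.≤ B

  bounded : ∀ x → IsCauchy x → ∃ λ B → 0ℚ ℚ.< B × EventuallyBounded x B
  bounded x cx with cx 1ℚ (ℚ.positive⁻¹ 1ℚ)
  ... | N , hx = 1ℚ ℚ.+ ℚ.∣ x N ∣ , B>0 , N , λ n N≤n →
    ℚ.≤-trans (∣a∣≤∣a-b∣+∣b∣ (x n) (x N))
              (ℚ.+-monoˡ-≤ ℚ.∣ x N ∣ (hx n N N≤n ℕ.≤-refl))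
    where
    B>0 : 0ℚ ℚ.< 1ℚ ℚ.+ ℚ.∣ x N ∣
    B>0 = ℚ.+-mono-<-≤ (ℚ.positive⁻¹ 1ℚ) (ℚ.0≤∣p∣ (x N))

  tolerance : ∀ {ε B} → 0ℚ ℚ.< ε → 0ℚ ℚ.< B →
    ∃ λ δ → 0ℚ ℚ.< δ × B ℚ.* δ ≡ ½ ℚ.* ε
  tolerance {ε} {B} ε>0 B>0 = δ , δ>0 , Bδ
    where
    instance
      _ = ℚ.positive B>0
      _ = ℚ.pos⇒nonZero B {{ℚ.positive B>0}}
    δ = ℚ.1/ B ℚ.* (½ ℚ.* ε)
    δ>0 : 0ℚ ℚ.< δ
    δ>0 = subst (ℚ._< δ) (ℚ.*-zeroʳ (ℚ.1/ B)) (ℚ.*-monoʳ-<-pos (ℚ.1/ B) {{ℚ.1/pos⇒pos B}} (halve-pos ε>0))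
    Bδ : B ℚ.* δ ≡ ½ ℚ.* ε
    Bδ = trans (sym (ℚ.*-assoc B (ℚ.1/ B) (½ ℚ.* ε)))
         (trans (cong (ℚ._* (½ ℚ.* ε)) (ℚ.*-inverseʳ B)) (ℚ.*-identityˡ (½ ℚ.* ε)))

  ∣*∣-mono : ∀ a b {A B} → ℚ.∣ a ∣ ℚ.≤ A → ℚ.∣ b ∣ ℚ.≤ B → ℚ.∣ a ℚ.* b ∣ ℚ.≤ A ℚ.* B
  ∣*∣-mono a b {A} {B} a≤A b≤B = begin
    ℚ.∣ a ℚ.* b ∣          ≡⟨ ℚ.∣p*q∣≡∣p∣*∣q∣ a b ⟩
    ℚ.∣ a ∣ ℚ.* ℚ.∣ b ∣    ≤⟨ ℚ.*-monoʳ-≤-nonNeg ℚ.∣ b ∣ a≤A ⟩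
    A ℚ.* ℚ.∣ b ∣          ≤⟨ ℚ.*-monoˡ-≤-nonNeg A b≤B ⟩
    A ℚ.* B                ∎
    where
    open ℚ.≤-Reasoning
    instance
      _ = ℚ.∣-∣-nonNeg b
      _ = ℚ.nonNegative (ℚ.≤-trans (ℚ.0≤∣p∣ a) a≤A)

  *-close : ∀ {A B α β ε} a b c d →
    ℚ.∣ a ∣ ℚ.≤ A → ℚ.∣ d ∣ ℚ.≤ B → ℚ.∣ b ℚ.- d ∣ ℚ.≤ α → ℚ.∣ a ℚ.- c ∣ ℚ.≤ β →
    A ℚ.* α ≡ ½ ℚ.* ε → B ℚ.* β ≡ ½ ℚ.* ε →
    ℚ.∣ a ℚ.* b ℚ.- c ℚ.* d ∣ ℚ.≤ ε
  *-close {A} {B} {α} {β} {ε} a b c d a≤A d≤B b-d≤α a-c≤β Aα Bβ = begin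
    ℚ.∣ a ℚ.* b ℚ.- c ℚ.* d ∣
      ≡⟨ cong ℚ.∣_∣ (*-difference a b c d) ⟩
    ℚ.∣ a ℚ.* (b ℚ.- d) ℚ.+ d ℚ.* (a ℚ.- c) ∣
      ≤⟨ ℚ.∣p+q∣≤∣p∣+∣q∣ (a ℚ.* (b ℚ.- d)) (d ℚ.* (a ℚ.- c)) ⟩
    ℚ.∣ a ℚ.* (b ℚ.- d) ∣ ℚ.+ ℚ.∣ d ℚ.* (a ℚ.- c) ∣
      ≤⟨ ℚ.+-mono-≤ (∣*∣-mono a (b ℚ.- d) a≤A b-d≤α) (∣*∣-mono d (a ℚ.- c) d≤B a-c≤β) ⟩
    A ℚ.* α ℚ.+ B ℚ.* β          ≡⟨ cong₂ ℚ._+_ Aα Bβ ⟩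
    ½ ℚ.* ε ℚ.+ ½ ℚ.* ε          ≡⟨ halves ε ⟩
    ε                            ∎
    where
    open ℚ.≤-Reasoning

  *-eventuallyClose : ∀ {x y : ℕ → ℚ} {A B ε} →
    EventuallyBounded x A → EventuallyBounded y B →
    (∃ λ α → EventuallyClose y α × A ℚ.* α ≡ ½ ℚ.* ε) →
    (∃ λ β → EventuallyClose x β × B ℚ.* β ≡ ½ ℚ.* ε) →
    EventuallyClose (λ n → x n ℚ.* y n) ε
  *-eventuallyClose {x} {y} {A} {B} {ε}
    (N₁ , x≤A) (N₂ , y≤B) (α , (N₃ , hy) , Aα) (β , (N₄ , hx) , Bβ) = N , λ m n N≤m N≤n →
    *-close {A} {B} {α} {β} {ε} (x m) (y m) (x n) (y n)
      (x≤A m (ℕ.≤-trans N₁≤N N≤m))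
      (y≤B n (ℕ.≤-trans N₂≤N N≤n))
      (hy m n (ℕ.≤-trans N₃≤N N≤m) (ℕ.≤-trans N₃≤N N≤n))
      (hx m n (ℕ.≤-trans N₄≤N N≤m) (ℕ.≤-trans N₄≤N N≤n))
      Aα Bβ
    where
    N = (N₁ ℕ.⊔ N₂) ℕ.⊔ (N₃ ℕ.⊔ N₄)
    N₁≤N = ℕ.≤-trans (ℕ.m≤m⊔n N₁ N₂) (ℕ.m≤m⊔n (N₁ ℕ.⊔ N₂) (N₃ ℕ.⊔ N₄))
    N₂≤N = ℕ.≤-trans (ℕ.m≤n⊔m N₁ N₂) (ℕ.m≤m⊔n (N₁ ℕ.⊔ N₂) (N₃ ℕ.⊔ N₄))
    N₃≤N = ℕ.≤-trans (ℕ.m≤m⊔n N₃ N₄) (ℕ.m≤n⊔m (N₁ ℕ.⊔ N₂) (N₃ ℕ.⊔ N₄))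
    N₄≤N = ℕ.≤-trans (ℕ.m≤n⊔m N₃ N₄) (ℕ.m≤n⊔m (N₁ ℕ.⊔ N₂) (N₃ ℕ.⊔ N₄))

  closeFor : ∀ {x B ε} → IsCauchy x → (∃ λ δ → 0ℚ ℚ.< δ × B ℚ.* δ ≡ ½ ℚ.* ε) →
    ∃ λ δ → EventuallyClose x δ × B ℚ.* δ ≡ ½ ℚ.* ε
  closeFor cx (δ , δ>0 , Bδ) = δ , cx δ δ>0 , Bδ

  *-cauchy : ∀ x y → IsCauchy x → IsCauchy y → IsCauchy (λ n → x n ℚ.* y n)
  *-cauchy x y cx cy ε ε>0 = go (bounded x cx) (bounded y cy)
    where
    go : (∃ λ A → 0ℚ ℚ.< A × EventuallyBounded x A) →
         (∃ λ B → 0ℚ ℚ.< B × EventuallyBounded y B) →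
         EventuallyClose (λ n → x n ℚ.* y n) ε
    go (A , A>0 , bx) (B , B>0 , by) = *-eventuallyClose {x} {y} {A} {B} {ε} bx by
      (closeFor {y} {A} {ε} cy (tolerance ε>0 A>0))
      (closeFor {x} {B} {ε} cx (tolerance ε>0 B>0))

infixl 6 _+_ _-_
infixl 7 _*_
infixr 8 _^_
infix  8 -_
infix  4 _≃_ _≤_ _<_ _≪_ _⟶_

fromℚ : ℚ → ℝ
fromℚ q = mkℝ (λ _ → q) λ ε ε>0 → 0 , λ _ _ _ _ →
  ℚ.≤-trans (ℚ.≤-reflexive (cong ℚ.∣_∣ (ℚ.+-inverseʳ q))) (ℚ.<⇒≤ ε>0)

fromℕ : ℕ → ℝ
fromℕ n = fromℚ (ℤ.+ n ℚ./ 1)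

-- 1 / n, with the junk value 0 at n = 0.
1/ℕ_ : ℕ → ℝ
1/ℕ zero  = fromℚ 0ℚ
1/ℕ suc n = fromℚ (ℤ.1ℤ ℚ./ suc n)

0ℝ 1ℝ ½ℝ : ℝ
0ℝ = fromℚ 0ℚ
1ℝ = fromℚ 1ℚ
½ℝ = fromℚ ½

_+_ _*_ : ℝ → ℝ → ℝ
-_ ∣_∣ : ℝ → ℝ

x + y = mkℝ (λ n → seq x n ℚ.+ seq y n) (+-cauchy (seq x) (seq y) (cauchy x) (cauchy y))
x * y = mkℝ (λ n → seq x n ℚ.* seq y n) (*-cauchy (seq x) (seq y) (cauchy x) (cauchy y))
- x   = mkℝ (λ n → ℚ.- seq x n) (neg-cauchy (seq x) (cauchy x))
∣ x ∣ = mkℝ (λ n → ℚ.∣ seq x n ∣) (∣∣-cauchy (seq x) (cauchy x))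

_-_ : ℝ → ℝ → ℝ
x - y = x + (- y)

_^_ : ℝ → ℕ → ℝ
x ^ zero  = 1ℝ
x ^ suc n = x * x ^ n

_≤_ _<_ _≃_ : ℝ → ℝ → Set
x ≤ y = ∀ ε → 0ℚ ℚ.< ε → ∃ λ N → ∀ n → N ℕ.≤ n → seq x n ℚ.≤ seq y n ℚ.+ ε
x < y = ∃ λ ε → 0ℚ ℚ.< ε × ∃ λ N → ∀ n → N ℕ.≤ n → seq x n ℚ.+ ε ℚ.≤ seq y n
x ≃ y = x ≤ y × y ≤ x

sumℝ : List ℝ → ℝ
sumℝ = List.foldr _+_ 0ℝ

_⟶_ : (ℕ → ℝ) → ℝ → Set
f ⟶ l = ∀ ε → 0ℝ < ε → ∃ λ N → ∀ n → N ℕ.≤ n → ∣ f n - l ∣ ≤ ε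

-- f / g → 0, with the quotient cleared: eventually g n ≠ 0 and |f n| ≤ ε |g n|.
_≪_ : (ℕ → ℝ) → (ℕ → ℝ) → Set
f ≪ g = ∀ ε → 0ℝ < ε → ∃ λ N → ∀ n → N ℕ.≤ n →
  0ℝ < ∣ g n ∣ × ∣ f n ∣ ≤ ε * ∣ g n ∣

-- The functions √, log and ⌊_⌋ enter through their graphs.

_IsSqrtOf_ : ℝ → ℝ → Set
r IsSqrtOf x = 0ℝ ≤ r × r * r ≃ x

-- exp y = x, through the power series of exp
_IsLogOf_ : ℝ → ℝ → Set
y IsLogOf x = (λ m → sumℝ (List.map (λ i → y ^ i * 1/ℕ (i !)) (upTo m))) ⟶ x

_IsFloorOf_ : ℕ → ℝ → Set
d IsFloorOf x = fromℕ d ≤ x × x < fromℕ (suc d)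

-- C_n is Fin n with addition of residues modulo n.

IsGenerator : ∀ {n} → Fin n → Set
IsGenerator {n} a = ∀ (b : Fin n) → ∃ λ m → (m ℕ.* toℕ a) % n ≡ toℕ b
  where instance _ = nonZeroIndex a

IsGenerator? : ∀ {n} (a : Fin n) → Dec (IsGenerator a)
IsGenerator? {n} a = all? λ b →
  map′ (λ (i , eq) → toℕ i , eq)
       (λ (m , eq) → fromℕ< (m%n<n m n) , trans (reduce m) eq)
       (any? λ (i : Fin n) → (toℕ i ℕ.* toℕ a) % n ℕ.≟ toℕ b)
  where
  instance _ = nonZeroIndex a
  reduce : ∀ m → (toℕ (fromℕ< (m%n<n m n)) ℕ.* toℕ a) % n ≡ (m ℕ.* toℕ a) % n
  reduce m = begin
    (toℕ (fromℕ< (m%n<n m n)) ℕ.* toℕ a) % n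
      ≡⟨ cong (λ j → (j ℕ.* toℕ a) % n) (toℕ-fromℕ< (m%n<n m n)) ⟩
    (m % n ℕ.* toℕ a) % n
      ≡⟨ %-distribˡ-* (m % n) (toℕ a) n ⟩
    ((m % n % n) ℕ.* (toℕ a % n)) % n
      ≡⟨ cong (λ j → (j ℕ.* (toℕ a % n)) % n) (m%n%n≡m%n m n) ⟩
    ((m % n) ℕ.* (toℕ a % n)) % n
      ≡⟨ %-distribˡ-* m (toℕ a) n ⟨
    (m ℕ.* toℕ a) % n ∎
    where
    open ≡-Reasoning

φ : ℕ → ℕ
φ n = List.length (filter IsGenerator? (allFin n))

-- A sequence over C_n is a multiset, given by its vector of multiplicities.
Sequence : ℕ → Set
Sequence n = Vec ℕ n

len : ∀ {n} → Sequence n → ℕ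
len = Vec.sum

ZeroSum : ∀ {n} → Sequence n → Set
ZeroSum {n} S = n ∣ Vec.sum (zipWith ℕ._*_ S (tabulate toℕ))

_⊑_ : ∀ {n} → Sequence n → Sequence n → Set
_⊑_ = Pointwise ℕ._≤_

ZeroSumFree : ∀ {n} → Sequence n → Set
ZeroSumFree S = ∀ T → T ⊑ S → 0 ℕ.< len T → ¬ ZeroSum T

ContainedIn : ∀ {n} → Sequence n → Subset n → Set
ContainedIn S A = ∀ a → 0 ℕ.< lookup S a → a ∈ A

-- The list of all subsequences of S, each occurring once.
subsequences : ∀ {n} → Sequence n → List (Sequence n)
subsequences []      = [] ∷ []
subsequences (s ∷ S) = concatMap (λ t → List.map (t ∷_) (subsequences S)) (upTo (suc s))

∈-subsequences : ∀ {n} {T S : Sequence n} → T ⊑ S → T Mem.∈ subsequences S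
∈-subsequences []          = Any.here refl
∈-subsequences (t≤s ∷ T⊑S) =
  ∈-concatMap⁺ _ (Mem.lose (∈-upTo⁺ (ℕ.s≤s t≤s)) (∈-map⁺ _ (∈-subsequences T⊑S)))

ZeroSumFree? : ∀ {n} (S : Sequence n) → Dec (ZeroSumFree S)
ZeroSumFree? {n} S =
  map′ (λ free T T⊑S → All.lookup free (∈-subsequences T⊑S) T⊑S)
       (λ free → All.tabulate λ {T} _ → free T)
       (All.all? (λ T → decidable ℕ._≤?_ T S →-dec (0 ℕ.<? len T →-dec ¬? (_ ∣? _)))
                 (subsequences S))

ContainedIn? : ∀ {n} (S : Sequence n) (A : Subset n) → Dec (ContainedIn S A)
ContainedIn? S A = all? λ a → (0 ℕ.<? lookup S a) →-dec (a ∈? A)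

-- All sequences of length ℓ over C_n; multiplicities are then at most ℓ.
sequencesOfLength : ∀ n → ℕ → List (Sequence n)
sequencesOfLength n ℓ = filter (λ S → len S ℕ.≟ ℓ) (subsequences (replicate n ℓ))

#zeroSumFree : ∀ {n} → Subset n → ℕ → ℕ
#zeroSumFree {n} R ℓ = List.length
  (filter (λ S → ZeroSumFree? S ×-dec ContainedIn? S R) (sequencesOfLength n ℓ))

subsets : ∀ n → List (Subset n)
subsets zero    = [] ∷ []
subsets (suc n) = List.map (inside ∷_) (subsets n) ++ List.map (outside ∷_) (subsets n)

-- The probability that the random subset equals R.
weight : ∀ {n} → ℝ → Subset n → ℝ
weight q []            = 1ℝ
weight q (inside  ∷ R) = q * weight q R
weight q (outside ∷ R) = (1ℝ - q) * weight q R

Pr : ∀ {n} → ℝ → (Subset n → Bool) → ℝ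
Pr {n} q F = sumℝ (List.map (weight q) (filterᵇ F (subsets n)))

-- Inequalities between reals are not decidable, so the probability of an event
-- E : Subset n → Set is bounded below through the decidable events F contained
-- in it.  For decidable E and 0 ≤ q ≤ 1 this says exactly c ≤ Pr E.
_≤Pr[_]_ : ∀ {n} → ℝ → ℝ → (Subset n → Set) → Set
c ≤Pr[ q ] E = ∃ λ F → (∀ R → F R ≡ true → E R) × c ≤ Pr q F

-- With probability tending to 1 as n → ∞, where each element of C_n is chosen
-- with probability p n.
AAS : (ℕ → ℝ) → (∀ n → Subset n → Set) → Set
AAS p E = ∀ ε → 0ℝ < ε → ∃ λ N → ∀ n → N ℕ.≤ n → (1ℝ - ε) ≤Pr[ p n ] E n

{-# OPTIONS --safe #-}
module Submission where

-- In a zero-sum free sequence over C_n, a pair of distinct elements contributes at least 3 rather than 2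
-- to the number of subset sums (Scherk's theorem), which is at most n.  So if the length is n - 1 - k, one
-- can take out at most k disjoint pairs of distinct elements, and what is left is a power of one element g.
-- For large n this g is a generator, and the elements taken out are b g with 1 ≤ b ≤ 3k, since otherwise
-- b g and n - b copies of g sum to zero.
--
-- Hence the count lies between Y and Y + O_k(Σ W_b), where Y is the number of generators in R and W_b is
-- the number of generators g with both g and b g in R, for 2 ≤ b ≤ 3k + 1.  The means are pφ(n) and p²φ(n),
-- and all variances are O_k(pφ(n)), so Chebyshev's inequality with deviation √(pφ(n)) log n suffices:
-- the failure probability is O_k(1 / (log n)²) and D ≥ 1.
--
-- The event is decided with the rational approximations of p and √(pφ(n)) at one late index, while its
-- probability is estimated at all later indices.

-- At index m of the Cauchy sequences `Pr` is the exact probability for the rational parameter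
-- `seq p m`, so all estimates are polynomial inequalities between rationals. A fixed event needs a
-- fixed centre: squared deviations are measured from the means at one index but averaged at a later
-- one. This costs a factor 2 and dictates the tolerances; the one for p is divided by n + 1,
-- because p gets multiplied by φ(n) ≤ n. For given ε the event is cut at λ√(pφ(n)) with a fixed
-- integer λ of at least 2A / ε, and log n ≥ λ holds for large n. This lower bound is not free: log
-- n is known only as some y whose exponential series tends to n, so a negative y has to be excluded
-- as well. There the partial sums have large alternating terms; those of even length are shown to
-- be at most 2 by walking from 0 to y in small Euler steps. The elements taken out are recorded as
-- a word of coefficients of fixed length 2k, padded by 1, so that the number of words depends on k
-- alone.

open import Data.Nat as ℕ using (ℕ; NonZero; _∸_)
import Data.Nat.Properties as ℕ
open import Data.Product using (∃; _×_; _,_; proj₁; proj₂)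
import Data.Rational as ℚ
import Data.Rational.Properties as ℚ
open import Relation.Binary.PropositionalEquality using (_≡_; trans; cong; sym)

-- Counting by injections between lists.

module Counting where

  open import Data.List using (List; []; _∷_; _++_; length; filter)
  open import Data.List.Properties using (length-++)
  open import Data.List.Membership.Propositional using (_∈_)
  open import Data.List.Membership.Propositional.Properties using (∈-∃++; ∈-++⁻; ∈-++⁺ˡ; ∈-++⁺ʳ)
  import Data.List.Relation.Unary.All as All
  open import Data.List.Relation.Unary.Any using (here; there)
  open import Data.List.Relation.Unary.AllPairs using ([]; _∷_)
  open import Data.List.Relation.Unary.Unique.Propositional using (Unique)
  open import Data.Nat using (suc; _+_; _≤_; z≤n; s≤s)
  open import Data.Nat.Properties using (+-suc)
  open import Data.Product using (_,_)
  open import Data.Sum using (inj₁; inj₂)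
  open import Level using (0ℓ)
  open import Relation.Binary.PropositionalEquality
  open import Relation.Nullary using (¬_; contradiction; yes; no)
  open import Relation.Unary using (Pred; Decidable)

  ∈-remove : ∀ {A : Set} {x y : A} us {vs} → y ≢ x → y ∈ us ++ x ∷ vs → y ∈ us ++ vs
  ∈-remove us y≢x y∈ with ∈-++⁻ us y∈
  ... | inj₁ y∈us           = ∈-++⁺ˡ y∈us
  ... | inj₂ (here y≡x)     = contradiction y≡x y≢x
  ... | inj₂ (there y∈vs)   = ∈-++⁺ʳ us y∈vs

  -- Pigeonhole: `f x` is deleted from `ys`, and injectivity keeps the other images in what remains.
  -- Injectivity is asked on members only, since some of the maps used later are injective only on
  -- the solutions of an equation.
  length-injection : ∀ {A B : Set} (f : A → B) {xs : List A} {ys : List B} → Unique xs →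
    (∀ {x y} → x ∈ xs → y ∈ xs → f x ≡ f y → x ≡ y) → (∀ {x} → x ∈ xs → f x ∈ ys) →
    length xs ≤ length ys
  length-injection f {[]} [] inj into = z≤n
  length-injection f {x ∷ xs} (x∉xs ∷ unique) inj into with ∈-∃++ (into (here refl))
  ... | us , vs , refl = subst (suc (length xs) ≤_) (sym len) (s≤s
      (length-injection f unique (λ y∈ z∈ → inj (there y∈) (there z∈))
        λ y∈xs → ∈-remove us
          (λ fy≡fx → All.lookup x∉xs y∈xs (sym (inj (there y∈xs) (here refl) fy≡fx)))
          (into (there y∈xs))))
    where
    len : length (us ++ f x ∷ vs) ≡ suc (length (us ++ vs))
    len = trans (length-++ us) (trans (+-suc (length us) (length vs)) (cong suc (sym (length-++ us))))

  filter-complement : ∀ {A : Set} {P Q : Pred A 0ℓ} (P? : Decidable P) (Q? : Decidable Q) →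
    (∀ {x} → P x → ¬ Q x) → (∀ {x} → ¬ P x → Q x) →
    ∀ xs → length (filter P? xs) + length (filter Q? xs) ≡ length xs
  filter-complement P? Q? P⇒¬Q ¬P⇒Q []       = refl
  filter-complement P? Q? P⇒¬Q ¬P⇒Q (x ∷ xs) with P? x | Q? x
  ... | yes p | yes q = contradiction q (P⇒¬Q p)
  ... | yes p | no ¬q = cong suc (filter-complement P? Q? P⇒¬Q ¬P⇒Q xs)
  ... | no ¬p | yes q = trans (+-suc _ _) (cong suc (filter-complement P? Q? P⇒¬Q ¬P⇒Q xs))
  ... | no ¬p | no ¬q = contradiction (¬P⇒Q ¬p) ¬q

-- Arithmetic of the cyclic group on residues.

module Residues (n : ℕ) {{_ : NonZero n}} where

  open import Data.Fin using (Fin; toℕ)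
  open import Data.Fin.Properties using (toℕ-fromℕ<; toℕ-injective; toℕ<n)
  open import Data.List using (List; []; _∷_; _++_; map; replicate)
  open import Data.List.Properties using (map-++)
  open import Data.Nat.ListAction using (sum)
  open import Data.Nat.ListAction.Properties using (sum-++)
  open import Data.Nat using (zero; suc; _+_; _*_; pred)
  open import Data.Nat.Properties
  open import Data.Nat.Divisibility using (_∣_; m%n≡0⇒n∣m; n∣m⇒m%n≡0; m∣m*n; _∣0)
  open import Data.Nat.DivMod
  open import Relation.Binary.PropositionalEquality hiding ([_])

  [_] : ℕ → Fin n
  [ a ] = a mod n

  toℕ-[] : ∀ a → toℕ [ a ] ≡ a % n
  toℕ-[] a = toℕ-fromℕ< (m%n<n a n)

  []-cong : ∀ {a b} → a % n ≡ b % n → [ a ] ≡ [ b ]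
  []-cong {a} {b} eq = toℕ-injective (trans (toℕ-[] a) (trans eq (sym (toℕ-[] b))))

  []-injective : ∀ {a b} → [ a ] ≡ [ b ] → a % n ≡ b % n
  []-injective {a} {b} eq = trans (sym (toℕ-[] a)) (trans (cong toℕ eq) (toℕ-[] b))

  [toℕ] : ∀ x → [ toℕ x ] ≡ x
  [toℕ] x = toℕ-injective (trans (toℕ-[] (toℕ x)) (m<n⇒m%n≡m (toℕ<n x)))

  infixl 6 _⊕_
  infixl 7 _·_

  _⊕_ : Fin n → Fin n → Fin n
  x ⊕ y = [ toℕ x + toℕ y ]

  _·_ : ℕ → Fin n → Fin n
  j · x = [ j * toℕ x ]

  0# : Fin n
  0# = [ 0 ]

  []-+ : ∀ a b → [ a + b ] ≡ [ a ] ⊕ [ b ]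
  []-+ a b = []-cong (trans (%-distribˡ-+ a b n)
    (sym (cong₂ (λ x y → (x + y) % n) (toℕ-[] a) (toℕ-[] b))))

  []-* : ∀ a b → [ a * b ] ≡ a · [ b ]
  []-* a b = []-cong (trans (%-distribˡ-* a b n)
    (sym (trans (cong (λ y → (a * y) % n) (toℕ-[] b))
      (trans (%-distribˡ-* a (b % n) n) (cong (λ y → (a % n * y) % n) (m%n%n≡m%n b n))))))

  ⊕-comm : ∀ x y → x ⊕ y ≡ y ⊕ x
  ⊕-comm x y = cong [_] (+-comm (toℕ x) (toℕ y))

  ⊕-assoc : ∀ x y z → (x ⊕ y) ⊕ z ≡ x ⊕ (y ⊕ z)
  ⊕-assoc x y z = begin
    (x ⊕ y) ⊕ z                    ≡⟨ cong ((x ⊕ y) ⊕_) ([toℕ] z) ⟨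
    (x ⊕ y) ⊕ [ toℕ z ]            ≡⟨ []-+ (toℕ x + toℕ y) (toℕ z) ⟨
    [ toℕ x + toℕ y + toℕ z ]      ≡⟨ cong [_] (+-assoc (toℕ x) (toℕ y) (toℕ z)) ⟩
    [ toℕ x + (toℕ y + toℕ z) ]    ≡⟨ []-+ (toℕ x) (toℕ y + toℕ z) ⟩
    [ toℕ x ] ⊕ (y ⊕ z)            ≡⟨ cong (_⊕ (y ⊕ z)) ([toℕ] x) ⟩
    x ⊕ (y ⊕ z)                    ∎
    where open ≡-Reasoning

  ⊕-identityˡ : ∀ x → 0# ⊕ x ≡ x
  ⊕-identityˡ x = trans (cong (0# ⊕_) (sym ([toℕ] x))) (trans (sym ([]-+ 0 (toℕ x))) ([toℕ] x))

  ⊕-identityʳ : ∀ x → x ⊕ 0# ≡ x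
  ⊕-identityʳ x = trans (⊕-comm x 0#) (⊕-identityˡ x)

  ∣⇒[]≡0 : ∀ {a} → n ∣ a → [ a ] ≡ 0#
  ∣⇒[]≡0 {a} n∣a = []-cong (trans (n∣m⇒m%n≡0 a n n∣a) (sym (n∣m⇒m%n≡0 0 n (n ∣0))))

  []≡0⇒∣ : ∀ {a} → [ a ] ≡ 0# → n ∣ a
  []≡0⇒∣ {a} eq = m%n≡0⇒n∣m a n (trans ([]-injective eq) (n∣m⇒m%n≡0 0 n (n ∣0)))

  n·≡0 : ∀ x → n · x ≡ 0#
  n·≡0 x = ∣⇒[]≡0 (m∣m*n (toℕ x))

  +-· : ∀ i j x → (i + j) · x ≡ (i · x) ⊕ (j · x)
  +-· i j x = trans (cong [_] (*-distribʳ-+ (toℕ x) i j)) ([]-+ (i * toℕ x) (j * toℕ x))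

  *-· : ∀ i j x → (i * j) · x ≡ i · (j · x)
  *-· i j x = trans (cong [_] (*-assoc i j (toℕ x))) ([]-* i (j * toℕ x))

  1·≡ : ∀ x → 1 · x ≡ x
  1·≡ x = trans (cong [_] (*-identityˡ (toℕ x))) ([toℕ] x)

  -- Multiplication by n - 1 serves as negation.
  pred·⊕ : ∀ x → (pred n · x) ⊕ x ≡ 0#
  pred·⊕ x = begin
    (pred n · x) ⊕ x        ≡⟨ cong ((pred n · x) ⊕_) (1·≡ x) ⟨
    (pred n · x) ⊕ (1 · x)  ≡⟨ +-· (pred n) 1 x ⟨
    (pred n + 1) · x        ≡⟨ cong (_· x) (trans (+-comm (pred n) 1) (suc-pred n)) ⟩
    n · x                   ≡⟨ n·≡0 x ⟩
    0#                      ∎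
    where open ≡-Reasoning

  ⊕-cancelˡ : ∀ x {y z} → x ⊕ y ≡ x ⊕ z → y ≡ z
  ⊕-cancelˡ x {y} {z} eq = trans (sym (undo y)) (trans (cong ((pred n · x) ⊕_) eq) (undo z))
    where
    undo : ∀ y → (pred n · x) ⊕ (x ⊕ y) ≡ y
    undo y = trans (sym (⊕-assoc (pred n · x) x y)) (trans (cong (_⊕ y) (pred·⊕ x)) (⊕-identityˡ y))

  σ : List (Fin n) → Fin n
  σ T = [ sum (map toℕ T) ]

  σ-++ : ∀ S T → σ (S ++ T) ≡ σ S ⊕ σ T
  σ-++ S T = trans (cong (λ l → [ sum l ]) (map-++ toℕ S T))
    (trans (cong [_] (sum-++ (map toℕ S) (map toℕ T))) ([]-+ (sum (map toℕ S)) (sum (map toℕ T))))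

  σ-∷ : ∀ x T → σ (x ∷ T) ≡ x ⊕ σ T
  σ-∷ x T = trans ([]-+ (toℕ x) (sum (map toℕ T))) (cong (_⊕ σ T) ([toℕ] x))

  σ-[x] : ∀ x → σ (x ∷ []) ≡ x
  σ-[x] x = trans (σ-∷ x []) (⊕-identityʳ x)

  σ-replicate : ∀ j x → σ (replicate j x) ≡ j · x
  σ-replicate zero    x = refl
  σ-replicate (suc j) x = trans (σ-∷ x (replicate j x))
    (trans (cong₂ _⊕_ (sym (1·≡ x)) (σ-replicate j x)) (sym (+-· 1 j x)))

-- Scherk's theorem on sumsets.

module Scherk (n : ℕ) {{_ : NonZero n}} where

  open Residues n
  open Counting
  open import Data.Fin using (Fin)
  open import Data.Fin.Properties using (_≟_)
  open import Data.List using (List; []; _∷_; _++_; length; map; filter)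
  open import Data.List.Properties using (length-++; length-map)
  open import Data.List.Membership.Propositional using (_∈_; _∉_; lose; find)
  open import Data.List.Membership.Propositional.Properties
  open import Data.List.Membership.DecPropositional (_≟_ {n}) using (_∈?_)
  open import Data.List.Relation.Unary.Any as Any using (here; there; any?)
  open import Data.List.Relation.Unary.AllPairs using ([]; _∷_)
  open import Data.List.Relation.Unary.Unique.Propositional using (Unique)
  import Data.List.Relation.Unary.Unique.Propositional.Properties as Unique
  open import Data.Nat using (zero; suc; pred; _+_; _≤_; _<_; z≤n; s≤s)
  open import Data.Nat.Properties
  open import Data.Product using (∃₂; _×_; _,_)
  open import Data.Sum using (inj₁; inj₂)
  open import Relation.Binary.PropositionalEquality hiding ([_])
  open import Relation.Nullary using (¬_; contradiction; yes; no)
  open import Relation.Nullary.Decidable using (¬?; decidable-stable)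

  -- Closure under adding b brings all multiples of b into A, in particular (n - 1) b = -b, and -b +
  -- b = 0 falls under the last hypothesis.
  closed⇒zero : ∀ {A b} → 0# ∈ A → (∀ {a} → a ∈ A → a ⊕ b ∈ A) →
    (∀ {a} → a ∈ A → a ⊕ b ≡ 0# → b ≡ 0#) → b ≡ 0#
  closed⇒zero {A} {b} 0∈A closed trivial = trivial (multiple (pred n)) (pred·⊕ b)
    where
    multiple : ∀ j → j · b ∈ A
    multiple zero    = 0∈A
    multiple (suc j) = subst (_∈ A)
      (trans (cong ((j · b) ⊕_) (sym (1·≡ b))) (trans (sym (+-· j 1 b)) (cong (_· b) (+-comm j 1))))
      (closed (multiple j))

  -- Only a lower bound is wanted, so `elements` is some part of A + B with at least |A| + |B| - 1
  -- members. It contains 0 so that it can serve as a summand again.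
  record Sumset (A B : List (Fin n)) : Set where
    field
      elements : List (Fin n)
      unique   : Unique elements
      0∈       : 0# ∈ elements
      sums     : ∀ {c} → c ∈ elements → ∃₂ λ a b → a ∈ A × b ∈ B × c ≡ a ⊕ b
      large    : length A + length B ≤ suc (length elements)

  open Sumset

  -- Dyson's e-transform: the elements b of B with a ⊕ b ∉ A are moved, translated by a, into A.
  scherk : ∀ fuel A B → length B ≤ fuel → Unique A → Unique B → 0# ∈ A → 0# ∈ B →
    (∀ {a b} → a ∈ A → b ∈ B → a ⊕ b ≡ 0# → b ≡ 0#) → Sumset A B
  scherk zero A []      _  _ _ _ () _
  scherk zero A (_ ∷ _) () _ _ _ _ _
  scherk (suc fuel) A B |B|≤ uA uB 0∈A 0∈B trivial
    with any? (λ a → any? (λ b → ¬? (a ⊕ b ∈? A)) B) A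
  ... | no ¬moves = record
    { elements = A
    ; unique   = uA
    ; 0∈       = 0∈A
    ; sums     = λ {c} c∈A → c , 0# , c∈A , 0∈B , sym (⊕-identityʳ c)
    ; large    = ≤-trans (+-monoʳ-≤ (length A) |B|≤1) (≤-reflexive (+-comm (length A) 1))
    }
    where
    closed : ∀ {a b} → a ∈ A → b ∈ B → a ⊕ b ∈ A
    closed a∈A b∈B = decidable-stable (_ ∈? A) λ ∉A → ¬moves (lose a∈A (lose b∈B ∉A))
    -- If nothing moves, A is closed under adding each element of B, which forces B to be at most
    -- {0}.
    |B|≤1 : length B ≤ 1
    |B|≤1 = length-injection (λ b → b) {ys = 0# ∷ []} uB (λ _ _ eq → eq)
      λ b∈B → here (closed⇒zero 0∈A (λ a∈A → closed a∈A b∈B) (λ a∈A → trivial a∈A b∈B))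
  ... | yes moves with find moves
  ... | a , a∈A , moves-a with find moves-a
  ... | b , b∈B , ab∉A = record
    { elements = elements rec
    ; unique   = unique rec
    ; 0∈       = 0∈ rec
    ; sums     = λ c∈ → resum (sums rec c∈)
    ; large    = subst (_≤ suc (length (elements rec))) sizes (large rec)
    }
    where
    stays? = λ b → a ⊕ b ∈? A
    moves? = λ b → ¬? (a ⊕ b ∈? A)
    B₀ = filter stays? B
    B₁ = filter moves? B
    A′ = A ++ map (a ⊕_) B₁
    split : length B₁ + length B₀ ≡ length B
    split = filter-complement moves? stays? (λ ∉ ∈ → ∉ ∈) (λ {x} → decidable-stable (a ⊕ x ∈? A)) B
    -- At least `b` moves, so `B₀` is shorter than `B` and one unit of fuel suffices.
    0<B₁ : 0 < length B₁
    0<B₁ = nonempty (∈-filter⁺ moves? b∈B ab∉A)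
      where
      nonempty : ∀ {x : Fin n} {xs} → x ∈ xs → 0 < length xs
      nonempty (here _)  = s≤s z≤n
      nonempty (there _) = s≤s z≤n
    |B₀|≤ : length B₀ ≤ fuel
    |B₀|≤ = ≤-pred (≤-trans (+-monoˡ-≤ (length B₀) 0<B₁) (≤-trans (≤-reflexive split) |B|≤))
    uA′ : Unique A′
    uA′ = Unique.++⁺ uA (Unique.map⁺ (⊕-cancelˡ a) (Unique.filter⁺ moves? uB)) disjoint
      where
      disjoint : ∀ {v} → ¬ (v ∈ A × v ∈ map (a ⊕_) B₁)
      disjoint (v∈A , v∈) with ∈-map⁻ (a ⊕_) v∈
      ... | b₁ , b₁∈ , refl with ∈-filter⁻ moves? {xs = B} b₁∈
      ... | _ , ∉A = ∉A v∈A
    -- The new case is x = a + b₁. As b₀ stays, a + b₀ lies in A, and (a + b₀) + b₁ = 0 gives b₁ =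
    -- 0. Then a + b₁ = a lies in A, although b₁ moves.
    trivial′ : ∀ {x b₀} → x ∈ A′ → b₀ ∈ B₀ → x ⊕ b₀ ≡ 0# → b₀ ≡ 0#
    trivial′ {x} {b₀} x∈ b₀∈ eq with ∈-filter⁻ stays? {xs = B} b₀∈ | ∈-++⁻ A x∈
    ... | b₀∈B , _   | inj₁ x∈A = trivial x∈A b₀∈B eq
    ... | _ , ab₀∈A  | inj₂ x∈A₁ with ∈-map⁻ (a ⊕_) x∈A₁
    ... | b₁ , b₁∈ , refl with ∈-filter⁻ moves? {xs = B} b₁∈
    ... | b₁∈B , ∉A = contradiction (subst (_∈ A) (sym a⊕b₁≡a) a∈A) ∉A
      where
      b₁≡0 : b₁ ≡ 0#
      b₁≡0 = trivial ab₀∈A b₁∈B (trans (⊕-assoc a b₀ b₁)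
        (trans (cong (a ⊕_) (⊕-comm b₀ b₁)) (trans (sym (⊕-assoc a b₁ b₀)) eq)))
      a⊕b₁≡a : a ⊕ b₁ ≡ a
      a⊕b₁≡a = trans (cong (a ⊕_) b₁≡0) (⊕-identityʳ a)
    rec : Sumset A′ B₀
    rec = scherk fuel A′ B₀ |B₀|≤ uA′ (Unique.filter⁺ stays? uB) (∈-++⁺ˡ 0∈A)
      (∈-filter⁺ stays? 0∈B (subst (_∈ A) (sym (⊕-identityʳ a)) a∈A)) trivial′
    -- No new sums appear: (a + b₁) + b₀ = (a + b₀) + b₁, where a + b₀ is in A because b₀ stays.
    resum : ∀ {c} → (∃₂ λ x b₀ → x ∈ A′ × b₀ ∈ B₀ × c ≡ x ⊕ b₀) →
      ∃₂ λ x y → x ∈ A × y ∈ B × c ≡ x ⊕ y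
    resum (x , b₀ , x∈ , b₀∈ , refl) with ∈-filter⁻ stays? {xs = B} b₀∈ | ∈-++⁻ A x∈
    ... | b₀∈B , _  | inj₁ x∈A = x , b₀ , x∈A , b₀∈B , refl
    ... | b₀∈B , ab₀∈A | inj₂ x∈A₁ with ∈-map⁻ (a ⊕_) x∈A₁
    ... | b₁ , b₁∈ , refl with ∈-filter⁻ moves? {xs = B} b₁∈
    ... | b₁∈B , _ = a ⊕ b₀ , b₁ , ab₀∈A , b₁∈B ,
      trans (⊕-assoc a b₁ b₀) (trans (cong (a ⊕_) (⊕-comm b₁ b₀)) (sym (⊕-assoc a b₀ b₁)))
    sizes : length A′ + length B₀ ≡ length A + length B
    sizes = trans (cong (_+ length B₀) (trans (length-++ A) (cong (length A +_) (length-map (a ⊕_) B₁))))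
      (trans (+-assoc (length A) (length B₁) (length B₀)) (cong (length A +_) split))

-- Subset sums of zero-sum free lists.

module FreeLists (n : ℕ) {{_ : NonZero n}} where

  open Residues n
  open Scherk n
  open Counting
  open import Data.Fin using (Fin)
  open import Data.List using (List; []; _∷_; _++_; length; allFin)
  open import Data.List.Properties using (++-conicalˡ; length-tabulate)
  open import Data.List.Membership.Propositional using (_∈_)
  open import Data.List.Membership.Propositional.Properties using (∈-allFin)
  open import Data.List.Relation.Unary.All as All using (All; []; _∷_)
  open import Data.List.Relation.Unary.Any using (here; there)
  open import Data.List.Relation.Unary.AllPairs using ([]; _∷_)
  open import Data.List.Relation.Unary.Unique.Propositional using (Unique)
  open import Data.List.Relation.Binary.Sublist.Propositional using (_⊆_; []; _∷_; _∷ʳ_; minimum; ⊆-refl; ⊆-trans)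
  open import Data.List.Relation.Binary.Sublist.Propositional.Properties using (++⁺)
  open import Data.Nat using (suc; _+_; _*_; _≤_; s≤s; z≤n)
  open import Data.Nat.Properties
  open import Data.Product using (∃; _×_; _,_)
  open import Relation.Binary.PropositionalEquality hiding ([_])

  -- Lists replace multiplicity vectors here because they can be split into blocks; sublists then
  -- stand for subsequences.
  Free : List (Fin n) → Set
  Free L = ∀ {T} → T ⊆ L → σ T ≡ 0# → T ≡ []

  free-⊆ : ∀ {K L} → K ⊆ L → Free L → Free K
  free-⊆ K⊆L free T⊆K = free (⊆-trans T⊆K K⊆L)

  record SubsetSums (L : List (Fin n)) (s : ℕ) : Set where
    field
      elements : List (Fin n)
      unique   : Unique elements
      0∈       : 0# ∈ elements
      sums     : ∀ {c} → c ∈ elements → ∃ λ T → T ⊆ L × c ≡ σ T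
      large    : s ≤ length elements

  open SubsetSums

  private module S = Sumset

  -- Scherk's theorem for A = subset sums of L and B = subset sums of X. Its hypothesis is zero-sum
  -- freeness: σ U + σ T = 0 forces U and T to be empty. The gain is |B| - 1.
  extend : ∀ {X L B s b} → Free (X ++ L) → Unique B → 0# ∈ B →
    (∀ {b} → b ∈ B → ∃ λ U → U ⊆ X × b ≡ σ U) → length B ≡ suc b →
    SubsetSums L s → SubsetSums (X ++ L) (b + s)
  extend {X} {L} {B} {s} {b} free uB 0∈B fromB |B| A = record
    { elements = S.elements C
    ; unique   = S.unique C
    ; 0∈       = S.0∈ C
    ; sums     = λ c∈ → resum (S.sums C c∈)
    ; large    = ≤-pred (≤-trans (≤-reflexive (trans (cong (_+ s) (sym |B|)) (+-comm (length B) s)))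
                   (≤-trans (+-monoˡ-≤ (length B) (large A)) (S.large C)))
    }
    where
    trivial : ∀ {a b} → a ∈ elements A → b ∈ B → a ⊕ b ≡ 0# → b ≡ 0#
    trivial {a} {b} a∈A b∈B eq with sums A a∈A | fromB b∈B
    ... | T , T⊆L , refl | U , U⊆X , refl = cong σ (++-conicalˡ U T
      (free (++⁺ U⊆X T⊆L) (trans (σ-++ U T) (trans (⊕-comm (σ U) (σ T)) eq))))
    C : Sumset (elements A) B
    C = scherk (length B) (elements A) B ≤-refl (unique A) uB (0∈ A) 0∈B trivial
    resum : ∀ {c} → (∃ λ a → ∃ λ b → a ∈ elements A × b ∈ B × c ≡ a ⊕ b) →
      ∃ λ T → T ⊆ X ++ L × c ≡ σ T
    resum (a , b , a∈A , b∈B , refl) with sums A a∈A | fromB b∈B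
    ... | T , T⊆L , refl | U , U⊆X , refl =
      U ++ T , ++⁺ U⊆X T⊆L , trans (⊕-comm (σ T) (σ U)) (sym (σ-++ U T))

  x≢0 : ∀ {x L} → Free L → x ∷ [] ⊆ L → x ≢ 0#
  x≢0 {x} free x⊆L x≡0 with free x⊆L (trans (σ-[x] x) x≡0)
  ... | ()

  sums-∷ : ∀ {x L s} → Free (x ∷ L) → SubsetSums L s → SubsetSums (x ∷ L) (1 + s)
  sums-∷ {x} free = extend {x ∷ []} {B = 0# ∷ x ∷ []} free
    (((λ 0≡x → x≢0 free (refl ∷ minimum _) (sym 0≡x)) ∷ []) ∷ [] ∷ []) (here refl)
    (λ { (here refl) → [] , minimum _ , refl
       ; (there (here refl)) → x ∷ [] , ⊆-refl , sym (σ-[x] x) }) refl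

  -- The gain 3 comes from the four distinct sums 0, x, y, x + y: freeness keeps x, y and x + y away
  -- from 0, which also separates x + y from x and y.
  sums-pair : ∀ {x y L s} → x ≢ y → Free (x ∷ y ∷ L) → SubsetSums L s → SubsetSums (x ∷ y ∷ L) (3 + s)
  sums-pair {x} {y} {L} x≢y free = extend {x ∷ y ∷ []} {B = 0# ∷ x ∷ y ∷ x ⊕ y ∷ []} free
    ( ((λ 0≡x → x≢0′ (sym 0≡x)) ∷ (λ 0≡y → y≢0 (sym 0≡y)) ∷ (λ 0≡xy → xy≢0 (sym 0≡xy)) ∷ [])
    ∷ (x≢y ∷ (λ x≡xy → y≢0 (⊕-cancelˡ x (trans (sym x≡xy) (sym (⊕-identityʳ x))))) ∷ [])
    ∷ ((λ y≡xy → x≢0′ (⊕-cancelˡ y (trans (⊕-comm y x) (trans (sym y≡xy) (sym (⊕-identityʳ y)))))) ∷ [])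
    ∷ [] ∷ []) (here refl)
    (λ { (here refl) → [] , minimum _ , refl
       ; (there (here refl)) → x ∷ [] , refl ∷ minimum _ , sym (σ-[x] x)
       ; (there (there (here refl))) → y ∷ [] , x ∷ʳ refl ∷ [] , sym (σ-[x] y)
       ; (there (there (there (here refl)))) → x ∷ y ∷ [] , ⊆-refl , sym σxy }) refl
    where
    x≢0′ : x ≢ 0#
    x≢0′ = x≢0 free (refl ∷ minimum _)
    y≢0 : y ≢ 0#
    y≢0 = x≢0 free (x ∷ʳ refl ∷ minimum _)
    σxy : σ (x ∷ y ∷ []) ≡ x ⊕ y
    σxy = trans (σ-∷ x (y ∷ [])) (cong (x ⊕_) (σ-[x] y))
    xy≢0 : x ⊕ y ≢ 0#
    xy≢0 eq with free (refl ∷ refl ∷ minimum L) (trans σxy eq)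
    ... | ()

  flatten : List (Fin n × Fin n) → List (Fin n)
  flatten []            = []
  flatten ((x , y) ∷ P) = x ∷ y ∷ flatten P

  Distinct : Fin n × Fin n → Set
  Distinct (x , y) = x ≢ y

  subsetSums : ∀ P L → All Distinct P → Free (flatten P ++ L) →
    SubsetSums (flatten P ++ L) (1 + (3 * length P + length L))
  subsetSums [] [] [] free = record
    { elements = 0# ∷ []
    ; unique   = [] ∷ []
    ; 0∈       = here refl
    ; sums     = λ { (here refl) → [] , [] , refl }
    ; large    = s≤s z≤n
    }
  subsetSums [] (x ∷ L) [] free = sums-∷ free (subsetSums [] L [] (free-⊆ (x ∷ʳ ⊆-refl) free))
  subsetSums ((x , y) ∷ P) L (x≢y ∷ ds) free = subst (SubsetSums (x ∷ y ∷ flatten P ++ L)) size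
    (sums-pair x≢y free (subsetSums P L ds (free-⊆ (x ∷ʳ y ∷ʳ ⊆-refl) free)))
    where
    size : 3 + (1 + (3 * length P + length L)) ≡ 1 + (3 * suc (length P) + length L)
    size = cong (λ j → 1 + (j + length L)) (sym (*-suc 3 (length P)))

  free-length : ∀ P L → All Distinct P → Free (flatten P ++ L) → 1 + (3 * length P + length L) ≤ n
  free-length P L ds free = ≤-trans (large A) (≤-trans
    (length-injection (λ x → x) {ys = allFin n} (unique A) (λ _ _ eq → eq) (λ _ → ∈-allFin _))
    (≤-reflexive (length-tabulate (λ x → x))))
    where
    A : SubsetSums (flatten P ++ L) (1 + (3 * length P + length L))
    A = subsetSums P L ds free

-- Multiplicity vectors and lists.

module Multisets where

  open import Defs using (Sequence; len; _⊑_)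
  open import Data.Fin using (Fin; zero; suc; toℕ)
  open import Data.Fin.Properties using (_≟_)
  open import Data.List using (List; []; _∷_; _++_; length; map; replicate)
  open import Data.List.Membership.Propositional using (_∈_)
  open import Data.List.Relation.Unary.All as All using ([]; _∷_)
  open import Data.List.Relation.Unary.Any using (here; there)
  open import Data.List.Relation.Binary.Sublist.Propositional using (_⊆_; []; _∷_; _∷ʳ_)
  open import Data.Nat using (zero; suc; _+_; _*_; _≤_; _<_; s≤s; z≤n)
  open import Data.Nat.ListAction using (sum)
  open import Data.Nat.Properties hiding (_≟_)
  open import Data.Nat.Solver using (module +-*-Solver)
  open import Data.Vec as Vec using (Vec; []; _∷_; lookup; updateAt; zipWith; tabulate)
  open import Data.Vec.Properties using (lookup∘updateAt; lookup∘updateAt′; lookup∘tabulate; updateAt-commutes; lookup-replicate)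
  open import Data.Vec.Relation.Binary.Pointwise.Inductive as Pointwise using (Pointwise; []; _∷_)
  open import Relation.Binary.PropositionalEquality
  open import Relation.Nullary using (yes; no; contradiction)

  private variable n : ℕ

  add : Fin n → Sequence n → Sequence n
  add x S = updateAt S x suc

  fromList : List (Fin n) → Sequence n
  fromList []      = Vec.replicate _ 0
  fromList (x ∷ L) = add x (fromList L)

  add-comm : ∀ (x y : Fin n) S → add x (add y S) ≡ add y (add x S)
  add-comm x y S with x ≟ y
  ... | yes refl = refl
  ... | no x≢y   = updateAt-commutes x y x≢y S

  -- Lets a letter be moved out of the middle of a list, since the order is invisible in the
  -- multiset.
  fromList-insert : ∀ us (x : Fin n) vs → fromList (us ++ x ∷ vs) ≡ add x (fromList (us ++ vs))
  fromList-insert []       x vs = refl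
  fromList-insert (u ∷ us) x vs = trans (cong (add u) (fromList-insert us x vs)) (add-comm u x _)

  -- For `w` = `tabulate toℕ` this is the sum in `ZeroSum`. A general weight is carried because the
  -- tail of that vector is not of the same form.
  dot : Sequence n → Vec ℕ n → ℕ
  dot S w = Vec.sum (zipWith _*_ S w)

  dot-add : ∀ (x : Fin n) S w → dot (add x S) w ≡ lookup w x + dot S w
  dot-add zero    (s ∷ S) (v ∷ w) = +-assoc v (s * v) (dot S w)
  dot-add (suc x) (s ∷ S) (v ∷ w) = trans (cong (s * v +_) (dot-add x S w))
    (solve 3 (λ a b c → a :+ (b :+ c) := b :+ (a :+ c)) refl (s * v) (lookup w x) (dot S w))
    where open +-*-Solver

  dot-0 : ∀ (w : Vec ℕ n) → dot (Vec.replicate n 0) w ≡ 0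
  dot-0 []      = refl
  dot-0 (_ ∷ w) = dot-0 w

  dot-fromList : ∀ (L : List (Fin n)) → dot (fromList L) (tabulate toℕ) ≡ sum (map toℕ L)
  dot-fromList {n} []  = dot-0 {n} (tabulate toℕ)
  dot-fromList (x ∷ L) = trans (dot-add x (fromList L) (tabulate toℕ))
    (cong₂ _+_ (lookup∘tabulate toℕ x) (dot-fromList L))

  len-add : ∀ (x : Fin n) S → len (add x S) ≡ suc (len S)
  len-add zero    (s ∷ S) = refl
  len-add (suc x) (s ∷ S) = trans (cong (s +_) (len-add x S)) (+-suc s (len S))

  len-0 : ∀ n → len (Vec.replicate n 0) ≡ 0
  len-0 zero    = refl
  len-0 (suc n) = len-0 n

  len-fromList : ∀ (L : List (Fin n)) → len (fromList L) ≡ length L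
  len-fromList {n} []  = len-0 n
  len-fromList (x ∷ L) = trans (len-add x (fromList L)) (cong suc (len-fromList L))

  len-mono : ∀ {S T : Sequence n} → S ⊑ T → len S ≤ len T
  len-mono []         = z≤n
  len-mono (s≤t ∷ ≤s) = +-mono-≤ s≤t (len-mono ≤s)

  ⊑-replicate : ∀ (S : Sequence n) {c} → len S ≤ c → S ⊑ Vec.replicate n c
  ⊑-replicate []      len≤c = []
  ⊑-replicate (s ∷ S) len≤c = m+n≤o⇒m≤o s len≤c ∷ ⊑-replicate S (m+n≤o⇒n≤o s len≤c)

  ⊑-lookup : ∀ {S T : Sequence n} → S ⊑ T → ∀ x → lookup S x ≤ lookup T x
  ⊑-lookup S⊑T x = Pointwise.lookup S⊑T x

  ⊑-add : ∀ (x : Fin n) {S T} → S ⊑ T → S ⊑ add x T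
  ⊑-add zero    (s≤t ∷ ≤s) = m≤n⇒m≤1+n s≤t ∷ ≤s
  ⊑-add (suc x) (s≤t ∷ ≤s) = s≤t ∷ ⊑-add x ≤s

  add-mono : ∀ (x : Fin n) {S T} → S ⊑ T → add x S ⊑ add x T
  add-mono zero    (s≤t ∷ ≤s) = s≤s s≤t ∷ ≤s
  add-mono (suc x) (s≤t ∷ ≤s) = s≤t ∷ add-mono x ≤s

  fromList-mono : ∀ {K L : List (Fin n)} → K ⊆ L → fromList K ⊑ fromList L
  fromList-mono []           = Pointwise.refl ≤-refl
  fromList-mono (x ∷ʳ K⊆L)   = ⊑-add x (fromList-mono K⊆L)
  fromList-mono (refl ∷ K⊆L) = add-mono _ (fromList-mono K⊆L)

  ∈⇒positive : ∀ {x : Fin n} {L} → x ∈ L → 0 < lookup (fromList L) x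
  ∈⇒positive {x = x} {y ∷ L} x∈ with x ≟ y
  ... | yes refl = subst (0 <_) (sym (lookup∘updateAt x (fromList L))) (s≤s z≤n)
  ∈⇒positive (here x≡y)  | no x≢y = contradiction x≡y x≢y
  ∈⇒positive {x = x} {y ∷ L} (there x∈L) | no x≢y =
    subst (0 <_) (sym (lookup∘updateAt′ x y x≢y (fromList L))) (∈⇒positive x∈L)

  positive⇒∈ : ∀ {x : Fin n} L → 0 < lookup (fromList L) x → x ∈ L
  positive⇒∈ {x = x} []      0< = contradiction (subst (0 <_) (lookup-replicate x 0) 0<) λ ()
  positive⇒∈ {x = x} (y ∷ L) 0< with x ≟ y
  ... | yes x≡y = here x≡y
  ... | no  x≢y = there (positive⇒∈ L (subst (0 <_) (lookup∘updateAt′ x y x≢y (fromList L)) 0<))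

  toList : Sequence n → List (Fin n)
  toList []      = []
  toList (s ∷ S) = replicate s zero ++ map suc (toList S)

  fromList-suc : ∀ (L : List (Fin n)) → fromList (map suc L) ≡ 0 ∷ fromList L
  fromList-suc []      = refl
  fromList-suc (x ∷ L) = cong (add (suc x)) (fromList-suc L)

  fromList-zeros : ∀ s (L : List (Fin n)) → fromList (replicate s zero ++ map suc L) ≡ s ∷ fromList L
  fromList-zeros zero    L = fromList-suc L
  fromList-zeros (suc s) L = cong (add zero) (fromList-zeros s L)

  fromList-toList : ∀ (S : Sequence n) → fromList (toList S) ≡ S
  fromList-toList []      = refl
  fromList-toList (s ∷ S) = trans (fromList-zeros s (toList S)) (cong (s ∷_) (fromList-toList S))

-- Structure of long zero-sum free sequences.

module Structure (n : ℕ) {{_ : NonZero n}} where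

  open Residues n
  open FreeLists n
  open Multisets
  open import Defs using (Sequence; len; ZeroSumFree; IsGenerator)
  open import Data.Fin using (Fin; zero; suc; toℕ)
  open import Data.Fin.Properties using (_≟_; toℕ<n)
  open import Data.List using (List; []; _∷_; _++_; length; map; replicate)
  open import Data.List.Properties using (length-++; length-map; length-replicate; map-++; map-replicate; ++-assoc)
  open import Data.List.Membership.Propositional using (_∈_)
  open import Data.List.Relation.Unary.All as All using (All; []; _∷_)
  import Data.List.Relation.Unary.All.Properties as All
  open import Data.List.Relation.Binary.Sublist.Propositional using (_⊆_; []; _∷_; minimum; ⊆-refl; from∈)
  open import Data.List.Relation.Binary.Sublist.Propositional.Properties using (++⁺; ++⁺ˡ)
  open import Data.Nat using (zero; suc; pred; _+_; _*_; _∸_; _≤_; _<_; s≤s; z≤n)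
  open import Data.Nat.Properties hiding (_≟_)
  open import Data.Nat.Coprimality using (Coprime; coprime-Bézout)
  open import Data.Nat.Divisibility
  open import Data.Nat.DivMod
  open import Data.Nat.GCD using (module Bézout)
  open import Data.Nat.Solver using (module +-*-Solver)
  open import Data.Product using (∃; _×_; _,_; proj₁; proj₂)
  open import Relation.Binary.PropositionalEquality hiding ([_])
  open import Relation.Nullary using (¬_; yes; no; contradiction)
  open +-*-Solver

  zeroSumFree⇒free : ∀ L → ZeroSumFree (fromList L) → Free L
  zeroSumFree⇒free L zsf {[]}    T⊆L σ≡0 = refl
  zeroSumFree⇒free L zsf {x ∷ T} T⊆L σ≡0 = contradiction
    (subst (n ∣_) (sym (dot-fromList (x ∷ T))) ([]≡0⇒∣ σ≡0))
    (zsf (fromList (x ∷ T)) (fromList-mono T⊆L)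
      (subst (0 <_) (sym (len-fromList (x ∷ T))) (s≤s z≤n)))

  replicate-⊆ : ∀ {A : Set} {x : A} {i j} → i ≤ j → replicate i x ⊆ replicate j x
  replicate-⊆ z≤n       = minimum _
  replicate-⊆ (s≤s i≤j) = refl ∷ replicate-⊆ i≤j

  record Grouping (L : List (Fin n)) : Set where
    field
      pairs    : List (Fin n × Fin n)
      g        : Fin n
      m        : ℕ
      distinct : All Distinct pairs
      regroup  : fromList L ≡ fromList (flatten pairs ++ replicate m g)

  -- Greedy pairing: a stock of copies of one element `g` is kept. A letter equal to `g` joins the
  -- stock, any other is paired with a copy of `g`, and an empty stock is restarted with the new
  -- letter.
  grouping : ∀ L → Grouping L
  -- With an empty stock `g` carries no information; `0#` is a placeholder.
  grouping []      = record { pairs = [] ; g = 0# ; m = 0 ; distinct = [] ; regroup = refl }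
  grouping (x ∷ L) with grouping L
  ... | record { pairs = P ; m = zero ; distinct = ds ; regroup = eq } =
    record { pairs = P ; g = x ; m = 1 ; distinct = ds
           ; regroup = trans (cong (add x) eq) (sym (fromList-insert (flatten P) x [])) }
  ... | record { pairs = P ; g = g ; m = suc m ; distinct = ds ; regroup = eq } with x ≟ g
  ... | yes refl =
    record { pairs = P ; g = g ; m = suc (suc m) ; distinct = ds
           ; regroup = trans (cong (add x) eq) (sym (fromList-insert (flatten P) x (replicate (suc m) x))) }
  ... | no x≢g =
    record { pairs = (x , g) ∷ P ; g = g ; m = m ; distinct = x≢g ∷ ds
           ; regroup = cong (add x) (trans eq (fromList-insert (flatten P) g (replicate m g))) }

  generator-multiple : ∀ {g} → IsGenerator g → ∀ x → ∃ λ j → j · g ≡ x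
  generator-multiple gen x with gen x
  ... | j , eq = j , trans ([]-cong (trans eq (sym (m<n⇒m%n≡m (toℕ<n x))))) ([toℕ] x)

  multiple⇒generator : ∀ {g} u → u · g ≡ [ 1 ] → IsGenerator g
  multiple⇒generator {g} u eq x = toℕ x * u , trans (sym (toℕ-[] _)) (cong toℕ
    (trans (*-· (toℕ x) u g) (trans (cong (toℕ x ·_) eq)
      (trans (sym ([]-* (toℕ x) 1)) (trans (cong [_] (*-identityʳ (toℕ x))) ([toℕ] x))))))

  coprime⇒generator : ∀ {g} → Coprime (toℕ g) n → IsGenerator g
  coprime⇒generator {g} coprime with coprime-Bézout coprime
  ... | Bézout.+- x y eq = multiple⇒generator x (trans (cong [_] (sym eq))
    (trans ([]-+ 1 (y * n)) (trans (cong ([ 1 ] ⊕_) (∣⇒[]≡0 (n∣m*n y))) (⊕-identityʳ [ 1 ]))))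
  -- Here 1 + x g = y n, so x g = -1, and the factor `pred n` turns this into 1.
  ... | Bézout.-+ x y eq = multiple⇒generator (pred n * x) (trans (*-· (pred n) x g)
    (⊕-cancelˡ (x · g) (trans (⊕-comm (x · g) _) (trans (pred·⊕ (x · g)) (sym
      (trans (⊕-comm (x · g) [ 1 ]) (trans (sym ([]-+ 1 (x * toℕ g)))
        (trans (cong [_] eq) (∣⇒[]≡0 (n∣m*n y))))))))))

  generator-order : ∀ {g j} → IsGenerator g → n ∣ j * toℕ g → n ∣ j
  generator-order {g} {j} gen n∣jg with generator-multiple gen [ 1 ]
  ... | u , ug≡1 = []≡0⇒∣ (begin
    [ j ]              ≡⟨ cong [_] (*-identityʳ j) ⟨
    [ j * 1 ]          ≡⟨ []-* j 1 ⟩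
    j · [ 1 ]          ≡⟨ cong (j ·_) ug≡1 ⟨
    j · (u · g)        ≡⟨ *-· j u g ⟨
    (j * u) · g        ≡⟨ cong (_· g) (*-comm j u) ⟩
    (u * j) · g        ≡⟨ *-· u j g ⟩
    u · (j · g)        ≡⟨ cong (u ·_) (∣⇒[]≡0 n∣jg) ⟩
    u · 0#             ≡⟨ []-* u 0 ⟨
    [ u * 0 ]          ≡⟨ cong [_] (*-zeroʳ u) ⟩
    0#                 ∎)
    where open ≡-Reasoning

  -- A common divisor d ≥ 2 of g and n would make n / d copies of g sum to zero, and n / d ≤ n / 2 ≤
  -- m copies are available.
  free⇒generator : ∀ {g m} → n ≤ m + m → Free (replicate m g) → IsGenerator g
  free⇒generator {g} {m} n≤2m free = coprime⇒generator λ {d} → coprime {d}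
    where
    ¬short : ∀ q → q ≤ m → 0 < q → ¬ n ∣ q * toℕ g
    ¬short (suc q) q≤m _ n∣qg with free (replicate-⊆ q≤m) (trans (σ-replicate (suc q) g) (∣⇒[]≡0 n∣qg))
    ... | ()
    coprime : Coprime (toℕ g) n
    coprime {zero}        (_ , 0∣n) = contradiction (0∣⇒≡0 0∣n) (m<n⇒n≢0 (toℕ<n g))
    coprime {suc zero}    _ = refl
    coprime {suc (suc d)} (divides r g≡ , divides q n≡) = contradiction n∣qg (¬short q q≤m 0<q)
      where
      0<q : 0 < q
      0<q = n≢0⇒n>0 λ q≡0 → m<n⇒n≢0 (toℕ<n g) (trans n≡ (cong (_* suc (suc d)) q≡0))
      q≤m : q ≤ m
      q≤m = ≮⇒≥ λ m<q → <⇒≱ (≤-<-trans n≤2m (+-mono-< m<q m<q))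
        (subst (q + q ≤_) (sym n≡) (≤-trans (≤-reflexive (trans (sym (cong (q +_) (+-identityʳ q))) (*-comm 2 q)))
          (*-monoʳ-≤ q (s≤s (s≤s z≤n)))))
      n∣qg : n ∣ q * toℕ g
      n∣qg = divides r (trans (cong (q *_) g≡) (trans
        (solve 3 (λ q r e → q :* (r :* e) := r :* (q :* e)) refl q r (suc (suc d))) (cong (r *_) (sym n≡))))

  -- Write x = b g with b < n. Then x and n - b copies of g sum to zero, so n - b exceeds m, that is
  -- b ≤ K; and b = 0 is excluded by x ≠ 0.
  free⇒multiple : ∀ {x g m K} → n ≤ suc (m + K) → IsGenerator g → Free (x ∷ replicate m g) →
    ∃ λ b → 1 ≤ b × b ≤ K × b · g ≡ x
  free⇒multiple {x} {g} {m} {K} n≤ gen free with generator-multiple gen x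
  ... | j , jg≡x = b , n≢0⇒n>0 b≢0 , b≤K , bg≡x
    where
    b = j % n
    bg≡x : b · g ≡ x
    bg≡x = trans ([]-cong (trans (%-distribˡ-* (j % n) (toℕ g) n)
      (trans (cong (λ i → (i * (toℕ g % n)) % n) (m%n%n≡m%n j n)) (sym (%-distribˡ-* j (toℕ g) n))))) jg≡x
    b≢0 : b ≢ 0
    b≢0 b≡0 = x≢0 free (refl ∷ minimum _) (trans (sym bg≡x) (cong (_· g) b≡0))
    b≤n : b ≤ n
    b≤n = <⇒≤ (m%n<n j n)
    sum≡0 : σ (x ∷ replicate (n ∸ b) g) ≡ 0#
    sum≡0 = begin
      σ (x ∷ replicate (n ∸ b) g)      ≡⟨ σ-∷ x (replicate (n ∸ b) g) ⟩
      x ⊕ σ (replicate (n ∸ b) g)      ≡⟨ cong₂ _⊕_ (sym bg≡x) (σ-replicate (n ∸ b) g) ⟩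
      (b · g) ⊕ ((n ∸ b) · g)          ≡⟨ +-· b (n ∸ b) g ⟨
      (b + (n ∸ b)) · g                ≡⟨ cong (_· g) (m+[n∸m]≡n b≤n) ⟩
      n · g                            ≡⟨ n·≡0 g ⟩
      0#                               ∎
      where open ≡-Reasoning
    m<n∸b : m < n ∸ b
    m<n∸b = ≰⇒> λ n∸b≤m → impossible (free (refl ∷ replicate-⊆ n∸b≤m) sum≡0)
      where
      impossible : ¬ (x ∷ replicate (n ∸ b) g ≡ [])
      impossible ()
    b≤K : b ≤ K
    b≤K = +-cancelˡ-≤ m b K (≤-pred (≤-trans
      (≤-trans (+-monoˡ-≤ b m<n∸b) (≤-reflexive (m∸n+n≡m b≤n))) n≤))

  lettersOf : ∀ {g K} L → All (λ x → ∃ λ b → 1 ≤ b × b ≤ K × b · g ≡ x) L →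
    ∃ λ w → map (_· g) w ≡ L × All (λ b → 1 ≤ b × b ≤ K) w
  lettersOf []      []                              = [] , refl , []
  lettersOf (x ∷ L) ((b , 1≤b , b≤K , bg≡x) ∷ all) with lettersOf L all
  ... | w , eq , letters = b ∷ w , cong₂ _∷_ bg≡x eq , (1≤b , b≤K) ∷ letters

  length-flatten : ∀ P → length (flatten P) ≡ 2 * length P
  length-flatten []      = refl
  length-flatten (_ ∷ P) = trans (cong (2 +_) (length-flatten P)) (sym (*-suc 2 (length P)))

  -- The word always has 2k letters, whatever the number of pairs, so that one finite list of words
  -- serves all sequences.
  build : ℕ → ℕ → Fin n → List ℕ → Sequence n
  build k ℓ g w = fromList (map (_· g) w ++ replicate (ℓ ∸ 2 * k) g)

  record Decomposition (k ℓ : ℕ) (S : Sequence n) : Set where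
    field
      g         : Fin n
      word      : List ℕ
      generator : IsGenerator g
      letters   : All (λ b → 1 ≤ b × b ≤ 3 * k) word
      size      : length word ≡ 2 * k
      equation  : S ≡ build k ℓ g word

  -- With t pairs and m copies left over, n = 2t + m + k + 1, while there are at least 1 + 3t + m
  -- subset sums. Hence t ≤ k and n ≤ m + 3k + 1, and `free⇒multiple` applies to each paired element
  -- with K = 3k.
  decompose : ∀ {k ℓ} → 6 * k + 2 ≤ n → ℓ + suc k ≡ n →
    ∀ S → ZeroSumFree S → len S ≡ ℓ → Decomposition k ℓ S
  decompose {k} {ℓ} big ℓ+ S zsf |S| = record
    { g         = g
    ; word      = word
    ; generator = gen
    ; letters   = letters
    ; size      = size
    ; equation  = trans S≡ (cong fromList (sym list-eq))
    }
    where
    open Grouping (grouping (toList S))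
    P = pairs
    t = length P
    S≡ : S ≡ fromList (flatten P ++ replicate m g)
    S≡ = trans (sym (fromList-toList S)) regroup
    free : Free (flatten P ++ replicate m g)
    free = zeroSumFree⇒free _ (subst ZeroSumFree S≡ zsf)
    2t+m≡ℓ : 2 * t + m ≡ ℓ
    2t+m≡ℓ = begin
      2 * t + m                                     ≡⟨ cong₂ _+_ (length-flatten P) (length-replicate m) ⟨
      length (flatten P) + length (replicate m g)   ≡⟨ length-++ (flatten P) ⟨
      length (flatten P ++ replicate m g)           ≡⟨ len-fromList (flatten P ++ replicate m g) ⟨
      len (fromList (flatten P ++ replicate m g))   ≡⟨ cong len S≡ ⟨
      len S                                         ≡⟨ |S| ⟩
      ℓ                                             ∎
      where open ≡-Reasoning
    n≡ : n ≡ (2 * t + m) + suc k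
    n≡ = trans (sym ℓ+) (cong (_+ suc k) (sym 2t+m≡ℓ))
    t≤k : t ≤ k
    t≤k = +-cancelˡ-≤ (suc (2 * t + m)) t k (begin
      suc (2 * t + m) + t    ≡⟨ solve 2 (λ t m → con 1 :+ (con 2 :* t :+ m) :+ t := con 1 :+ (con 3 :* t :+ m)) refl t m ⟩
      suc (3 * t + m)        ≡⟨ cong (λ j → suc (3 * t + j)) (length-replicate m) ⟨
      suc (3 * t + length (replicate m g)) ≤⟨ free-length P (replicate m g) distinct free ⟩
      n                      ≡⟨ n≡ ⟩
      (2 * t + m) + suc k    ≡⟨ +-suc (2 * t + m) k ⟩
      suc (2 * t + m) + k    ∎)
      where open ≤-Reasoning
    n≤ : n ≤ suc (m + 3 * k)
    n≤ = begin
      n                      ≡⟨ n≡ ⟩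
      (2 * t + m) + suc k    ≤⟨ +-monoˡ-≤ (suc k) (+-monoˡ-≤ m (*-monoʳ-≤ 2 t≤k)) ⟩
      (2 * k + m) + suc k    ≡⟨ solve 2 (λ k m → (con 2 :* k :+ m) :+ (con 1 :+ k) := con 1 :+ (m :+ con 3 :* k)) refl k m ⟩
      suc (m + 3 * k)        ∎
      where open ≤-Reasoning
    -- The origin of the threshold 6k + 2: together with n ≤ m + 3k + 1 it makes the copies of g at
    -- least half of n.
    3k<m : 3 * k + 1 ≤ m
    3k<m = +-cancelˡ-≤ (3 * k + 1) (3 * k + 1) m (begin
      (3 * k + 1) + (3 * k + 1)   ≡⟨ solve 1 (λ k → (con 3 :* k :+ con 1) :+ (con 3 :* k :+ con 1) := con 6 :* k :+ con 2) refl k ⟩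
      6 * k + 2                   ≤⟨ big ⟩
      n                           ≤⟨ n≤ ⟩
      suc (m + 3 * k)             ≡⟨ solve 2 (λ k m → con 1 :+ (m :+ con 3 :* k) := (con 3 :* k :+ con 1) :+ m) refl k m ⟩
      (3 * k + 1) + m             ∎)
      where open ≤-Reasoning
    n≤2m : n ≤ m + m
    n≤2m = ≤-trans n≤ (≤-trans (≤-reflexive (solve 2 (λ k m → con 1 :+ (m :+ con 3 :* k) := m :+ (con 3 :* k :+ con 1)) refl k m))
      (+-monoʳ-≤ m 3k<m))
    gen : IsGenerator g
    gen = free⇒generator n≤2m (free-⊆ (++⁺ˡ (flatten P) ⊆-refl) free)
    lets : ∃ λ w → map (_· g) w ≡ flatten P × All (λ b → 1 ≤ b × b ≤ 3 * k) w
    lets = lettersOf (flatten P) (All.tabulate λ x∈ →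
      free⇒multiple n≤ gen (free-⊆ (++⁺ (from∈ x∈) ⊆-refl) free))
    w = proj₁ lets
    -- The letter 1 stands for g itself, so copies of g can be moved into the word until it has
    -- length 2k.
    pad = 2 * k ∸ 2 * t
    word = w ++ replicate pad 1
    2t≤2k = *-monoʳ-≤ 2 t≤k
    -- For k = 0 the alphabet is empty; the letter 1 has to be admissible only if there is something
    -- to pad.
    1≤3k : 0 < pad → 1 ≤ 3 * k
    1≤3k 0<pad = ≤-trans (≤-trans 0<pad (m∸n≤m (2 * k) (2 * t))) (*-monoˡ-≤ k {2} {3} (s≤s (s≤s z≤n)))
    pads : ∀ j → (0 < j → 1 ≤ 3 * k) → All (λ b → 1 ≤ b × b ≤ 3 * k) (replicate j 1)
    pads zero    _   = []
    pads (suc j) ≤3k = (s≤s z≤n , ≤3k (s≤s z≤n)) ∷ pads j (λ _ → ≤3k (s≤s z≤n))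
    letters : All (λ b → 1 ≤ b × b ≤ 3 * k) word
    letters = All.++⁺ (proj₂ (proj₂ lets)) (pads pad 1≤3k)
    |w| : length w ≡ 2 * t
    |w| = trans (sym (length-map (_· g) w)) (trans (cong length (proj₁ (proj₂ lets))) (length-flatten P))
    size : length word ≡ 2 * k
    size = trans (length-++ w) (trans (cong₂ _+_ |w| (length-replicate pad)) (m+[n∸m]≡n 2t≤2k))
    2k≤ℓ : 2 * k ≤ ℓ
    2k≤ℓ = ≤-trans (≤-trans (*-monoˡ-≤ k {2} {3} (s≤s (s≤s z≤n))) (≤-trans (m≤m+n (3 * k) 1) 3k<m))
      (subst (m ≤_) 2t+m≡ℓ (m≤n+m m (2 * t)))
    pad+ : pad + (ℓ ∸ 2 * k) ≡ m
    pad+ = +-cancelˡ-≡ (2 * t) (pad + (ℓ ∸ 2 * k)) m (begin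
      2 * t + (pad + (ℓ ∸ 2 * k))   ≡⟨ +-assoc (2 * t) pad _ ⟨
      2 * t + pad + (ℓ ∸ 2 * k)     ≡⟨ cong (_+ (ℓ ∸ 2 * k)) (m+[n∸m]≡n 2t≤2k) ⟩
      2 * k + (ℓ ∸ 2 * k)           ≡⟨ m+[n∸m]≡n 2k≤ℓ ⟩
      ℓ                             ≡⟨ 2t+m≡ℓ ⟨
      2 * t + m                     ∎)
      where open ≡-Reasoning
    list-eq : map (_· g) word ++ replicate (ℓ ∸ 2 * k) g ≡ flatten P ++ replicate m g
    list-eq = begin
      map (_· g) word ++ rest
        ≡⟨ cong (_++ rest) (map-++ (_· g) w (replicate pad 1)) ⟩
      (map (_· g) w ++ map (_· g) (replicate pad 1)) ++ rest
        ≡⟨ ++-assoc (map (_· g) w) _ rest ⟩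
      map (_· g) w ++ (map (_· g) (replicate pad 1) ++ rest)
        ≡⟨ cong₂ (λ us vs → us ++ (vs ++ rest)) (proj₁ (proj₂ lets))
             (trans (map-replicate (_· g) pad 1) (cong (replicate pad) (1·≡ g))) ⟩
      flatten P ++ (replicate pad g ++ rest)
        ≡⟨ cong (flatten P ++_) (replicate-+ pad (ℓ ∸ 2 * k)) ⟨
      flatten P ++ replicate (pad + (ℓ ∸ 2 * k)) g
        ≡⟨ cong (λ j → flatten P ++ replicate j g) pad+ ⟩
      flatten P ++ replicate m g ∎
      where
      open ≡-Reasoning
      rest = replicate (ℓ ∸ 2 * k) g
      replicate-+ : ∀ i j → replicate (i + j) g ≡ replicate i g ++ replicate j g
      replicate-+ zero    j = refl
      replicate-+ (suc i) j = cong (g ∷_) (replicate-+ i j)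

-- Words over a finite alphabet of coefficients.

module Words where

  open import Data.List using (List; []; _∷_; length; map; concatMap; upTo)
  open import Data.List.Membership.Propositional using (_∈_; lose)
  open import Data.List.Membership.Propositional.Properties using (∈-concatMap⁺; ∈-map⁺; ∈-upTo⁺)
  open import Data.List.Relation.Unary.All using (All; []; _∷_)
  open import Data.List.Relation.Unary.Any using (here)
  open import Data.Nat using (zero; suc; _≤_)
  open import Data.Product using (_×_; _,_)
  open import Relation.Binary.PropositionalEquality using (_≡_; refl)

  words : ℕ → ℕ → List (List ℕ)
  words K zero    = [] ∷ []
  words K (suc j) = concatMap (λ b → map (b ∷_) (words K j)) (map suc (upTo K))

  ∈-words : ∀ {K j} w → All (λ b → 1 ≤ b × b ≤ K) w → length w ≡ j → w ∈ words K j
  ∈-words []      []                     refl = here refl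
  ∈-words (suc b ∷ w) ((_ , b<K) ∷ ≤K) refl =
    ∈-concatMap⁺ _ (lose (∈-map⁺ suc (∈-upTo⁺ b<K)) (∈-map⁺ _ (∈-words w ≤K refl)))

-- The count between numbers of generators.

module Sandwich (n : ℕ) {{_ : NonZero n}} where

  open Counting
  open Words
  open Residues n
  open Multisets
  open Structure n
  open import Defs using (Sequence; len; ZeroSumFree; ZeroSumFree?; ContainedIn; ContainedIn?; _⊑_; IsGenerator; IsGenerator?; subsequences; ∈-subsequences; sequencesOfLength; #zeroSumFree)
  open import Data.Fin using (Fin; zero; suc; toℕ)
  open import Data.Fin.Subset using (Subset) renaming (_∈_ to _∈ˢ_)
  open import Data.Fin.Subset.Properties using (_∈?_)
  open import Data.List using (List; []; _∷_; _++_; length; map; replicate; filter; concatMap; upTo; allFin)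
  open import Data.List.Properties using (length-++; length-map; length-replicate; map-cong)
  open import Data.List.Membership.Propositional using (_∈_; lose)
  open import Data.List.Membership.Propositional.Properties
  open import Data.List.Relation.Unary.All as All using (All; []; _∷_)
  import Data.List.Relation.Unary.All.Properties as All
  open import Data.List.Relation.Unary.Any using (here; there)
  open import Data.List.Relation.Unary.AllPairs as AllPairs using ([]; _∷_)
  import Data.List.Relation.Unary.AllPairs.Properties as AllPairs
  open import Data.List.Relation.Unary.Unique.Propositional using (Unique)
  import Data.List.Relation.Unary.Unique.Propositional.Properties as Unique
  open import Data.Nat using (zero; suc; _+_; _*_; _∸_; _≤_; _<_; s≤s; z≤n; _≟_; >-nonZero)
  open import Data.Nat.Divisibility using (_∣_; >⇒∤)
  open import Data.Nat.ListAction using (sum)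
  open import Data.Nat.Properties hiding (_≟_)
  open import Data.Nat.Solver using (module +-*-Solver)
  open import Data.Product using (∃; _×_; _,_; proj₂)
  open import Data.Sum using (_⊎_; inj₁; inj₂)
  open import Data.Vec as Vec using ([]; _∷_; lookup)
  import Data.Vec.Properties as Vec
  open import Relation.Binary.PropositionalEquality hiding ([_])
  open import Relation.Nullary using (¬_)
  open import Relation.Nullary.Decidable using (_×-dec_)
  open +-*-Solver

  generators : List (Fin n)
  generators = filter IsGenerator? (allFin n)

  generators-unique : Unique generators
  generators-unique = Unique.filter⁺ IsGenerator? (Unique.allFin⁺ n)

  ∈-generators⁺ : ∀ {g} → IsGenerator g → g ∈ generators
  ∈-generators⁺ gen = ∈-filter⁺ IsGenerator? (∈-allFin _) gen

  ∈-generators⁻ : ∀ {g} → g ∈ generators → IsGenerator g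
  ∈-generators⁻ g∈ = proj₂ (∈-filter⁻ IsGenerator? {xs = allFin n} g∈)

  generatorsIn : Subset n → List (Fin n)
  generatorsIn R = filter (_∈? R) generators

  generatorPairsIn : ℕ → Subset n → List (Fin n)
  generatorPairsIn b R = filter (λ g → (g ∈? R) ×-dec (b · g ∈? R)) generators

  length-concatMap : ∀ {A B : Set} (f : A → List B) xs → length (concatMap f xs) ≡ sum (map (λ x → length (f x)) xs)
  length-concatMap f []       = refl
  length-concatMap f (x ∷ xs) = trans (length-++ (f x)) (cong (length (f x) +_) (length-concatMap f xs))

  sum-map-const : ∀ {A : Set} c (xs : List A) → sum (map (λ _ → c) xs) ≡ length xs * c
  sum-map-const c []       = refl
  sum-map-const c (x ∷ xs) = cong (c +_) (sum-map-const c xs)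

  -- The dichotomy behind the two counts: the all-ones word yields the power of g, and any other
  -- word forces some b g with b ≥ 2 into R as well.
  all-ones-or-big : ∀ {K} w → All (λ b → 1 ≤ b × b ≤ K) w →
    w ≡ replicate (length w) 1 ⊎ ∃ λ i → 2 + i ∈ w × i < K
  all-ones-or-big [] [] = inj₁ refl
  -- The letter 2 + i ≤ K would give i < K - 1; this is weakened to i < K to match `upTo`.
  all-ones-or-big (suc (suc i) ∷ w) ((_ , i<K) ∷ _) = inj₂ (i , here refl , ≤-trans (n≤1+n (suc i)) i<K)
  all-ones-or-big (suc zero ∷ w) (_ ∷ ≤K) with all-ones-or-big w ≤K
  ... | inj₁ eq             = inj₁ (cong (1 ∷_) eq)
  ... | inj₂ (i , i∈ , i<K) = inj₂ (i , there i∈ , i<K)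

  subsequences-unique : ∀ {m} (S : Sequence m) → Unique (subsequences S)
  subsequences-unique []      = [] ∷ []
  subsequences-unique (s ∷ S) = Unique.concat⁺
    (All.map⁺ (All.tabulate λ {t} _ → Unique.map⁺ Vec.∷-injectiveʳ (subsequences-unique S)))
    (AllPairs.map⁺ (AllPairs.map disjoint (Unique.upTo⁺ (suc s))))
    where
    disjoint : ∀ {t u} → t ≢ u → ∀ {T} → ¬ (T ∈ map (t ∷_) (subsequences S) × T ∈ map (u ∷_) (subsequences S))
    disjoint t≢u (T∈ , T∈′) with ∈-map⁻ _ T∈ | ∈-map⁻ _ T∈′
    ... | _ , _ , refl | _ , _ , eq = t≢u (Vec.∷-injectiveˡ eq)

  module _ (k ℓ : ℕ) (big : 6 * k + 2 ≤ n) (ℓ+ : ℓ + suc k ≡ n) (R : Subset n) where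

    counted : List (Sequence n)
    counted = filter (λ S → ZeroSumFree? S ×-dec ContainedIn? S R) (sequencesOfLength n ℓ)

    private
      -- At least one copy of g remains outside the word, which puts g itself into R.
      2k<ℓ : 2 * k < ℓ
      2k<ℓ = +-cancelʳ-≤ (suc k) (suc (2 * k)) ℓ (begin
        suc (2 * k) + suc k   ≡⟨ solve 1 (λ k → (con 1 :+ con 2 :* k) :+ (con 1 :+ k) := con 3 :* k :+ con 2) refl k ⟩
        3 * k + 2             ≤⟨ +-monoˡ-≤ 2 (*-monoˡ-≤ k {3} {6} (s≤s (s≤s (s≤s z≤n)))) ⟩
        6 * k + 2             ≤⟨ big ⟩
        n                     ≡⟨ ℓ+ ⟨
        ℓ + suc k             ∎)
        where open ≤-Reasoning

      ℓ<n : ℓ < n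
      ℓ<n = subst (ℓ <_) ℓ+ (m<m+n ℓ (s≤s z≤n))

      0<ℓ : 0 < ℓ
      0<ℓ = ≤-<-trans z≤n 2k<ℓ

    contained-∈ : ∀ L → ContainedIn (fromList L) R → ∀ {x} → x ∈ L → x ∈ˢ R
    contained-∈ L ⊆R {x} x∈L = ⊆R x (∈⇒positive x∈L)

    -- Repetitions and sequences that are not zero-sum free are tolerated, because only the length
    -- of this list is used, as an upper bound.
    candidates : List (Sequence n)
    candidates = map (λ g → build k ℓ g (replicate (2 * k) 1)) (generatorsIn R)
      ++ concatMap (λ i → concatMap (λ g → map (build k ℓ g) (words (3 * k) (2 * k)))
                                     (generatorPairsIn (2 + i) R))
                   (upTo (3 * k))

    length-candidates : length candidates ≡ length (generatorsIn R)
      + sum (map (λ i → length (generatorPairsIn (2 + i) R) * length (words (3 * k) (2 * k))) (upTo (3 * k)))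
    length-candidates = trans (length-++ (map _ (generatorsIn R)))
      (cong₂ _+_ (length-map _ (generatorsIn R))
        (trans (length-concatMap _ (upTo (3 * k))) (cong sum (map-cong each (upTo (3 * k))))))
      where
      each : ∀ i → length (concatMap (λ g → map (build k ℓ g) (words (3 * k) (2 * k))) (generatorPairsIn (2 + i) R))
        ≡ length (generatorPairsIn (2 + i) R) * length (words (3 * k) (2 * k))
      each i = trans (length-concatMap _ (generatorPairsIn (2 + i) R))
        (trans (cong sum (map-cong (λ g → length-map (build k ℓ g) (words (3 * k) (2 * k))) (generatorPairsIn (2 + i) R)))
          (sum-map-const (length (words (3 * k) (2 * k))) (generatorPairsIn (2 + i) R)))

    counted⊆candidates : ∀ {S} → S ∈ counted → S ∈ candidates
    counted⊆candidates {S} S∈ with ∈-filter⁻ (λ S → ZeroSumFree? S ×-dec ContainedIn? S R) {xs = sequencesOfLength n ℓ} S∈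
    ... | S∈seq , zsf , S⊆R with ∈-filter⁻ (λ S → len S ≟ ℓ) {xs = subsequences (Vec.replicate n ℓ)} S∈seq
    ... | _ , |S| with decompose big ℓ+ S zsf |S|
    ... | record { g = g ; word = w ; generator = gen ; letters = letters ; size = size ; equation = refl } = found
      where
      in-R : ∀ {x} → x ∈ map (_· g) w ++ replicate (ℓ ∸ 2 * k) g → x ∈ˢ R
      in-R = contained-∈ _ S⊆R
      ∈-replicate : ∀ {j} → 0 < j → g ∈ replicate j g
      ∈-replicate (s≤s _) = here refl
      g∈R : g ∈ˢ R
      g∈R = in-R (∈-++⁺ʳ (map (_· g) w) (∈-replicate (m<n⇒0<n∸m 2k<ℓ)))
      found : build k ℓ g w ∈ candidates
      found with all-ones-or-big w letters
      ... | inj₁ ones = ∈-++⁺ˡ (subst (λ v → build k ℓ g v ∈ map (λ g → build k ℓ g (replicate (2 * k) 1)) (generatorsIn R))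
        (sym (trans ones (cong (λ j → replicate j 1) size)))
        (∈-map⁺ (λ g → build k ℓ g (replicate (2 * k) 1)) (∈-filter⁺ (_∈? R) (∈-generators⁺ gen) g∈R)))
      ... | inj₂ (i , i∈ , i<) = ∈-++⁺ʳ _ (∈-concatMap⁺ _ (lose (∈-upTo⁺ i<) (∈-concatMap⁺ _
        (lose (∈-filter⁺ (λ g → (g ∈? R) ×-dec ((2 + i) · g ∈? R)) (∈-generators⁺ gen)
                (g∈R , in-R (∈-++⁺ˡ (∈-map⁺ (_· g) i∈))))
              (∈-map⁺ (build k ℓ g) (∈-words w letters size))))))

    upper : #zeroSumFree R ℓ ≤ length (generatorsIn R)
      + sum (map (λ i → length (generatorPairsIn (2 + i) R) * length (words (3 * k) (2 * k))) (upTo (3 * k)))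
    upper = ≤-trans (length-injection (λ S → S)
        (Unique.filter⁺ _ (Unique.filter⁺ _ (subsequences-unique (Vec.replicate n ℓ))))
        (λ _ _ eq → eq) counted⊆candidates)
      (≤-reflexive length-candidates)

    all-equal : ∀ {g : Fin n} L → (∀ {x} → x ∈ L → x ≡ g) → L ≡ replicate (length L) g
    all-equal []      _   = refl
    all-equal (x ∷ L) x≡g = cong₂ _∷_ (x≡g (here refl)) (all-equal L (λ x∈ → x≡g (there x∈)))

    ∈-replicate⁻ : ∀ {x g : Fin n} j → x ∈ replicate j g → x ≡ g
    ∈-replicate⁻ (suc j) (here x≡g) = x≡g
    ∈-replicate⁻ (suc j) (there x∈) = ∈-replicate⁻ j x∈

    power : Fin n → Sequence n
    power g = fromList (replicate ℓ g)

    support-power : ∀ {x g} → 0 < lookup (power g) x → x ≡ g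
    support-power {x} {g} 0< = ∈-replicate⁻ ℓ (positive⇒∈ (replicate ℓ g) 0<)

    len-power : ∀ g → len (power g) ≡ ℓ
    len-power g = trans (len-fromList (replicate ℓ g)) (length-replicate ℓ)

    -- A nonempty subsequence consists of j copies of g with 0 < j ≤ ℓ < n, too few for an element
    -- of order n.
    power-zeroSumFree : ∀ {g} → IsGenerator g → ZeroSumFree (power g)
    power-zeroSumFree {g} gen T T⊑ 0<T n∣T = >⇒∤ {{>-nonZero 0<j}} j<n (generator-order gen n∣jg)
      where
      L = toList T
      j = length L
      T≡ : fromList L ≡ T
      T≡ = fromList-toList T
      |T| : len T ≡ j
      |T| = trans (cong len (sym T≡)) (len-fromList L)
      0<j : 0 < j
      0<j = subst (0 <_) |T| 0<T
      j<n : j < n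
      j<n = ≤-<-trans (subst₂ _≤_ |T| (len-power g) (len-mono T⊑)) ℓ<n
      L≡ : L ≡ replicate j g
      L≡ = all-equal L λ {x} x∈ → support-power (≤-trans
        (subst (λ S → 0 < lookup S x) T≡ (∈⇒positive x∈)) (⊑-lookup T⊑ x))
      sum-replicate : ∀ i → sum (map toℕ (replicate i g)) ≡ i * toℕ g
      sum-replicate zero    = refl
      sum-replicate (suc i) = cong (toℕ g +_) (sum-replicate i)
      n∣jg : n ∣ j * toℕ g
      n∣jg = subst (n ∣_) (trans (trans (cong (λ S → dot S (Vec.tabulate toℕ)) (sym T≡)) (dot-fromList L))
        (trans (cong (λ K → sum (map toℕ K)) L≡) (sum-replicate j))) n∣T

    power-∈ : ∀ {g} → g ∈ generatorsIn R → power g ∈ counted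
    power-∈ {g} g∈ with ∈-filter⁻ (_∈? R) {xs = generators} g∈
    ... | g∈gens , g∈R = ∈-filter⁺ (λ S → ZeroSumFree? S ×-dec ContainedIn? S R)
      (∈-filter⁺ (λ S → len S ≟ ℓ) (∈-subsequences (⊑-replicate (power g) (≤-reflexive (len-power g)))) (len-power g))
      (power-zeroSumFree (∈-generators⁻ g∈gens) , λ x 0< → subst (_∈ˢ R) (sym (support-power 0<)) g∈R)

    power-injective : ∀ {g h} → power g ≡ power h → g ≡ h
    power-injective {g} {h} eq = support-power
      (subst (λ S → 0 < lookup S g) eq (∈⇒positive (g∈ 0<ℓ)))
      where
      g∈ : ∀ {j} → 0 < j → g ∈ replicate j g
      g∈ (s≤s _) = here refl

    lower : length (generatorsIn R) ≤ #zeroSumFree R ℓ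
    lower = length-injection power (Unique.filter⁺ (_∈? R) generators-unique)
      (λ _ _ → power-injective) power-∈

-- Inequalities between rationals.

module Rationals where

  open import Data.Integer as ℤ using (+_)
  import Data.Integer.Properties as ℤ
  open import Data.Nat as ℕ using (ℕ; zero; suc)
  import Data.Nat.Properties as ℕ
  open import Data.Product using (∃; _,_)
  open import Data.Rational
  open import Data.Rational.Properties
  open import Data.Rational.Solver using (module +-*-Solver)
  import Data.Rational.Unnormalised as ℚᵘ
  import Data.Rational.Unnormalised.Properties as ℚᵘ
  open import Data.Sum using (inj₁; inj₂)
  open import Relation.Binary.PropositionalEquality
  open import Relation.Nullary using (yes; no; contradiction)
  open +-*-Solver

  -- Inequalities are certified in the form b = a + d with d visibly nonnegative, leaving a ring identity.
  ≤-by : ∀ {a b d} → 0ℚ ≤ d → b ≡ a + d → a ≤ b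
  ≤-by {a} {b} {d} 0≤d b≡ = subst₂ _≤_ (+-identityʳ a) (sym b≡) (+-monoʳ-≤ a 0≤d)

  ≤⇒0≤- : ∀ {a b} → a ≤ b → 0ℚ ≤ b - a
  ≤⇒0≤- {a} {b} a≤b = subst (_≤ b - a) (+-inverseʳ a) (+-monoˡ-≤ (- a) a≤b)

  0≤-+ : ∀ {a b} → 0ℚ ≤ a → 0ℚ ≤ b → 0ℚ ≤ a + b
  0≤-+ 0≤a 0≤b = +-mono-≤ 0≤a 0≤b

  0≤-* : ∀ {a b} → 0ℚ ≤ a → 0ℚ ≤ b → 0ℚ ≤ a * b
  0≤-* {a} {b} 0≤a 0≤b = nonNegative⁻¹ (a * b) {{nonNeg*nonNeg⇒nonNeg a {{nonNegative 0≤a}} b {{nonNegative 0≤b}}}}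

  0≤-square : ∀ a → 0ℚ ≤ a * a
  0≤-square a with ≤-total 0ℚ a
  ... | inj₁ 0≤a = 0≤-* 0≤a 0≤a
  ... | inj₂ a≤0 = subst (0ℚ ≤_) (solve 1 (λ a → (:- a) :* (:- a) := a :* a) refl a) (0≤-* 0≤-a 0≤-a)
    where
    0≤-a : 0ℚ ≤ - a
    0≤-a = neg-antimono-≤ a≤0

  *-mono-≤-nonNeg : ∀ {a b c d} → 0ℚ ≤ a → 0ℚ ≤ c → a ≤ b → c ≤ d → a * c ≤ b * d
  *-mono-≤-nonNeg {a} {b} {c} {d} 0≤a 0≤c a≤b c≤d = ≤-by
    (0≤-+ (0≤-* (≤⇒0≤- a≤b) (≤-trans 0≤c c≤d)) (0≤-* 0≤a (≤⇒0≤- c≤d)))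
    (solve 4 (λ a b c d → b :* d := a :* c :+ ((b :- a) :* d :+ a :* (d :- c))) refl a b c d)

  square-cancel-≤ : ∀ {a b} → 0ℚ ≤ b → a * a ≤ b * b → a ≤ b
  square-cancel-≤ {a} {b} 0≤b aa≤bb with ≤-total a b
  ... | inj₁ a≤b = a≤b
  ... | inj₂ b≤a with b <? a
  ...   | no a≮b  = ≮⇒≥ a≮b
  ...   | yes b<a = contradiction (≤-<-trans (*-monoˡ-≤-nonNeg b {{nonNegative 0≤b}} b≤a)
                      (<-≤-trans (*-monoˡ-<-pos a {{positive (≤-<-trans 0≤b b<a)}} b<a) aa≤bb)) (<-irrefl refl)

  p≤∣p∣ : ∀ p → p ≤ ∣ p ∣
  p≤∣p∣ p with ≤-total 0ℚ p
  ... | inj₁ 0≤p = ≤-reflexive (sym (0≤p⇒∣p∣≡p 0≤p))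
  ... | inj₂ p≤0 = ≤-trans p≤0 (0≤∣p∣ p)

  ∣p∣≤-by : ∀ {p b} → p ≤ b → - p ≤ b → ∣ p ∣ ≤ b
  ∣p∣≤-by {p} p≤b -p≤b with ∣p∣≡p∨∣p∣≡-p p
  ... | inj₁ eq = ≤-trans (≤-reflexive eq) p≤b
  ... | inj₂ eq = ≤-trans (≤-reflexive eq) -p≤b

  ι : ℕ → ℚ
  ι n = + n / 1

  private
    ιᵘ : ℕ → ℚᵘ.ℚᵘ
    ιᵘ n = ℚᵘ.mkℚᵘ (+ n) 0

    toℚᵘ-ι : ∀ n → toℚᵘ (ι n) ℚᵘ.≃ ιᵘ n
    toℚᵘ-ι n = toℚᵘ-fromℚᵘ (ιᵘ n)

  ι-+ : ∀ m n → ι (m ℕ.+ n) ≡ ι m + ι n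
  ι-+ m n = toℚᵘ-injective (begin
    toℚᵘ (ι (m ℕ.+ n))             ≈⟨ toℚᵘ-ι (m ℕ.+ n) ⟩
    ιᵘ (m ℕ.+ n)                   ≈⟨ ℚᵘ.*≡* (cong (ℤ._* + 1) (trans (ℤ.pos-+ m n)
                                       (sym (cong₂ ℤ._+_ (ℤ.*-identityʳ (+ m)) (ℤ.*-identityʳ (+ n)))))) ⟩
    ιᵘ m ℚᵘ.+ ιᵘ n                 ≈⟨ ℚᵘ.+-cong (toℚᵘ-ι m) (toℚᵘ-ι n) ⟨
    toℚᵘ (ι m) ℚᵘ.+ toℚᵘ (ι n)     ≈⟨ toℚᵘ-homo-+ (ι m) (ι n) ⟨
    toℚᵘ (ι m + ι n)               ∎)
    where open ℚᵘ.≃-Reasoning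

  ι-* : ∀ m n → ι (m ℕ.* n) ≡ ι m * ι n
  ι-* zero    n = sym (*-zeroˡ (ι n))
  ι-* (suc m) n = trans (ι-+ n (m ℕ.* n)) (trans (cong (_+_ (ι n)) (ι-* m n))
    (trans (solve 2 (λ x y → x :+ y :* x := (con 1ℚ :+ y) :* x) refl (ι n) (ι m)) (cong (_* ι n) (sym (ι-+ 1 m)))))

  ι-suc : ∀ n → ι (suc n) ≡ 1ℚ + ι n
  ι-suc n = ι-+ 1 n

  0≤ι : ∀ n → 0ℚ ≤ ι n
  0≤ι zero    = ≤-refl
  0≤ι (suc n) = subst (0ℚ ≤_) (sym (ι-suc n)) (0≤-+ (nonNegative⁻¹ 1ℚ) (0≤ι n))

  ι-mono : ∀ {m n} → m ℕ.≤ n → ι m ≤ ι n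
  ι-mono {m} {n} m≤n = ≤-by (0≤ι (n ℕ.∸ m)) (trans (cong ι (sym (ℕ.m+[n∸m]≡n m≤n))) (ι-+ m (n ℕ.∸ m)))

  -- The absolute value of the numerator will do, as the denominator is at least 1.
  archimedean : ∀ q → ∃ λ n → q ≤ ι n
  archimedean q@(mkℚ u d _) = ℤ.∣ u ∣ , toℚᵘ-cancel-≤ (ℚᵘ.≤-trans (ℚᵘ.*≤* bound) (ℚᵘ.≤-reflexive (ℚᵘ.≃-sym (toℚᵘ-ι ℤ.∣ u ∣))))
    where
    u≤∣u∣ : ∀ i → i ℤ.≤ + ℤ.∣ i ∣
    u≤∣u∣ (+ i)      = ℤ.≤-refl
    u≤∣u∣ ℤ.-[1+ i ] = ℤ.-≤+
    bound : u ℤ.* + 1 ℤ.≤ + ℤ.∣ u ∣ ℤ.* + suc d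
    bound = begin
      u ℤ.* + 1                   ≡⟨ ℤ.*-identityʳ u ⟩
      u                           ≤⟨ u≤∣u∣ u ⟩
      + ℤ.∣ u ∣                   ≤⟨ ℤ.+≤+ (ℕ.m≤m*n ℤ.∣ u ∣ (suc d)) ⟩
      + (ℤ.∣ u ∣ ℕ.* suc d)       ≡⟨ ℤ.pos-* ℤ.∣ u ∣ (suc d) ⟩
      + ℤ.∣ u ∣ ℤ.* + suc d       ∎
      where open ℤ.≤-Reasoning

-- Expectation, second moments and Markov's inequality at a rational parameter.

module Expectation where

  open Rationals
  open import Data.Bool using (Bool; true; false; if_then_else_)
  open import Data.Fin using (Fin; zero; suc)
  open import Data.Fin.Properties using (_≟_)
  open import Data.Fin.Subset using (Subset; inside; outside)
  open import Data.List using (List; []; _∷_; _++_; length; filter; filterᵇ; map)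
  open import Data.List.Membership.Propositional using (_∈_)
  open import Data.List.Relation.Unary.Any using (here; there)
  open import Data.Nat as ℕ using (ℕ; zero; suc)
  open import Data.Rational hiding (_≟_)
  open import Data.Rational.Properties hiding (_≟_)
  open import Data.Rational.Solver using (module +-*-Solver)
  open import Data.Vec using ([]; _∷_; lookup; _[_]≔_)
  open import Data.Vec.Properties using (lookup∘updateAt′)
  open import Level using (0ℓ)
  open import Relation.Binary.PropositionalEquality
  open import Relation.Nullary using (¬_; Dec; yes; no; does)
  open import Relation.Unary using (Pred; Decidable)
  open +-*-Solver

  private variable n : ℕ

  -- Averaging one coordinate at a time turns linearity and independence into inductions over ring
  -- identities. `Σ-weight` identifies it with the weighted sum over all subsets.
  Ex : ∀ {n} → ℚ → (Subset n → ℚ) → ℚ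
  Ex {zero}  q f = f []
  Ex {suc n} q f = q * Ex q (λ R → f (inside ∷ R)) + (1ℚ - q) * Ex q (λ R → f (outside ∷ R))

  Ex-cong : ∀ q {f g : Subset n → ℚ} → (∀ R → f R ≡ g R) → Ex q f ≡ Ex q g
  Ex-cong {zero}  q f≗g = f≗g []
  Ex-cong {suc n} q f≗g = cong₂ (λ a b → q * a + (1ℚ - q) * b) 
    (Ex-cong {n} q (λ R → f≗g (inside ∷ R))) (Ex-cong {n} q (λ R → f≗g (outside ∷ R)))

  Ex-const : ∀ q c → Ex {n} q (λ _ → c) ≡ c
  Ex-const {zero}  q c = refl
  Ex-const {suc n} q c = trans (cong (λ e → q * e + (1ℚ - q) * e) (Ex-const {n} q c))
    (solve 2 (λ q c → q :* c :+ (con 1ℚ :- q) :* c := c) refl q c)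

  Ex-+ : ∀ q (f g : Subset n → ℚ) → Ex q (λ R → f R + g R) ≡ Ex q f + Ex q g
  Ex-+ {zero}  q f g = refl
  Ex-+ {suc n} q f g = trans (cong₂ (λ a b → q * a + (1ℚ - q) * b) 
      (Ex-+ q (λ R → f (inside ∷ R)) (λ R → g (inside ∷ R))) (Ex-+ q (λ R → f (outside ∷ R)) (λ R → g (outside ∷ R))))
    (solve 5 (λ q a b c d → q :* (a :+ b) :+ (con 1ℚ :- q) :* (c :+ d)
        := (q :* a :+ (con 1ℚ :- q) :* c) :+ (q :* b :+ (con 1ℚ :- q) :* d)) refl q
      (Ex q λ R → f (inside ∷ R)) (Ex q λ R → g (inside ∷ R)) (Ex q λ R → f (outside ∷ R)) (Ex q λ R → g (outside ∷ R)))

  Ex-* : ∀ q c (f : Subset n → ℚ) → Ex q (λ R → c * f R) ≡ c * Ex q f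
  Ex-* {zero}  q c f = refl
  Ex-* {suc n} q c f = trans (cong₂ (λ a b → q * a + (1ℚ - q) * b) (Ex-* q c (λ R → f (inside ∷ R))) (Ex-* q c (λ R → f (outside ∷ R))))
    (solve 4 (λ q c a b → q :* (c :* a) :+ (con 1ℚ :- q) :* (c :* b) := c :* (q :* a :+ (con 1ℚ :- q) :* b)) refl q c
      (Ex q λ R → f (inside ∷ R)) (Ex q λ R → f (outside ∷ R)))

  Ex-mono : ∀ {q} → 0ℚ ≤ q → q ≤ 1ℚ → {f g : Subset n → ℚ} → (∀ R → f R ≤ g R) → Ex q f ≤ Ex q g
  Ex-mono {zero}  0≤q q≤1 f≤g = f≤g []
  Ex-mono {suc n} {q} 0≤q q≤1 f≤g = +-mono-≤
    (*-monoˡ-≤-nonNeg q {{nonNegative 0≤q}} (Ex-mono {n} 0≤q q≤1 (λ R → f≤g (inside ∷ R))))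
    (*-monoˡ-≤-nonNeg (1ℚ - q) {{nonNegative (≤⇒0≤- q≤1)}} (Ex-mono {n} 0≤q q≤1 (λ R → f≤g (outside ∷ R))))

  χ : Fin n → Subset n → ℚ
  χ a R = if lookup R a then 1ℚ else 0ℚ

  Independent : Fin n → (Subset n → ℚ) → Set
  Independent a f = ∀ R v → f (R [ a ]≔ v) ≡ f R

  -- At the coordinate a itself both halves of the average of f agree, so the factor χ only
  -- contributes q; other coordinates are averaged outside.
  Ex-χ* : ∀ q (a : Fin n) {f} → Independent a f → Ex q (λ R → χ a R * f R) ≡ q * Ex q f
  Ex-χ* {suc n} q zero {f} indep = begin
    q * Ex q (λ R → 1ℚ * f (inside ∷ R)) + (1ℚ - q) * Ex q (λ R → 0ℚ * f (outside ∷ R))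
      ≡⟨ cong₂ (λ a b → q * a + (1ℚ - q) * b) (Ex-* q 1ℚ (λ R → f (inside ∷ R))) (Ex-* q 0ℚ (λ R → f (outside ∷ R))) ⟩
    q * (1ℚ * Ex q (λ R → f (inside ∷ R))) + (1ℚ - q) * (0ℚ * Ex q (λ R → f (outside ∷ R)))
      ≡⟨ cong (λ e → q * (1ℚ * E₁) + (1ℚ - q) * (0ℚ * e)) same ⟩
    q * (1ℚ * E₁) + (1ℚ - q) * (0ℚ * E₁)
      ≡⟨ solve 2 (λ q e → q :* (con 1ℚ :* e) :+ (con 1ℚ :- q) :* (con 0ℚ :* e) := q :* (q :* e :+ (con 1ℚ :- q) :* e)) refl q E₁ ⟩
    q * (q * E₁ + (1ℚ - q) * E₁)
      ≡⟨ cong (λ e → q * (q * E₁ + (1ℚ - q) * e)) (sym same) ⟩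
    q * (q * E₁ + (1ℚ - q) * Ex q (λ R → f (outside ∷ R))) ∎
    where
    open ≡-Reasoning
    E₁ = Ex q (λ R → f (inside ∷ R))
    same : Ex q (λ R → f (outside ∷ R)) ≡ E₁
    same = Ex-cong q λ R → indep (inside ∷ R) outside
  Ex-χ* {suc n} q (suc a) {f} indep = trans
    (cong₂ (λ x y → q * x + (1ℚ - q) * y)
      (Ex-χ* q a (λ R v → indep (inside ∷ R) v)) (Ex-χ* q a (λ R v → indep (outside ∷ R) v)))
    (solve 3 (λ q x y → q :* (q :* x) :+ (con 1ℚ :- q) :* (q :* y) := q :* (q :* x :+ (con 1ℚ :- q) :* y)) refl q
      (Ex q λ R → f (inside ∷ R)) (Ex q λ R → f (outside ∷ R)))

  χ-independent : ∀ {a b : Fin n} → a ≢ b → Independent a (χ b)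
  χ-independent {a = a} {b} a≢b R v = cong (λ i → if i then 1ℚ else 0ℚ) (lookup∘updateAt′ b a (λ b≡a → a≢b (sym b≡a)) R)

  *-independent : ∀ {a : Fin n} {f g} → Independent a f → Independent a g → Independent a (λ R → f R * g R)
  *-independent if ig R v = cong₂ _*_ (if R v) (ig R v)

  minus-independent : ∀ {a : Fin n} {f} c → Independent a f → Independent a (λ R → f R - c)
  minus-independent c if R v = cong (_- c) (if R v)

  Ex-χ : ∀ q (a : Fin n) → Ex q (χ a) ≡ q
  Ex-χ {n} q a = begin
    Ex q (χ a)                  ≡⟨ Ex-cong q (λ R → sym (*-identityʳ (χ a R))) ⟩
    Ex q (λ R → χ a R * 1ℚ)     ≡⟨ Ex-χ* q a {λ _ → 1ℚ} (λ _ _ → refl) ⟩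
    q * Ex {n} q (λ _ → 1ℚ)     ≡⟨ cong (q *_) (Ex-const {n} q 1ℚ) ⟩
    q * 1ℚ                      ≡⟨ *-identityʳ q ⟩
    q                           ∎
    where open ≡-Reasoning

  0≤χ : ∀ (a : Fin n) R → 0ℚ ≤ χ a R
  0≤χ a R with lookup R a
  ... | true  = nonNegative⁻¹ 1ℚ
  ... | false = ≤-refl

  χ≤1 : ∀ (a : Fin n) R → χ a R ≤ 1ℚ
  χ≤1 a R with lookup R a
  ... | true  = ≤-refl
  ... | false = nonNegative⁻¹ 1ℚ

  -- From (f - a)(g - a) = f (g - a) - a (g - a). The second hypothesis is what remains after the
  -- indicators in f have been factored out by `Ex-χ*`.
  Ex-uncorrelated : ∀ q (f g : Subset n → ℚ) {a} → Ex q f ≡ a → Ex q (λ R → f R * (g R - a)) ≡ a * Ex q (λ R → g R - a) →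
    Ex q (λ R → (f R - a) * (g R - a)) ≡ 0ℚ
  Ex-uncorrelated q f g {a} Ef cov = begin
    Ex q (λ R → (f R - a) * (g R - a))
      ≡⟨ Ex-cong q (λ R → solve 3 (λ f g a → (f :- a) :* (g :- a) := f :* (g :- a) :+ (:- a) :* (g :- a)) refl (f R) (g R) a) ⟩
    Ex q (λ R → f R * (g R - a) + (- a) * (g R - a))
      ≡⟨ Ex-+ q (λ R → f R * (g R - a)) (λ R → (- a) * (g R - a)) ⟩
    Ex q (λ R → f R * (g R - a)) + Ex q (λ R → (- a) * (g R - a))
      ≡⟨ cong₂ _+_ cov (Ex-* q (- a) (λ R → g R - a)) ⟩
    a * E + (- a) * E
      ≡⟨ solve 2 (λ a e → a :* e :+ (:- a) :* e := con 0ℚ) refl a E ⟩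
    0ℚ ∎
    where
    open ≡-Reasoning
    E = Ex q (λ R → g R - a)

  Σ : {A : Set} → List A → (A → ℚ) → ℚ
  Σ []       f = 0ℚ
  Σ (x ∷ xs) f = f x + Σ xs f

  Ex-Σ : ∀ {A : Set} q (xs : List A) (f : A → Subset n → ℚ) → Ex q (λ R → Σ xs (λ x → f x R)) ≡ Σ xs (λ x → Ex q (f x))
  Ex-Σ {n} q []   f = Ex-const {n} q 0ℚ
  Ex-Σ q (x ∷ xs) f = trans (Ex-+ q (f x) _) (cong (Ex q (f x) +_) (Ex-Σ q xs f))

  *-Σ : ∀ {A : Set} c (xs : List A) f → c * Σ xs f ≡ Σ xs (λ x → c * f x)
  *-Σ c []       f = *-zeroʳ c
  *-Σ c (x ∷ xs) f = trans (*-distribˡ-+ c (f x) (Σ xs f)) (cong (c * f x +_) (*-Σ c xs f))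

  Σ-cong : ∀ {A : Set} (xs : List A) {f g : A → ℚ} → (∀ x → f x ≡ g x) → Σ xs f ≡ Σ xs g
  Σ-cong []       f≗g = refl
  Σ-cong (x ∷ xs) f≗g = cong₂ _+_ (f≗g x) (Σ-cong xs f≗g)

  Σ-minus : ∀ {A : Set} (xs : List A) f c → Σ xs (λ x → f x - c) ≡ Σ xs f - ι (length xs) * c
  Σ-minus []       f c = solve 1 (λ c → con 0ℚ := con 0ℚ :- con 0ℚ :* c) refl c
  Σ-minus (x ∷ xs) f c = trans (cong (f x - c +_) (Σ-minus xs f c))
    (trans (solve 4 (λ a s l c → (a :- c) :+ (s :- l :* c) := (a :+ s) :- (con 1ℚ :+ l) :* c) refl (f x) (Σ xs f) (ι (length xs)) c)
      (cong (λ l → f x + Σ xs f - l * c) (sym (ι-suc (length xs)))))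

  Σ-bound : ∀ {A : Set} (xs : List A) {f : A → ℚ} {c} → (∀ {x} → x ∈ xs → f x ≤ c) → Σ xs f ≤ ι (length xs) * c
  Σ-bound []       {c = c} f≤c = ≤-reflexive (sym (*-zeroˡ c))
  Σ-bound (x ∷ xs) {f} {c} f≤c = ≤-trans (+-mono-≤ (f≤c (here refl)) (Σ-bound xs (λ x∈ → f≤c (there x∈)))) (≤-reflexive
    (trans (solve 2 (λ l c → c :+ l :* c := (con 1ℚ :+ l) :* c) refl (ι (length xs)) c) (cong (_* c) (sym (ι-suc (length xs))))))

  Σ-filter-bound : ∀ {A : Set} {P : Pred A 0ℓ} (P? : Decidable P) (xs : List A) {f : A → ℚ} {c} →
    (∀ {x} → x ∈ xs → f x ≤ c) → (∀ {x} → x ∈ xs → ¬ P x → f x ≡ 0ℚ) →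
    Σ xs f ≤ ι (length (filter P? xs)) * c
  Σ-filter-bound P? []       {c = c} f≤c f≡0 = ≤-reflexive (sym (*-zeroˡ c))
  Σ-filter-bound P? (x ∷ xs) {f} {c} f≤c f≡0 with P? x | Σ-filter-bound P? xs (λ x∈ → f≤c (there x∈)) (λ x∈ → f≡0 (there x∈))
  ... | no ¬p | rest = ≤-trans (≤-reflexive (trans (cong (_+ Σ xs f) (f≡0 (here refl) ¬p)) (+-identityˡ (Σ xs f)))) rest
  ... | yes p | rest = ≤-trans (+-mono-≤ (f≤c (here refl)) rest) (≤-reflexive
    (trans (solve 2 (λ l c → c :+ l :* c := (con 1ℚ :+ l) :* c) refl (ι l) c) (cong (_* c) (sym (ι-suc l)))))
    where l = length (filter P? xs)

  -- The square of the sum of the X g - a is expanded over pairs. Pairs that are not bad contribute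
  -- 0, and each g has at most M bad partners, each contributing at most 2a.
  secondMoment : ∀ {A : Set} {q} → 0ℚ ≤ q → q ≤ 1ℚ → (G : List A) (X : A → Subset n → ℚ) {a : ℚ} {M : ℕ} →
    0ℚ ≤ a → a ≤ 1ℚ → (∀ g R → 0ℚ ≤ X g R) → (∀ g R → X g R ≤ 1ℚ) → (∀ {g} → g ∈ G → Ex q (X g) ≡ a) →
    {Bad : A → Pred A 0ℓ} (Bad? : ∀ g → Decidable (Bad g)) → (∀ {g} → g ∈ G → length (filter (Bad? g) G) ℕ.≤ M) →
    (∀ {g h} → g ∈ G → h ∈ G → ¬ Bad g h → Ex q (λ R → (X g R - a) * (X h R - a)) ≡ 0ℚ) →
    Ex q (λ R → (Σ G (λ g → X g R) - ι (length G) * a) * (Σ G (λ g → X g R) - ι (length G) * a))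
      ≤ ι (length G) * (ι M * (a + a))
  secondMoment {n} {q = q} 0≤q q≤1 G X {a} {M} 0≤a a≤1 0≤X X≤1 mean Bad? few uncorrelated = begin
    Ex q (λ R → (Σ G (λ g → X g R) - ι (length G) * a) * (Σ G (λ g → X g R) - ι (length G) * a))
      ≡⟨ Ex-cong q (λ R → cong₂ _*_ (sym (Σ-minus G (λ g → X g R) a)) (sym (Σ-minus G (λ g → X g R) a))) ⟩
    Ex q (λ R → D R * D R)
      ≡⟨ Ex-cong q expand ⟩
    Ex q (λ R → Σ G (λ g → Σ G (λ h → d g R * d h R)))
      ≡⟨ Ex-Σ q G (λ g R → Σ G (λ h → d g R * d h R)) ⟩
    Σ G (λ g → Ex q (λ R → Σ G (λ h → d g R * d h R)))
      ≡⟨ Σ-cong G (λ g → Ex-Σ q G (λ h R → d g R * d h R)) ⟩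
    Σ G (λ g → Σ G (λ h → Ex q (λ R → d g R * d h R)))
      ≤⟨ Σ-bound G row ⟩
    ι (length G) * (ι M * (a + a)) ∎
    where
    open ≤-Reasoning
    d = λ g R → X g R - a
    D = λ R → Σ G (λ g → d g R)
    expand : ∀ R → D R * D R ≡ Σ G (λ g → Σ G (λ h → d g R * d h R))
    expand R = trans (*-Σ (D R) G (λ g → d g R))
      (Σ-cong G (λ g → trans (*-comm (D R) (d g R)) (*-Σ (d g R) G (λ h → d h R))))
    -- From 0 ≤ x, y ≤ 1 and 0 ≤ a ≤ 1; the right-hand side has expectation 2a.
    pointwise : ∀ g h R → d g R * d h R ≤ X g R + a
    pointwise g h R = ≤-by {d = x * (1ℚ - y) + a * x + a * y + a * (1ℚ - a)}
      (0≤-+ (0≤-+ (0≤-+ (0≤-* (0≤X g R) (≤⇒0≤- (X≤1 h R))) (0≤-* 0≤a (0≤X g R))) (0≤-* 0≤a (0≤X h R))) (0≤-* 0≤a (≤⇒0≤- a≤1)))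
      (solve 3 (λ x y a → x :+ a := (x :- a) :* (y :- a)
        :+ (x :* (con 1ℚ :- y) :+ a :* x :+ a :* y :+ a :* (con 1ℚ :- a))) refl x y a)
      where
      x = X g R
      y = X h R
    entry : ∀ {g} h → g ∈ G → Ex q (λ R → d g R * d h R) ≤ a + a
    entry {g} h g∈ = ≤-trans (Ex-mono 0≤q q≤1 (pointwise g h))
      (≤-reflexive (trans (Ex-+ q (X g) (λ _ → a)) (cong₂ _+_ (mean g∈) (Ex-const {n} q a))))
    row : ∀ {g} → g ∈ G → Σ G (λ h → Ex q (λ R → d g R * d h R)) ≤ ι M * (a + a)
    row {g} g∈ = ≤-trans (Σ-filter-bound (Bad? g) G (λ {h} _ → entry h g∈) (λ h∈ → uncorrelated g∈ h∈))
      (*-monoʳ-≤-nonNeg (a + a) {{nonNegative (0≤-+ 0≤a 0≤a)}} (ι-mono (few g∈)))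

  atMost : (Subset n → ℚ) → ℚ → Subset n → Bool
  atMost V T R = does (V R ≤? T)

  atMost⁻ : ∀ (V : Subset n → ℚ) T R → atMost V T R ≡ true → V R ≤ T
  atMost⁻ V T R = go (V R ≤? T)
    where
    go : (V≤T? : Dec (V R ≤ T)) → does V≤T? ≡ true → V R ≤ T
    go (yes V≤T) _ = V≤T

  𝟙 : (Subset n → Bool) → Subset n → ℚ
  𝟙 F R = if F R then 1ℚ else 0ℚ

  -- Where V exceeds T the summand V alone covers T, elsewhere the indicator does. Division by T is
  -- postponed to `probability`.
  markov : ∀ {q} → 0ℚ ≤ q → q ≤ 1ℚ → (V : Subset n → ℚ) (T : ℚ) → (∀ R → 0ℚ ≤ V R) →
    T ≤ T * Ex q (𝟙 (atMost V T)) + Ex q V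
  markov {n} {q} 0≤q q≤1 V T 0≤V = begin
    T                                               ≡⟨ Ex-const {n} q T ⟨
    Ex {n} q (λ _ → T)                              ≤⟨ Ex-mono 0≤q q≤1 pointwise ⟩
    Ex q (λ R → T * 𝟙 (atMost V T) R + V R)         ≡⟨ Ex-+ q (λ R → T * 𝟙 (atMost V T) R) V ⟩
    Ex q (λ R → T * 𝟙 (atMost V T) R) + Ex q V      ≡⟨ cong (_+ Ex q V) (Ex-* q T (𝟙 (atMost V T))) ⟩
    T * Ex q (𝟙 (atMost V T)) + Ex q V              ∎
    where
    open ≤-Reasoning
    pointwise : ∀ R → T ≤ T * 𝟙 (atMost V T) R + V R
    pointwise R = go (V R ≤? T)
      where
      go : (V≤T? : Dec (V R ≤ T)) → T ≤ T * (if does V≤T? then 1ℚ else 0ℚ) + V R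
      go (yes _)  = ≤-by (0≤V R) (cong (_+ V R) (*-identityʳ T))
      go (no V≰T) = ≤-trans (<⇒≤ (≰⇒> V≰T)) (≤-reflexive (solve 2 (λ t v → v := t :* con 0ℚ :+ v) refl T (V R)))

  -- Real probabilities, index by index.

  open import Defs using (ℝ; seq; weight; Pr; subsets; sumℝ)

  Σ-++ : ∀ {A : Set} (xs ys : List A) f → Σ (xs ++ ys) f ≡ Σ xs f + Σ ys f
  Σ-++ []       ys f = sym (+-identityˡ (Σ ys f))
  Σ-++ (x ∷ xs) ys f = trans (cong (f x +_) (Σ-++ xs ys f)) (sym (+-assoc (f x) (Σ xs f) (Σ ys f)))

  Σ-map : ∀ {A B : Set} (g : A → B) (xs : List A) f → Σ (map g xs) f ≡ Σ xs (λ x → f (g x))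
  Σ-map g []       f = refl
  Σ-map g (x ∷ xs) f = cong (f (g x) +_) (Σ-map g xs f)

  Σ-filterᵇ : ∀ {A : Set} (F : A → Bool) (xs : List A) w → Σ (filterᵇ F xs) w ≡ Σ xs (λ x → w x * (if F x then 1ℚ else 0ℚ))
  Σ-filterᵇ F []       w = refl
  Σ-filterᵇ F (x ∷ xs) w with F x
  ... | true  = cong₂ _+_ (sym (*-identityʳ (w x))) (Σ-filterᵇ F xs w)
  ... | false = trans (Σ-filterᵇ F xs w) (trans (sym (+-identityˡ _)) (cong (_+ _) (sym (*-zeroʳ (w x)))))

  seq-sumℝ : ∀ {A : Set} (f : A → ℝ) xs m → seq (sumℝ (map f xs)) m ≡ Σ xs (λ x → seq (f x) m)
  seq-sumℝ f []       m = refl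
  seq-sumℝ f (x ∷ xs) m = cong (seq (f x) m +_) (seq-sumℝ f xs m)

  Σ-weight : ∀ {n} (q : ℝ) m (f : Subset n → ℚ) → Σ (subsets n) (λ R → seq (weight q R) m * f R) ≡ Ex (seq q m) f
  Σ-weight {zero}  q m f = solve 1 (λ x → con 1ℚ :* x :+ con 0ℚ := x) refl (f [])
  Σ-weight {suc n} q m f = trans (Σ-++ (map (inside ∷_) (subsets n)) _ _) (cong₂ _+_
    (half inside (seq q m) (λ _ → refl)) (half outside (1ℚ - seq q m) (λ _ → refl)))
    where
    half : ∀ v c → (∀ R → seq (weight q (v ∷ R)) m ≡ c * seq (weight q R) m) →
      Σ (map (v ∷_) (subsets n)) (λ R → seq (weight q R) m * f R) ≡ c * Ex (seq q m) (λ R → f (v ∷ R))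
    half v c w = trans (Σ-map (v ∷_) (subsets n) _) (trans (Σ-cong (subsets n) (λ R →
        trans (cong (_* f (v ∷ R)) (w R)) (*-assoc c (seq (weight q R) m) (f (v ∷ R)))))
      (trans (sym (*-Σ c (subsets n) _)) (cong (c *_) (Σ-weight q m (λ R → f (v ∷ R))))))

  -- The bridge from real to rational probabilities: operations on reals act termwise, so index m
  -- sees only the rational `seq q m`.
  seq-Pr : ∀ {n} (q : ℝ) (F : Subset n → Bool) m → seq (Pr q F) m ≡ Ex (seq q m) (𝟙 F)
  seq-Pr {n} q F m = trans (seq-sumℝ (weight q) (filterᵇ F (subsets n)) m)
    (trans (Σ-filterᵇ F (subsets n) (λ R → seq (weight q R) m)) (Σ-weight q m (𝟙 F)))

-- Generators whose pairs overlap.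

module Coincidences (n : ℕ) {{_ : NonZero n}} where

  open Counting
  open Residues n
  open Structure n using (generator-order)
  open Sandwich n using (generators; generators-unique)
  open import Defs using (IsGenerator)
  open import Data.Fin using (Fin; toℕ)
  open import Data.Fin.Properties using (_≟_; toℕ-injective; toℕ<n)
  open import Data.List using (List; []; _∷_; length; filter; upTo)
  open import Data.List.Properties using (length-upTo)
  open import Data.List.Membership.Propositional using (_∈_)
  open import Data.List.Membership.Propositional.Properties using (∈-filter⁻; ∈-upTo⁺)
  open import Data.List.Relation.Unary.Any using (here)
  import Data.List.Relation.Unary.Unique.Propositional.Properties as Unique
  open import Data.Nat using (suc; _+_; _*_; _≤_; _<_; z≤n; s≤s)
  open import Data.Nat.DivMod
  open import Data.Nat.Divisibility using (>⇒∤)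
  open import Data.Nat.Properties hiding (_≟_)
  open import Data.Product using (proj₂)
  open import Data.Sum using (_⊎_)
  open import Level using (0ℓ)
  open import Relation.Binary.PropositionalEquality hiding ([_])
  open import Relation.Nullary using (¬_; Dec; yes; no)
  open import Relation.Nullary.Decidable using (_⊎-dec_)
  open import Relation.Unary using (Pred; Decidable)

  length-filter-⊎ : ∀ {A : Set} {P Q : Pred A 0ℓ} (P? : Decidable P) (Q? : Decidable Q) xs →
    length (filter (λ x → P? x ⊎-dec Q? x) xs) ≤ length (filter P? xs) + length (filter Q? xs)
  length-filter-⊎ P? Q? []       = z≤n
  length-filter-⊎ P? Q? (x ∷ xs) with P? x | Q? x | length-filter-⊎ P? Q? xs
  ... | yes p | yes q | rest = s≤s (≤-trans rest (+-monoʳ-≤ (length (filter P? xs)) (n≤1+n _)))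
  ... | yes p | no ¬q | rest = s≤s rest
  ... | no ¬p | yes q | rest = ≤-trans (s≤s rest) (≤-reflexive (sym (+-suc _ _)))
  ... | no ¬p | no ¬q | rest = rest

  length-filter-≟ : ∀ x → length (filter (_≟ x) generators) ≤ 1
  length-filter-≟ x = length-injection (λ h → h) {ys = x ∷ []} (Unique.filter⁺ (_≟ x) generators-unique)
    (λ _ _ eq → eq) (λ h∈ → here (proj₂ (∈-filter⁻ (_≟ x) {xs = generators} h∈)))

  -- A solution h of b · h ≡ x is determined by the integer part of b h / n, which is below b.
  length-filter-· : ∀ b .{{_ : NonZero b}} x → length (filter (λ h → b · h ≟ x) generators) ≤ b
  length-filter-· b x = ≤-trans
    (length-injection (λ h → b * toℕ h / n) {ys = upTo b} (Unique.filter⁺ (λ h → b · h ≟ x) generators-unique) injective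
      (λ {h} _ → ∈-upTo⁺ (m<n*o⇒m/o<n (*-monoʳ-< b (toℕ<n h)))))
    (≤-reflexive (length-upTo b))
    where
    solves : ∀ {h} → h ∈ filter (λ h → b · h ≟ x) generators → b · h ≡ x
    solves h∈ = proj₂ (∈-filter⁻ (λ h → b · h ≟ x) {xs = generators} h∈)
    injective : ∀ {h h′} → h ∈ filter (λ h → b · h ≟ x) generators → h′ ∈ filter (λ h → b · h ≟ x) generators →
      b * toℕ h / n ≡ b * toℕ h′ / n → h ≡ h′
    injective {h} {h′} h∈ h′∈ eq = toℕ-injective (*-cancelˡ-≡ (toℕ h) (toℕ h′) b (begin
      b * toℕ h                                       ≡⟨ m≡m%n+[m/n]*n (b * toℕ h) n ⟩
      (b * toℕ h) % n + (b * toℕ h / n) * n           ≡⟨ cong₂ (λ r d → r + d * n) ([]-injective (trans (solves h∈) (sym (solves h′∈)))) eq ⟩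
      (b * toℕ h′) % n + (b * toℕ h′ / n) * n         ≡⟨ m≡m%n+[m/n]*n (b * toℕ h′) n ⟨
      b * toℕ h′                                      ∎))
      where open ≡-Reasoning

  -- The sets {h, b h} and {g, b g} meet; otherwise the two pair indicators depend on disjoint sets
  -- of coordinates.
  Coincide : ℕ → Fin n → Fin n → Set
  Coincide b g h = (h ≡ g ⊎ h ≡ b · g) ⊎ (b · h ≡ g ⊎ b · h ≡ b · g)

  coincide? : ∀ b g h → Dec (Coincide b g h)
  coincide? b g h = (h ≟ g ⊎-dec h ≟ b · g) ⊎-dec (b · h ≟ g ⊎-dec b · h ≟ b · g)

  length-coincide : ∀ b .{{_ : NonZero b}} g → length (filter (coincide? b g) generators) ≤ 2 + (b + b)
  length-coincide b g = ≤-trans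
    (length-filter-⊎ (λ h → h ≟ g ⊎-dec h ≟ b · g) (λ h → b · h ≟ g ⊎-dec b · h ≟ b · g) generators)
    (+-mono-≤
      (≤-trans (length-filter-⊎ (_≟ g) (_≟ b · g) generators) (+-mono-≤ (length-filter-≟ g) (length-filter-≟ (b · g))))
      (≤-trans (length-filter-⊎ (λ h → b · h ≟ g) (λ h → b · h ≟ b · g) generators) (+-mono-≤ (length-filter-· b g) (length-filter-· b (b · g)))))

  -- Subtracting g leaves (i + 1) g = 0 with 0 < i + 1 < n. Hence g and b g are different
  -- coordinates, and the pair has mean q².
  ·-moves-generator : ∀ {i g} → IsGenerator g → suc i < n → suc (suc i) · g ≢ g
  ·-moves-generator {i} {g} gen i<n eq = >⇒∤ i<n (generator-order gen ([]≡0⇒∣ (⊕-cancelˡ g (begin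
    g ⊕ (suc i · g)          ≡⟨ cong (_⊕ (suc i · g)) (1·≡ g) ⟨
    (1 · g) ⊕ (suc i · g)    ≡⟨ +-· 1 (suc i) g ⟨
    suc (suc i) · g          ≡⟨ eq ⟩
    g                        ≡⟨ ⊕-identityʳ g ⟨
    g ⊕ 0#                   ∎))))
    where open ≡-Reasoning

-- Variances of the numbers of generators and of generator pairs.

module Variances (n : ℕ) {{_ : NonZero n}} where

  open Residues n
  open Sandwich n
  open Coincidences n
  open Rationals
  open Expectation
  open import Data.Bool using (true; false)
  open import Data.Fin using (Fin)
  open import Data.Fin.Properties using (_≟_)
  open import Data.Fin.Subset using (Subset) renaming (_∈_ to _∈ˢ_)
  open import Data.Fin.Subset.Properties using (_∈?_)
  open import Data.List using (List; []; _∷_; length; filter)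
  open import Data.List.Membership.Propositional using (_∈_)
  open import Data.Nat as ℕ using (suc)
  open import Data.Product using (_×_; _,_)
  open import Data.Rational hiding (_≟_)
  open import Data.Rational.Properties hiding (_≟_)
  open import Data.Sum using (inj₁; inj₂)
  open import Data.Vec using (lookup)
  open import Data.Vec.Properties using (lookup⇒[]=; []=⇒lookup)
  open import Level using (0ℓ)
  open import Relation.Binary.PropositionalEquality hiding ([_])
  open import Relation.Nullary using (¬_; yes; no; contradiction)
  open import Relation.Nullary.Decidable using (_×-dec_)
  open import Relation.Unary using (Pred; Decidable)

  ι-length-filter : ∀ {A : Set} {P : Pred A 0ℓ} (P? : Decidable P) xs (f : A → ℚ) →
    (∀ {x} → P x → f x ≡ 1ℚ) → (∀ {x} → ¬ P x → f x ≡ 0ℚ) → ι (length (filter P? xs)) ≡ Σ xs f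
  ι-length-filter P? []       f f≡1 f≡0 = refl
  ι-length-filter P? (x ∷ xs) f f≡1 f≡0 with P? x
  ... | yes p = trans (ι-suc (length (filter P? xs))) (cong₂ _+_ (sym (f≡1 p)) (ι-length-filter P? xs f f≡1 f≡0))
  ... | no ¬p = trans (ι-length-filter P? xs f f≡1 f≡0) (trans (sym (+-identityˡ _)) (cong (_+ Σ xs f) (sym (f≡0 ¬p))))

  χ-∈ : ∀ {a} {R : Subset n} → a ∈ˢ R → χ a R ≡ 1ℚ
  χ-∈ {a} {R} a∈R with lookup R a | []=⇒lookup a∈R
  ... | true | refl = refl

  χ-∉ : ∀ {a} {R : Subset n} → ¬ a ∈ˢ R → χ a R ≡ 0ℚ
  χ-∉ {a} {R} a∉R with lookup R a in eq
  ... | true  = contradiction (lookup⇒[]= a R eq) a∉R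
  ... | false = refl

  pair : ℕ → Fin n → Subset n → ℚ
  pair b g R = χ g R * χ (b · g) R

  Y : Subset n → ℚ
  Y R = Σ generators (λ g → χ g R)

  W : ℕ → Subset n → ℚ
  W b R = Σ generators (λ g → pair b g R)

  ι-generatorsIn : ∀ R → ι (length (generatorsIn R)) ≡ Y R
  ι-generatorsIn R = ι-length-filter (_∈? R) generators (λ g → χ g R) χ-∈ χ-∉

  ι-generatorPairsIn : ∀ b R → ι (length (generatorPairsIn b R)) ≡ W b R
  ι-generatorPairsIn b R = ι-length-filter (λ g → (g ∈? R) ×-dec (b · g ∈? R)) generators (λ g → pair b g R) both notBoth
    where
    both : ∀ {g} → g ∈ˢ R × b · g ∈ˢ R → pair b g R ≡ 1ℚ
    both (g∈ , bg∈) = cong₂ _*_ (χ-∈ g∈) (χ-∈ bg∈)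
    notBoth : ∀ {g} → ¬ (g ∈ˢ R × b · g ∈ˢ R) → pair b g R ≡ 0ℚ
    notBoth {g} ¬both with g ∈? R
    ... | no  g∉ = trans (cong (_* χ (b · g) R) (χ-∉ g∉)) (*-zeroˡ (χ (b · g) R))
    ... | yes g∈ = trans (cong (χ g R *_) (χ-∉ λ bg∈ → ¬both (g∈ , bg∈))) (*-zeroʳ (χ g R))

  φ′ : ℚ
  φ′ = ι (length generators)

  module _ {q : ℚ} (0≤q : 0ℚ ≤ q) (q≤1 : q ≤ 1ℚ) where

    variance-Y : Ex q (λ R → (Y R - φ′ * q) * (Y R - φ′ * q)) ≤ φ′ * (ι 1 * (q + q))
    variance-Y = secondMoment {n} 0≤q q≤1 generators χ {q} {1} 0≤q q≤1 0≤χ χ≤1 (λ {g} _ → Ex-χ q g)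
      (λ g h → h ≟ g) (λ {g} _ → length-filter-≟ g) uncorrelated
      where
      uncorrelated : ∀ {g h} → g ∈ generators → h ∈ generators → h ≢ g → Ex q (λ R → (χ g R - q) * (χ h R - q)) ≡ 0ℚ
      uncorrelated {g} {h} _ _ h≢g = Ex-uncorrelated q (χ g) (χ h) (Ex-χ q g)
        (Ex-χ* q g {λ R → χ h R - q} (minus-independent {n} {g} {χ h} q (χ-independent (λ g≡h → h≢g (sym g≡h)))))

    variance-W : ∀ i → suc i ℕ.< n → let b = suc (suc i) in
      Ex q (λ R → (W b R - φ′ * (q * q)) * (W b R - φ′ * (q * q))) ≤ φ′ * (ι (2 ℕ.+ (b ℕ.+ b)) * (q * q + q * q))
    variance-W i i<n = secondMoment {n} 0≤q q≤1 generators (pair b) {q * q} {2 ℕ.+ (b ℕ.+ b)} (0≤-* 0≤q 0≤q)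
      (≤-trans (*-mono-≤-nonNeg 0≤q 0≤q q≤1 q≤1) ≤-refl)
      (λ g R → 0≤-* (0≤χ g R) (0≤χ (b · g) R))
      (λ g R → *-mono-≤-nonNeg (0≤χ g R) (0≤χ (b · g) R) (χ≤1 g R) (χ≤1 (b · g) R))
      mean (coincide? b) (λ {g} _ → length-coincide b g) uncorrelated
      where
      b = suc (suc i)
      g≢bg : ∀ {g} → g ∈ generators → g ≢ b · g
      g≢bg g∈ eq = ·-moves-generator (∈-generators⁻ g∈) i<n (sym eq)
      mean : ∀ {g} → g ∈ generators → Ex q (pair b g) ≡ q * q
      mean {g} g∈ = trans (Ex-χ* q g {χ (b · g)} (χ-independent (g≢bg g∈))) (cong (q *_) (Ex-χ q (b · g)))
      uncorrelated : ∀ {g h} → g ∈ generators → h ∈ generators → ¬ Coincide b g h →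
        Ex q (λ R → (pair b g R - q * q) * (pair b h R - q * q)) ≡ 0ℚ
      uncorrelated {g} {h} g∈ h∈ apart = Ex-uncorrelated q (pair b g) (pair b h) (mean g∈) (begin
        -- The two indicators are factored out one after the other: g differs from b g, and neither
        -- occurs in {h, b h}.
        Ex q (λ R → (χ g R * χ (b · g) R) * f R)   ≡⟨ Ex-cong q (λ R → *-assoc (χ g R) (χ (b · g) R) (f R)) ⟩
        Ex q (λ R → χ g R * (χ (b · g) R * f R))   ≡⟨ Ex-χ* q g {λ R → χ (b · g) R * f R}
                                                        (*-independent {n} {g} {χ (b · g)} {f} (χ-independent (g≢bg g∈)) indep-g) ⟩
        q * Ex q (λ R → χ (b · g) R * f R)         ≡⟨ cong (q *_) (Ex-χ* q (b · g) {f} indep-bg) ⟩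
        q * (q * Ex q f)                           ≡⟨ *-assoc q q (Ex q f) ⟨
        q * q * Ex q f                             ∎)
        where
        open ≡-Reasoning
        f = λ R → pair b h R - q * q
        indep : ∀ {a} → a ≢ h → a ≢ b · h → Independent a f
        indep {a} a≢h a≢bh = minus-independent {n} {a} {pair b h} (q * q)
          (*-independent {n} {a} {χ h} {χ (b · h)} (χ-independent a≢h) (χ-independent a≢bh))
        indep-g : Independent g f
        indep-g = indep (λ eq → apart (inj₁ (inj₁ (sym eq)))) (λ eq → apart (inj₂ (inj₁ (sym eq))))
        indep-bg : Independent (b · g) f
        indep-bg = indep (λ eq → apart (inj₁ (inj₂ (sym eq)))) (λ eq → apart (inj₂ (inj₂ (sym eq))))

-- Partial sums of the exponential series and a lower bound for logarithms.

module ExponentialSums where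

  open Rationals
  open Expectation using (Σ; Σ-++; Σ-cong; seq-sumℝ)
  open import Defs as Defs using (ℝ; seq; _IsLogOf_; fromℕ; 1ℝ; 0ℝ; sumℝ; 1/ℕ_)
  open import Data.Integer as ℤ using (+_)
  import Data.Integer.Properties as ℤ
  open import Data.List using (List; []; _∷_; upTo; map)
  open import Data.List.Properties using (upTo-∷ʳ)
  open import Data.Nat as ℕ using (ℕ; zero; suc; _!)
  import Data.Nat.Properties as ℕ
  open import Data.Product using (∃; _×_; _,_; proj₁; proj₂)
  open import Data.Rational
  open import Data.Rational.Properties
  open import Data.Rational.Solver using (module +-*-Solver)
  import Data.Rational.Unnormalised as ℚᵘ
  import Data.Rational.Unnormalised.Properties as ℚᵘ
  open import Data.Sum using ([_,_]′)
  open import Relation.Binary.PropositionalEquality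
  open import Relation.Nullary using (contradiction)
  open import Relation.Nullary.Decidable using (from-yes)
  open +-*-Solver

  recip : ℕ → ℚ
  recip i = ℤ.1ℤ / suc i

  ι*recip : ∀ i → ι (suc i) * recip i ≡ 1ℚ
  ι*recip i = toℚᵘ-injective (begin
    toℚᵘ (ι (suc i) * recip i)                          ≈⟨ toℚᵘ-homo-* (ι (suc i)) (recip i) ⟩
    toℚᵘ (ι (suc i)) ℚᵘ.* toℚᵘ (recip i)                ≈⟨ ℚᵘ.*-cong (toℚᵘ-fromℚᵘ (ℚᵘ.mkℚᵘ (+ suc i) 0)) (toℚᵘ-fromℚᵘ (ℚᵘ.mkℚᵘ ℤ.1ℤ i)) ⟩
    ℚᵘ.mkℚᵘ (+ suc i) 0 ℚᵘ.* ℚᵘ.mkℚᵘ ℤ.1ℤ i             ≈⟨ ℚᵘ.*≡* (trans (ℤ.*-identityʳ _) (trans (ℤ.*-identityʳ (+ suc i))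
                                                            (trans (cong (λ j → + suc j) (sym (ℕ.+-identityʳ i))) (sym (ℤ.*-identityˡ _))))) ⟩
    toℚᵘ 1ℚ                                             ∎)
    where open ℚᵘ.≃-Reasoning

  0≤recip : ∀ i → 0ℚ ≤ recip i
  0≤recip i = nonNegative⁻¹ (recip i) {{pos⇒nonNeg (recip i) {{normalize-pos 1 (suc i)}}}}

  recip≤1 : ∀ i → recip i ≤ 1ℚ
  recip≤1 i = subst₂ _≤_ (*-identityˡ (recip i)) (ι*recip i)
    (*-monoʳ-≤-nonNeg (recip i) {{nonNegative (0≤recip i)}} (ι-mono {1} {suc i} (ℕ.s≤s ℕ.z≤n)))

  term : ℚ → ℕ → ℚ
  term x zero    = 1ℚ
  term x (suc i) = x * recip i * term x i

  term′ : ℚ → ℕ → ℚ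
  term′ x zero    = 0ℚ
  term′ x (suc i) = term x i

  S : (ℕ → ℚ) → ℕ → ℚ
  S f zero    = 0ℚ
  S f (suc d) = S f d + f d

  ι*term : ∀ x i → ι i * term x i ≡ x * term′ x i
  ι*term x zero    = solve 1 (λ x → con 0ℚ :* con 1ℚ := x :* con 0ℚ) refl x
  ι*term x (suc i) = trans (solve 4 (λ n x r t → n :* (x :* r :* t) := (n :* r) :* (x :* t)) refl (ι (suc i)) x (recip i) (term x i))
    (trans (cong (_* (x * term x i)) (ι*recip i)) (*-identityˡ _))

  -- The second-order coefficient of the Taylor expansion of term at x: term (x - h) = term x - h term′ x + h² taylor x h.
  taylor : ℚ → ℚ → ℕ → ℚ
  taylor x h zero    = 0ℚ
  taylor x h (suc i) = recip i * (term′ x i + (x - h) * taylor x h i)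

  -- The first-order part closes up through i x^i / i! = x x^(i-1) / (i-1)!, used in `collapse`; all
  -- the rest goes into `taylor`.
  term-taylor : ∀ x h i → term (x - h) i ≡ term x i - h * term′ x i + h * h * taylor x h i
  term-taylor x h zero    = solve 1 (λ h → con 1ℚ := con 1ℚ :- h :* con 0ℚ :+ h :* h :* con 0ℚ) refl h
  term-taylor x h (suc i) = begin
    (x - h) * r * term (x - h) i
      ≡⟨ cong ((x - h) * r *_) (term-taylor x h i) ⟩
    (x - h) * r * (t - h * u + h * h * D)
      ≡⟨ solve 6 (λ x h r t u D →
           (x :- h) :* r :* (t :- h :* u :+ h :* h :* D)
             := x :* r :* t :- h :* (r :* t :+ r :* (x :* u)) :+ h :* h :* (r :* (u :+ (x :- h) :* D)))
           refl x h r t u D ⟩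
    x * r * t - h * (r * t + r * (x * u)) + h * h * (r * (u + (x - h) * D))
      ≡⟨ cong (λ e → x * r * t - h * e + h * h * (r * (u + (x - h) * D))) collapse ⟩
    x * r * t - h * t + h * h * (r * (u + (x - h) * D)) ∎
    where
    open ≡-Reasoning
    r = recip i
    t = term x i
    u = term′ x i
    D = taylor x h i
    collapse : r * t + r * (x * u) ≡ t
    collapse = begin
      r * t + r * (x * u)        ≡⟨ cong (λ e → r * t + r * e) (ι*term x i) ⟨
      r * t + r * (ι i * t)      ≡⟨ solve 3 (λ r t n → r :* t :+ r :* (n :* t) := ((con 1ℚ :+ n) :* r) :* t) refl r t (ι i) ⟩
      (1ℚ + ι i) * r * t         ≡⟨ cong (λ e → e * r * t) (ι-suc i) ⟨
      ι (suc i) * r * t          ≡⟨ cong (_* t) (ι*recip i) ⟩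
      1ℚ * t                     ≡⟨ *-identityˡ t ⟩
      t                          ∎

  S-taylor : ∀ x h d → S (term (x - h)) d ≡ S (term x) d - h * S (term′ x) d + h * h * S (taylor x h) d
  S-taylor x h zero    = solve 1 (λ h → con 0ℚ := con 0ℚ :- h :* con 0ℚ :+ h :* h :* con 0ℚ) refl h
  S-taylor x h (suc d) = trans (cong₂ _+_ (S-taylor x h d) (term-taylor x h d))
    (solve 7 (λ h a b c a′ b′ c′ → (a :- h :* b :+ h :* h :* c) :+ (a′ :- h :* b′ :+ h :* h :* c′)
        := (a :+ a′) :- h :* (b :+ b′) :+ h :* h :* (c :+ c′)) refl
      h (S (term x) d) (S (term′ x) d) (S (taylor x h) d) (term x d) (term′ x d) (taylor x h d))

  S-term′ : ∀ x d → S (term′ x) (suc d) ≡ S (term x) d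
  S-term′ x zero    = refl
  S-term′ x (suc d) = cong (_+ term x d) (S-term′ x d)

  module _ (B : ℚ) (0≤B : 0ℚ ≤ B) where

    private
      termBound term′Bound taylorBound : ℕ → ℚ
      termBound zero    = 1ℚ
      termBound (suc i) = B * termBound i
      term′Bound zero    = 0ℚ
      term′Bound (suc i) = termBound i
      taylorBound zero    = 0ℚ
      taylorBound (suc i) = term′Bound i + (B + 1ℚ) * taylorBound i

      ∣*∣≤ : ∀ a b {A C} → ∣ a ∣ ≤ A → ∣ b ∣ ≤ C → ∣ a * b ∣ ≤ A * C
      ∣*∣≤ a b a≤ b≤ = ≤-trans (≤-reflexive (∣p*q∣≡∣p∣*∣q∣ a b)) (*-mono-≤-nonNeg (0≤∣p∣ a) (0≤∣p∣ b) a≤ b≤)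

      ∣recip∣≤1 : ∀ i → ∣ recip i ∣ ≤ 1ℚ
      ∣recip∣≤1 i = ≤-trans (≤-reflexive (0≤p⇒∣p∣≡p (0≤recip i))) (recip≤1 i)

      module _ {x h} (∣x∣≤B : ∣ x ∣ ≤ B) (∣x-h∣≤ : ∣ x - h ∣ ≤ B + 1ℚ) where

        term≤ : ∀ i → ∣ term x i ∣ ≤ termBound i
        term≤ zero    = ≤-refl
        term≤ (suc i) = ∣*∣≤ (x * recip i) (term x i)
          (≤-trans (∣*∣≤ x (recip i) ∣x∣≤B (∣recip∣≤1 i)) (≤-reflexive (*-identityʳ B))) (term≤ i)

        term′≤ : ∀ i → ∣ term′ x i ∣ ≤ term′Bound i
        term′≤ zero    = ≤-refl
        term′≤ (suc i) = term≤ i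

        taylor≤ : ∀ i → ∣ taylor x h i ∣ ≤ taylorBound i
        taylor≤ zero    = ≤-refl
        taylor≤ (suc i) = ≤-trans (∣*∣≤ (recip i) (term′ x i + (x - h) * taylor x h i) (∣recip∣≤1 i)
          (≤-trans (∣p+q∣≤∣p∣+∣q∣ (term′ x i) _) (+-mono-≤ (term′≤ i) (∣*∣≤ (x - h) (taylor x h i) ∣x-h∣≤ (taylor≤ i)))))
          (≤-reflexive (*-identityˡ _))

    -- A crude bound is enough: C may depend on B and d, but not on x and h, since the step length
    -- is chosen after C.
    S-taylor-bound : ∀ d → ∃ λ C → 0ℚ ≤ C × (∀ x h → - B ≤ x → x ≤ 0ℚ → 0ℚ ≤ h → h ≤ 1ℚ → S (taylor x h) d ≤ C)
    S-taylor-bound zero    = 0ℚ , ≤-refl , λ _ _ _ _ _ _ → ≤-refl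
    S-taylor-bound (suc d) with S-taylor-bound d
    ... | C , 0≤C , bound = C + ∣ taylorBound d ∣ , 0≤-+ 0≤C (0≤∣p∣ _) , λ x h -B≤x x≤0 0≤h h≤1 →
      +-mono-≤ (bound x h -B≤x x≤0 0≤h h≤1) (≤-trans (p≤∣p∣ _) (≤-trans (taylor≤
        (∣p∣≤-by (≤-trans x≤0 0≤B) (≤-by (≤⇒0≤- -B≤x) (solve 2 (λ b x → b := :- x :+ (x :- (:- b))) refl B x)))
        (∣p∣≤-by (≤-by (0≤-+ (0≤-+ (≤⇒0≤- x≤0) 0≤h) (0≤-+ 0≤B (nonNegative⁻¹ 1ℚ)))
                    (solve 3 (λ b x h → b :+ con 1ℚ := (x :- h) :+ (con 0ℚ :- x :+ h :+ (b :+ con 1ℚ))) refl B x h))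
                 (≤-by (0≤-+ (≤⇒0≤- -B≤x) (≤⇒0≤- h≤1))
                    (solve 3 (λ b x h → b :+ con 1ℚ := :- (x :- h) :+ ((x :- (:- b)) :+ (con 1ℚ :- h))) refl B x h)))
        d) (p≤∣p∣ _)))

  0≤-neg* : ∀ {x y} → x ≤ 0ℚ → y ≤ 0ℚ → 0ℚ ≤ x * y
  0≤-neg* {x} {y} x≤0 y≤0 = subst (0ℚ ≤_) (solve 2 (λ x y → (con 0ℚ :- x) :* (con 0ℚ :- y) := x :* y) refl x y)
    (0≤-* (≤⇒0≤- x≤0) (≤⇒0≤- y≤0))

  *-nonPos : ∀ {x y} → x ≤ 0ℚ → 0ℚ ≤ y → x * y ≤ 0ℚ
  *-nonPos {x} {y} x≤0 0≤y = ≤-by (0≤-* (≤⇒0≤- x≤0) 0≤y) (solve 2 (λ x y → con 0ℚ := x :* y :+ (con 0ℚ :- x) :* y) refl x y)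

  term-even : ∀ {x} → x ≤ 0ℚ → ∀ j → 0ℚ ≤ term x (j ℕ.+ j)
  term-odd  : ∀ {x} → x ≤ 0ℚ → ∀ j → term x (suc (j ℕ.+ j)) ≤ 0ℚ
  term-even x≤0 zero    = nonNegative⁻¹ 1ℚ
  term-even {x} x≤0 (suc j) = subst (λ i → 0ℚ ≤ term x (suc i)) (sym (ℕ.+-suc j j))
    (0≤-neg* (*-nonPos x≤0 (0≤recip (suc (j ℕ.+ j)))) (term-odd x≤0 j))
  term-odd x≤0 j = *-nonPos (*-nonPos x≤0 (0≤recip (j ℕ.+ j))) (term-even x≤0 j)

  S-0 : ∀ d → S (term 0ℚ) (suc d) ≡ 1ℚ
  S-0 zero    = refl
  S-0 (suc d) = trans (cong₂ _+_ (S-0 d) (solve 2 (λ r t → con 0ℚ :* r :* t := con 0ℚ) refl (recip d) (term 0ℚ d))) refl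

  -- Since exp′ = exp up to a last term of the right sign, one Euler step of length h to the left
  -- multiplies a partial sum of even length by at most 1 - h, up to O(h²).
  private
    S-negative′ : ∀ {z} → 0ℚ ≤ z → ∀ j C → 0ℚ ≤ C →
      (∀ x h → - z ≤ x → x ≤ 0ℚ → 0ℚ ≤ h → h ≤ 1ℚ → S (taylor x h) (suc (suc (j ℕ.+ j))) ≤ C) →
      ∀ r → z + z * z * C ≤ ι r → S (term (- z)) (suc (suc (j ℕ.+ j))) ≤ 1ℚ + 1ℚ
    S-negative′ {z} 0≤z j C 0≤C bound r ≤r = subst (λ x → S (term x) M ≤ 1ℚ + 1ℚ) (cong -_ rh≡z)
        (≤-trans (walk (suc r) (ℕ.≤-refl)) (≤-by 0≤slack slack≡))
      where
      M = suc (suc (j ℕ.+ j))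
      -- The walk from 0 to -z takes r + 1 steps. As r ≥ z + z²C, the step is at most 1 and the
      -- accumulated error (r + 1) h²C = z²C / (r + 1) is at most 1, hence the bound 2.
      h = z * recip r
      0≤h : 0ℚ ≤ h
      0≤h = 0≤-* 0≤z (0≤recip r)
      rh≡z : ι (suc r) * h ≡ z
      rh≡z = trans (solve 3 (λ n z r → n :* (z :* r) := (n :* r) :* z) refl (ι (suc r)) z (recip r))
        (trans (cong (_* z) (ι*recip r)) (*-identityˡ z))
      small : ∀ {a} → a ≤ ι (suc r) → a * recip r ≤ 1ℚ
      small a≤ = ≤-trans (*-monoʳ-≤-nonNeg (recip r) {{nonNegative (0≤recip r)}} a≤) (≤-reflexive (ι*recip r))
      h≤1 : h ≤ 1ℚ
      h≤1 = small {z} (≤-trans (≤-by {z} {z + z * z * C} {z * z * C} (0≤-* (0≤-* 0≤z 0≤z) 0≤C) refl) (≤-trans ≤r (ι-mono (ℕ.n≤1+n r))))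
      zzC≤1 : z * z * C * recip r ≤ 1ℚ
      zzC≤1 = small {z * z * C} (≤-trans (≤-by {z * z * C} {z + z * z * C} {z} 0≤z (+-comm z (z * z * C))) (≤-trans ≤r (ι-mono (ℕ.n≤1+n r))))
      0≤slack : 0ℚ ≤ 1ℚ - z * z * C * recip r
      0≤slack = ≤⇒0≤- zzC≤1
      slack≡ : 1ℚ + 1ℚ ≡ 1ℚ + ι (suc r) * (h * h * C) + (1ℚ - z * z * C * recip r)
      slack≡ = begin
        1ℚ + 1ℚ
          ≡⟨ solve 1 (λ e → con 1ℚ :+ con 1ℚ := con 1ℚ :+ e :+ (con 1ℚ :- e)) refl (z * z * C * recip r) ⟩
        1ℚ + z * z * C * recip r + (1ℚ - z * z * C * recip r)
          ≡⟨ cong (λ e → 1ℚ + e + (1ℚ - z * z * C * recip r)) (begin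
               z * z * C * recip r                    ≡⟨ solve 3 (λ z C r → z :* z :* C :* r := z :* (z :* r :* C)) refl z C (recip r) ⟩
               z * (h * C)                            ≡⟨ cong (_* (h * C)) rh≡z ⟨
               ι (suc r) * h * (h * C)                ≡⟨ solve 3 (λ n h C → n :* h :* (h :* C) := n :* (h :* h :* C)) refl (ι (suc r)) h C ⟩
               ι (suc r) * (h * h * C)                ∎) ⟩
        1ℚ + ι (suc r) * (h * h * C) + (1ℚ - z * z * C * recip r) ∎
        where open ≡-Reasoning
      -- The derivative of s + t is s, and s ≥ s + t because the last term t has odd index and so is
      -- nonpositive.
      step : ∀ x → - z ≤ x → x ≤ 0ℚ → S (term (x - h)) M ≤ (1ℚ - h) * S (term x) M + h * h * C
      step x -z≤x x≤0 = ≤-by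
        (0≤-+ (0≤-* 0≤h (≤⇒0≤- (term-odd x≤0 j))) (0≤-* (0≤-* 0≤h 0≤h) (≤⇒0≤- (bound x h -z≤x x≤0 0≤h h≤1))))
        (begin
          (1ℚ - h) * (s + t) + h * h * C
            ≡⟨ solve 5 (λ h s t C D → (con 1ℚ :- h) :* (s :+ t) :+ h :* h :* C
                 := ((s :+ t) :- h :* s :+ h :* h :* D) :+ (h :* (con 0ℚ :- t) :+ h :* h :* (C :- D))) refl h s t C D ⟩
          ((s + t) - h * s + h * h * D) + (h * (0ℚ - t) + h * h * (C - D))
            ≡⟨ cong (_+ (h * (0ℚ - t) + h * h * (C - D))) (trans (S-taylor x h M)
                 (cong (λ e → (s + t) - h * e + h * h * D) (S-term′ x (suc (j ℕ.+ j))))) ⟨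
          S (term (x - h)) M + (h * (0ℚ - t) + h * h * (C - D)) ∎)
        where
        open ≡-Reasoning
        s = S (term x) (suc (j ℕ.+ j))
        t = term x (suc (j ℕ.+ j))
        D = S (taylor x h) M
      walk : ∀ i → i ℕ.≤ suc r → S (term (- (ι i * h))) M ≤ 1ℚ + ι i * (h * h * C)
      walk zero    _   = ≤-reflexive (trans (cong (λ x → S (term x) M) (solve 1 (λ h → :- (con 0ℚ :* h) := con 0ℚ) refl h))
        (trans (S-0 (suc (j ℕ.+ j))) (solve 1 (λ c → con 1ℚ := con 1ℚ :+ con 0ℚ :* c) refl (h * h * C))))
      walk (suc i) i≤r = begin
        S (term (- (ι (suc i) * h))) M
          ≡⟨ cong (λ x → S (term x) M) (trans (cong (λ n → - (n * h)) (ι-suc i))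
               (solve 2 (λ n h → :- ((con 1ℚ :+ n) :* h) := :- (n :* h) :- h) refl (ι i) h)) ⟩
        S (term (x - h)) M
          ≤⟨ step x (neg-antimono-≤ (≤-trans (*-monoʳ-≤-nonNeg h {{nonNegative 0≤h}} (ι-mono (ℕ.≤-trans (ℕ.n≤1+n i) i≤r))) (≤-reflexive rh≡z)))
                    (neg-antimono-≤ (0≤-* (0≤ι i) 0≤h)) ⟩
        (1ℚ - h) * S (term x) M + h * h * C
          ≤⟨ +-monoˡ-≤ (h * h * C) (*-monoˡ-≤-nonNeg (1ℚ - h) {{nonNegative (≤⇒0≤- h≤1)}} (walk i (ℕ.≤-trans (ℕ.n≤1+n i) i≤r))) ⟩
        (1ℚ - h) * (1ℚ + ι i * (h * h * C)) + h * h * C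
          ≤⟨ ≤-by (0≤-* 0≤h (0≤-+ (nonNegative⁻¹ 1ℚ) (0≤-* (0≤ι i) (0≤-* (0≤-* 0≤h 0≤h) 0≤C))))
               (solve 3 (λ n h c → con 1ℚ :+ (con 1ℚ :+ n) :* c
                  := ((con 1ℚ :- h) :* (con 1ℚ :+ n :* c) :+ c) :+ h :* (con 1ℚ :+ n :* c)) refl (ι i) h (h * h * C)) ⟩
        1ℚ + (1ℚ + ι i) * (h * h * C)
          ≡⟨ cong (λ n → 1ℚ + n * (h * h * C)) (ι-suc i) ⟨
        1ℚ + ι (suc i) * (h * h * C) ∎
        where
        open ≤-Reasoning
        x = - (ι i * h)

  -- Excludes negative candidates for log n. An even number of terms ends on a nonpositive term; an
  -- odd number could end on a huge positive one.
  S-negative : ∀ {z} → 0ℚ ≤ z → ∀ j → S (term (- z)) (suc (suc (j ℕ.+ j))) ≤ 1ℚ + 1ℚ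
  S-negative {z} 0≤z j =
    let C , 0≤C , bound = S-taylor-bound z 0≤z (suc (suc (j ℕ.+ j)))
        r , ≤r          = archimedean (z + z * z * C)
    in S-negative′ 0≤z j C 0≤C bound r ≤r

  0≤term : ∀ {x} → 0ℚ ≤ x → ∀ i → 0ℚ ≤ term x i
  0≤term 0≤x zero    = nonNegative⁻¹ 1ℚ
  0≤term 0≤x (suc i) = 0≤-* (0≤-* 0≤x (0≤recip i)) (0≤term 0≤x i)

  term-mono : ∀ {x y} → 0ℚ ≤ x → x ≤ y → ∀ i → term x i ≤ term y i
  term-mono 0≤x x≤y zero    = ≤-refl
  term-mono 0≤x x≤y (suc i) = *-mono-≤-nonNeg (0≤-* 0≤x (0≤recip i)) (0≤term 0≤x i)
    (*-monoʳ-≤-nonNeg (recip i) {{nonNegative (0≤recip i)}} x≤y) (term-mono 0≤x x≤y i)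

  S-mono : ∀ {x y} → 0ℚ ≤ x → x ≤ y → ∀ d → S (term x) d ≤ S (term y) d
  S-mono 0≤x x≤y zero    = ≤-refl
  S-mono 0≤x x≤y (suc d) = +-mono-≤ (S-mono 0≤x x≤y d) (term-mono 0≤x x≤y d)

  0≤S : ∀ {x} → 0ℚ ≤ x → ∀ d → 0ℚ ≤ S (term x) d
  0≤S 0≤x zero    = ≤-refl
  0≤S 0≤x (suc d) = 0≤-+ (0≤S 0≤x d) (0≤term 0≤x d)

  expBound : ℕ → ℚ
  expBound l = S (term (ι l)) (l ℕ.+ l) + (1ℚ + 1ℚ) * term (ι l) (l ℕ.+ l)

  -- From index 2l on the terms l^i / i! at least halve, so that S + 2 term decreases.
  S-expBound : ∀ l c → S (term (ι l)) (c ℕ.+ (l ℕ.+ l)) + (1ℚ + 1ℚ) * term (ι l) (c ℕ.+ (l ℕ.+ l)) ≤ expBound l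
  S-expBound l zero    = ≤-refl
  S-expBound l (suc c) = ≤-trans (≤-by (0≤-* (≤⇒0≤- halving) (0≤term (0≤ι l) d))
      (solve 4 (λ s t x r → s :+ (con 1ℚ :+ con 1ℚ) :* t
        := (s :+ t :+ (con 1ℚ :+ con 1ℚ) :* (x :* r :* t)) :+ (con 1ℚ :- (x :+ x) :* r) :* t) refl
        (S (term (ι l)) d) (term (ι l) d) (ι l) (recip d)))
    (S-expBound l c)
    where
    d = c ℕ.+ (l ℕ.+ l)
    halving : (ι l + ι l) * recip d ≤ 1ℚ
    halving = ≤-trans (*-monoʳ-≤-nonNeg (recip d) {{nonNegative (0≤recip d)}}
      (≤-trans (≤-reflexive (sym (ι-+ l l))) (ι-mono (ℕ.m≤n⇒m≤1+n (ℕ.m≤n+m (l ℕ.+ l) c))))) (≤-reflexive (ι*recip d))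

  pow : ℚ → ℕ → ℚ
  pow x zero    = 1ℚ
  pow x (suc i) = x * pow x i

  seq-^ : ∀ (y : ℝ) i m → seq (y Defs.^ i) m ≡ pow (seq y m) i
  seq-^ y zero    m = refl
  seq-^ y (suc i) m = cong (seq y m *_) (seq-^ y i m)

  ι*1/ℕ : ∀ k {{_ : ℕ.NonZero k}} m → ι k * seq (1/ℕ k) m ≡ 1ℚ
  ι*1/ℕ (suc k) m = ι*recip k

  inverse-unique : ∀ {a u v} → a * u ≡ 1ℚ → a * v ≡ 1ℚ → u ≡ v
  inverse-unique {a} {u} {v} au av = begin
    u             ≡⟨ *-identityʳ u ⟨
    u * 1ℚ        ≡⟨ cong (u *_) av ⟨
    u * (a * v)   ≡⟨ solve 3 (λ a u v → u :* (a :* v) := (a :* u) :* v) refl a u v ⟩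
    a * u * v     ≡⟨ cong (_* v) au ⟩
    1ℚ * v        ≡⟨ *-identityˡ v ⟩
    v             ∎
    where open ≡-Reasoning

  -- `1/ℕ` is defined by cases and does not compute on a factorial, so both sides are compared as
  -- inverses of (i + 1)!.
  1/ℕ-! : ∀ i m → seq (1/ℕ (suc i !)) m ≡ recip i * seq (1/ℕ (i !)) m
  1/ℕ-! i m = inverse-unique {ι (suc i !)} (ι*1/ℕ (suc i !) {{suc i ℕ.!≢0}} m) (begin
    ι (suc i !) * (recip i * seq (1/ℕ (i !)) m)
      ≡⟨ cong (_* (recip i * seq (1/ℕ (i !)) m)) (ι-* (suc i) (i !)) ⟩
    ι (suc i) * ι (i !) * (recip i * seq (1/ℕ (i !)) m)
      ≡⟨ solve 4 (λ a b c d → a :* b :* (c :* d) := (a :* c) :* (b :* d)) refl (ι (suc i)) (ι (i !)) (recip i) (seq (1/ℕ (i !)) m) ⟩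
    ι (suc i) * recip i * (ι (i !) * seq (1/ℕ (i !)) m)
      ≡⟨ cong₂ _*_ (ι*recip i) (ι*1/ℕ (i !) {{i ℕ.!≢0}} m) ⟩
    1ℚ * 1ℚ ≡⟨⟩
    1ℚ ∎)
    where
    open ≡-Reasoning

  term≡ : ∀ (y : ℝ) i m → seq (y Defs.^ i Defs.* 1/ℕ (i !)) m ≡ term (seq y m) i
  term≡ y zero    m = refl
  term≡ y (suc i) m = begin
    seq y m * seq (y Defs.^ i) m * seq (1/ℕ (suc i !)) m
      ≡⟨ cong (seq y m * seq (y Defs.^ i) m *_) (1/ℕ-! i m) ⟩
    seq y m * seq (y Defs.^ i) m * (recip i * seq (1/ℕ (i !)) m)
      ≡⟨ solve 4 (λ y p r f → y :* p :* (r :* f) := y :* r :* (p :* f)) refl (seq y m) (seq (y Defs.^ i) m) (recip i) (seq (1/ℕ (i !)) m) ⟩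
    seq y m * recip i * (seq (y Defs.^ i) m * seq (1/ℕ (i !)) m)
      ≡⟨ cong (seq y m * recip i *_) (term≡ y i m) ⟩
    seq y m * recip i * term (seq y m) i ∎
    where open ≡-Reasoning

  Σ-upTo : ∀ f d → Σ (upTo d) f ≡ S f d
  Σ-upTo f zero    = refl
  Σ-upTo f (suc d) = trans (cong (λ xs → Σ xs f) (sym (upTo-∷ʳ d)))
    (trans (Σ-++ (upTo d) (d ∷ []) f) (cong₂ _+_ (Σ-upTo f d) (+-identityʳ (f d))))

  expSum : ∀ (y : ℝ) d m → seq (sumℝ (map (λ i → y Defs.^ i Defs.* 1/ℕ (i !)) (upTo d))) m ≡ S (term (seq y m)) d
  expSum y d m = trans (seq-sumℝ (λ i → y Defs.^ i Defs.* 1/ℕ (i !)) (upTo d) m)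
    (trans (Σ-cong (upTo d) (λ i → term≡ y i m)) (Σ-upTo (term (seq y m)) d))

  -- If some late term of y were at most l, an even partial sum there would be at most `expBound l`
  -- + 2, by monotonicity for a nonnegative term and by `S-negative` otherwise. Yet it is within 2
  -- of n. The threshold N is uniform in y.
  log-large : ∀ l → ∃ λ N → ∀ n → N ℕ.≤ n → ∀ y → y IsLogOf fromℕ n → ∃ λ m₀ → ∀ m → m₀ ℕ.≤ m → ι l ≤ seq y m
  log-large l = N , λ n N≤n y isLog → large n N≤n y (isLog 1ℝ 0<1)
    where
    -- The 5 consists of 2 for the distance from n (limit and index tolerance, 1 each), 2 for the
    -- bound at negative arguments, and 1 for strictness.
    N  = proj₁ (archimedean (expBound l + ι 5))
    ≤N = proj₂ (archimedean (expBound l + ι 5))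
    0<1 : 0ℝ Defs.< 1ℝ
    0<1 = 1ℚ , positive⁻¹ 1ℚ , 0 , λ _ _ → ≤-refl
    0≤G : 0ℚ ≤ expBound l
    0≤G = 0≤-+ (0≤S (0≤ι l) (l ℕ.+ l)) (0≤-* (nonNegative⁻¹ (1ℚ + 1ℚ)) (0≤term (0≤ι l) (l ℕ.+ l)))
    large : ∀ n → N ℕ.≤ n → ∀ y →
      (∃ λ N₀ → ∀ d → N₀ ℕ.≤ d → Defs.∣ sumℝ (map (λ i → y Defs.^ i Defs.* 1/ℕ (i !)) (upTo d)) Defs.- fromℕ n ∣ Defs.≤ 1ℝ) →
      ∃ λ m₀ → ∀ m → m₀ ℕ.≤ m → ι l ≤ seq y m
    large n N≤n y (N₀ , close) = m₀ , λ m m₀≤m → bound (seq y m) (subst (λ s → ∣ s - ι n ∣ ≤ 1ℚ + 1ℚ) (expSum y M m) (near m m₀≤m))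
      where
      -- Makes M even, beyond N₀ for closeness to n, and at least 2l for `S-expBound`.
      K = N₀ ℕ.+ l
      M = suc (suc (K ℕ.+ K))
      N₀≤M : N₀ ℕ.≤ M
      N₀≤M = ℕ.≤-trans (ℕ.m≤m+n N₀ l) (ℕ.≤-trans (ℕ.m≤m+n K K) (ℕ.≤-trans (ℕ.n≤1+n _) (ℕ.n≤1+n _)))
      eventually = close M N₀≤M 1ℚ (positive⁻¹ 1ℚ)
      m₀ = proj₁ eventually
      near = proj₂ eventually
      2l≤M : l ℕ.+ l ℕ.≤ M
      2l≤M = ℕ.≤-trans (ℕ.+-mono-≤ (ℕ.m≤n+m l N₀) (ℕ.m≤n+m l N₀)) (ℕ.≤-trans (ℕ.n≤1+n _) (ℕ.n≤1+n _))
      bound : ∀ x → ∣ S (term x) M - ι n ∣ ≤ 1ℚ + 1ℚ → ι l ≤ x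
      bound x near = [ (λ l≤x → l≤x) , (λ x≤l → contradiction (≤-<-trans (S≤ x≤l) (<-≤-trans gap S≥)) (<-irrefl refl)) ]′ (≤-total (ι l) x)
        where
        S≥ : ι n - (1ℚ + 1ℚ) ≤ S (term x) M
        S≥ = ≤-by (≤⇒0≤- (≤-trans (p≤∣p∣ (- (S (term x) M - ι n))) (≤-trans (≤-reflexive (∣-p∣≡∣p∣ (S (term x) M - ι n))) near)))
          (solve 2 (λ s n → s := (n :- (con 1ℚ :+ con 1ℚ)) :+ ((con 1ℚ :+ con 1ℚ) :- (:- (s :- n)))) refl (S (term x) M) (ι n))
        gap : expBound l + (1ℚ + 1ℚ) < ι n - (1ℚ + 1ℚ)
        gap = <-≤-trans (subst (_< expBound l + ι 3) (refl {x = expBound l + (1ℚ + 1ℚ)}) (+-monoʳ-< (expBound l) 2<3))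
          (≤-by (≤⇒0≤- (≤-trans ≤N (ι-mono N≤n)))
            (solve 2 (λ g n → n :- (con 1ℚ :+ con 1ℚ) := (g :+ con (ι 3)) :+ (n :- (g :+ con (ι 5)))) refl (expBound l) (ι n)))
          where
          2<3 : 1ℚ + 1ℚ < ι 3
          2<3 = from-yes (1ℚ + 1ℚ <? ι 3)
        nonNegative≤ : x ≤ ι l → 0ℚ ≤ x → S (term x) M ≤ expBound l + (1ℚ + 1ℚ)
        nonNegative≤ x≤l 0≤x = ≤-trans (S-mono 0≤x x≤l M) (≤-trans
          (≤-by (0≤-* (nonNegative⁻¹ (1ℚ + 1ℚ)) (0≤term (0≤ι l) M)) refl)
          (≤-trans (subst (λ d → S (term (ι l)) d + (1ℚ + 1ℚ) * term (ι l) d ≤ expBound l) (ℕ.m∸n+n≡m 2l≤M) (S-expBound l (M ℕ.∸ (l ℕ.+ l))))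
            (≤-by (nonNegative⁻¹ (1ℚ + 1ℚ)) refl)))
        nonPositive≤ : x ≤ 0ℚ → S (term x) M ≤ expBound l + (1ℚ + 1ℚ)
        nonPositive≤ x≤0 = ≤-trans (subst (λ x → S (term x) M ≤ 1ℚ + 1ℚ) (solve 1 (λ x → :- (:- x) := x) refl x) (S-negative (neg-antimono-≤ x≤0) K))
          (≤-by 0≤G (+-comm (expBound l) (1ℚ + 1ℚ)))
        S≤ : x ≤ ι l → S (term x) M ≤ expBound l + (1ℚ + 1ℚ)
        S≤ x≤l = [ nonNegative≤ x≤l , nonPositive≤ ]′ (≤-total 0ℚ x)

-- The constants depending on k.

module Constants (k : ℕ) where

  open Rationals
  open Words using (words)
  open import Data.List using (length)
  open import Data.Rational

  -- c bounds the error and A the variance, both relative to the scales of the theorem.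
  width : ℕ
  width = 3 ℕ.* k

  -- The bound 2 + 2b on overlapping pairs, at b = 2 + `width`.
  maxCoincidences : ℕ
  maxCoincidences = 2 ℕ.+ ((2 ℕ.+ width) ℕ.+ (2 ℕ.+ width))

  wordCount : ℚ
  wordCount = ι (length (words width (2 ℕ.* k)))

  -- The 4 comes from q₀² ≤ (2q)² in the mean of the pairs. The 3 is the deviation of Y, at most
  -- 2√(pφ) log^D, plus the drift of its mean.
  c : ℚ
  c = ι 4 * (wordCount * ι width) + ι 3

  -- Doubled variance plus doubled squared drift: 2 · 2 + 2 = 6 for Y, and 2 · 2 `maxCoincidences` +
  -- 2 for each number of pairs.
  A : ℚ
  A = ι 6 + ι width * (ι 4 * ι maxCoincidences + ι 2)

  0≤wordCount*width : 0ℚ ≤ wordCount * ι width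
  0≤wordCount*width = 0≤-* (0≤ι (length (words width (2 ℕ.* k)))) (0≤ι width)

  0≤A : 0ℚ ≤ A
  0≤A = 0≤-+ (0≤ι 6) (0≤-* (0≤ι width) (0≤-+ (0≤-* (0≤ι 4) (0≤ι maxCoincidences)) (0≤ι 2)))

-- Concentration of the count.

module Concentration (k n : ℕ) {{_ : NonZero n}} (big : 6 ℕ.* k ℕ.+ 2 ℕ.≤ n) (ℓ : ℕ) (ℓ+ : ℓ ℕ.+ ℕ.suc k ≡ n) where

  open Constants k
  open Rationals
  open Expectation
  open Residues n using ([_]; 1·≡)
  open Structure n using (multiple⇒generator)
  open Words using (words)
  open Sandwich n
  open Variances n
  open import Defs using (#zeroSumFree; IsGenerator?)
  open import Data.Fin.Subset using (Subset)
  open import Data.List using (List; []; _∷_; length; map; upTo; allFin)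
  open import Data.List.Properties using (length-upTo; length-filter; length-tabulate)
  open import Data.List.Membership.Propositional using (_∈_)
  open import Data.List.Membership.Propositional.Properties using (∈-upTo⁻; ∈-upTo⁺)
  open import Data.List.Relation.Unary.Any using (here; there)
  open import Data.Nat using (suc)
  open import Data.Nat.ListAction using (sum)
  import Data.Nat.Properties as ℕ
  open import Data.Rational hiding (truncate)
  open import Data.Rational.Properties
  open import Data.Rational.Solver using (module +-*-Solver)
  open import Relation.Binary.PropositionalEquality hiding ([_])
  open +-*-Solver

  1≤φ′ : 1ℚ ≤ φ′
  1≤φ′ = ι-mono {1} {length generators} (nonempty (∈-generators⁺ (multiple⇒generator {[ 1 ]} 1 (1·≡ [ 1 ]))))
    where
    nonempty : ∀ {A : Set} {x : A} {xs} → x ∈ xs → 1 ℕ.≤ length xs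
    nonempty (here _)  = ℕ.s≤s ℕ.z≤n
    nonempty (there _) = ℕ.s≤s ℕ.z≤n

  0≤φ′ : 0ℚ ≤ φ′
  0≤φ′ = 0≤ι (length generators)

  φ′≤n : φ′ ≤ ι n
  φ′≤n = ι-mono {length generators} {n} (ℕ.≤-trans (length-filter IsGenerator? (allFin n)) (ℕ.≤-reflexive (length-tabulate {n = n} (λ x → x))))

  square : ℚ → ℚ
  square x = x * x

  -- All squared deviations are added up, so that a single application of Markov's inequality
  -- controls Y and every W at once.
  V : ℚ → Subset n → ℚ
  V q₀ R = square (Y R - φ′ * q₀) + Σ (upTo width) (λ i → square (W (2 ℕ.+ i) R - φ′ * (q₀ * q₀)))

  0≤Σ : ∀ {A : Set} (xs : List A) {f : A → ℚ} → (∀ x → 0ℚ ≤ f x) → 0ℚ ≤ Σ xs f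
  0≤Σ []       0≤f = ≤-refl
  0≤Σ (x ∷ xs) 0≤f = 0≤-+ (0≤f x) (0≤Σ xs 0≤f)

  Σ-term≤ : ∀ {A : Set} {xs : List A} {f : A → ℚ} {x} → (∀ x → 0ℚ ≤ f x) → x ∈ xs → f x ≤ Σ xs f
  Σ-term≤ {xs = x ∷ xs} 0≤f (here refl) = ≤-by (0≤Σ xs 0≤f) refl
  Σ-term≤ {xs = y ∷ xs} {f} {x} 0≤f (there x∈) = ≤-trans (Σ-term≤ {f = f} 0≤f x∈) (≤-by (0≤f y) (+-comm (f y) (Σ xs f)))

  0≤V : ∀ q₀ R → 0ℚ ≤ V q₀ R
  0≤V q₀ R = 0≤-+ (0≤-square (Y R - φ′ * q₀)) (0≤Σ (upTo width) (λ i → 0≤-square (W (2 ℕ.+ i) R - φ′ * (q₀ * q₀))))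

  module _ {q} (0≤q : 0ℚ ≤ q) (q≤1 : q ≤ 1ℚ) where

    -- Since (u + v)² + (u - v)² = 2u² + 2v² with u = X - μ and v = μ - α.
    shift-centre : ∀ (X : Subset n → ℚ) μ α → Ex q (λ R → square (X R - α))
      ≤ ι 2 * Ex q (λ R → square (X R - μ)) + ι 2 * square (μ - α)
    shift-centre X μ α = begin
      Ex q (λ R → square (X R - α))
        ≤⟨ Ex-mono 0≤q q≤1 (λ R → ≤-by (0≤-square (X R - μ - (μ - α)))
             (solve 3 (λ x m a → con (ι 2) :* ((x :- m) :* (x :- m)) :+ con (ι 2) :* ((m :- a) :* (m :- a))
               := (x :- a) :* (x :- a) :+ (x :- m :- (m :- a)) :* (x :- m :- (m :- a))) refl (X R) μ α)) ⟩
      Ex q (λ R → ι 2 * square (X R - μ) + ι 2 * square (μ - α))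
        ≡⟨ Ex-+ q (λ R → ι 2 * square (X R - μ)) (λ _ → ι 2 * square (μ - α)) ⟩
      Ex q (λ R → ι 2 * square (X R - μ)) + Ex {n} q (λ _ → ι 2 * square (μ - α))
        ≡⟨ cong₂ _+_ (Ex-* q (ι 2) (λ R → square (X R - μ))) (Ex-const {n} q (ι 2 * square (μ - α))) ⟩
      ι 2 * Ex q (λ R → square (X R - μ)) + ι 2 * square (μ - α) ∎
      where open ≤-Reasoning

    2*-mono : ∀ {a b} → a ≤ b → ι 2 * a ≤ ι 2 * b
    2*-mono a≤b = *-monoˡ-≤-nonNeg (ι 2) {{nonNegative (0≤ι 2)}} a≤b

    q²≤q : q * q ≤ q
    q²≤q = ≤-by (0≤-* 0≤q (≤⇒0≤- q≤1)) (solve 1 (λ q → q := q :* q :+ q :* (con 1ℚ :- q)) refl q)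

    -- Every contribution is of order φ q: the variances directly, for pairs by q² ≤ q, and the
    -- drifts by assumption.
    Ex-V : ∀ {q₀} → square (φ′ * q - φ′ * q₀) ≤ φ′ * q → square (φ′ * (q * q) - φ′ * (q₀ * q₀)) ≤ φ′ * q →
      Ex q (V q₀) ≤ A * (φ′ * q)
    Ex-V {q₀} drift-Y drift-W = begin
      Ex q (V q₀)
        ≡⟨ Ex-+ q (λ R → square (Y R - φ′ * q₀)) (λ R → Σ (upTo width) (λ i → square (W (2 ℕ.+ i) R - φ′ * (q₀ * q₀)))) ⟩
      Ex q (λ R → square (Y R - φ′ * q₀)) + Ex q (λ R → Σ (upTo width) (λ i → square (W (2 ℕ.+ i) R - φ′ * (q₀ * q₀))))
        ≡⟨ cong (Ex q (λ R → square (Y R - φ′ * q₀)) +_) (Ex-Σ q (upTo width) (λ i R → square (W (2 ℕ.+ i) R - φ′ * (q₀ * q₀)))) ⟩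
      Ex q (λ R → square (Y R - φ′ * q₀)) + Σ (upTo width) (λ i → Ex q (λ R → square (W (2 ℕ.+ i) R - φ′ * (q₀ * q₀))))
        ≤⟨ +-mono-≤ part-Y (Σ-bound (upTo width) (λ {i} i∈ → part-W i (∈-upTo⁻ i∈))) ⟩
      ι 6 * (φ′ * q) + ι (length (upTo width)) * ((ι 4 * ι maxCoincidences + ι 2) * (φ′ * q))
        ≡⟨ cong (λ w → ι 6 * (φ′ * q) + ι w * ((ι 4 * ι maxCoincidences + ι 2) * (φ′ * q))) (length-upTo width) ⟩
      ι 6 * (φ′ * q) + ι width * ((ι 4 * ι maxCoincidences + ι 2) * (φ′ * q))
        ≡⟨ solve 4 (λ a w d x → a :* x :+ w :* (d :* x) := (a :+ w :* d) :* x) refl (ι 6) (ι width) (ι 4 * ι maxCoincidences + ι 2) (φ′ * q) ⟩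
      A * (φ′ * q) ∎
      where
      open ≤-Reasoning
      part-Y : Ex q (λ R → square (Y R - φ′ * q₀)) ≤ ι 6 * (φ′ * q)
      part-Y = ≤-trans (shift-centre Y (φ′ * q) (φ′ * q₀)) (≤-trans
        (+-mono-≤ (2*-mono (variance-Y 0≤q q≤1)) (2*-mono drift-Y))
        (≤-reflexive (solve 2 (λ f q → con (ι 2) :* (f :* (con (ι 1) :* (q :+ q))) :+ con (ι 2) :* (f :* q) := con (ι 6) :* (f :* q)) refl φ′ q)))
      part-W : ∀ i → i ℕ.< width → Ex q (λ R → square (W (2 ℕ.+ i) R - φ′ * (q₀ * q₀))) ≤ (ι 4 * ι maxCoincidences + ι 2) * (φ′ * q)
      part-W i i<w = ≤-trans (shift-centre (W (2 ℕ.+ i)) (φ′ * (q * q)) (φ′ * (q₀ * q₀))) (≤-trans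
        (+-mono-≤ (2*-mono (≤-trans (variance-W 0≤q q≤1 i i<n) bound)) (2*-mono drift-W))
        (≤-reflexive (solve 3 (λ f d q → con (ι 2) :* (f :* (d :* (q :+ q))) :+ con (ι 2) :* (f :* q)
          := (con (ι 4) :* d :+ con (ι 2)) :* (f :* q)) refl φ′ (ι maxCoincidences) q)))
        where
        i<n : suc i ℕ.< n
        i<n = ℕ.≤-<-trans i<w (ℕ.<-≤-trans (ℕ.m<m+n width (ℕ.s≤s ℕ.z≤n))
          (ℕ.≤-trans (ℕ.+-monoˡ-≤ 2 (ℕ.*-monoˡ-≤ k {3} {6} (ℕ.s≤s (ℕ.s≤s (ℕ.s≤s ℕ.z≤n))))) big))
        b≤ : 2 ℕ.+ i ℕ.≤ 2 ℕ.+ width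
        b≤ = ℕ.+-monoʳ-≤ 2 (ℕ.<⇒≤ i<w)
        bound : φ′ * (ι (2 ℕ.+ ((2 ℕ.+ i) ℕ.+ (2 ℕ.+ i))) * (q * q + q * q)) ≤ φ′ * (ι maxCoincidences * (q + q))
        bound = *-monoˡ-≤-nonNeg φ′ {{nonNegative 0≤φ′}} (*-mono-≤-nonNeg (0≤ι (2 ℕ.+ ((2 ℕ.+ i) ℕ.+ (2 ℕ.+ i)))) (0≤-+ (0≤-* 0≤q 0≤q) (0≤-* 0≤q 0≤q))
          (ι-mono {2 ℕ.+ ((2 ℕ.+ i) ℕ.+ (2 ℕ.+ i))} {maxCoincidences} (ℕ.+-monoʳ-≤ 2 (ℕ.+-mono-≤ b≤ b≤))) (+-mono-≤ q²≤q q²≤q))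

    probability : ∀ {q₀ ε T} → 0ℚ < T → Ex q (V q₀) ≤ ε * T → 1ℚ - ε ≤ Ex q (𝟙 (atMost (V q₀) T))
    probability {q₀} {ε} {T} 0<T Ex≤ = *-cancelˡ-≤-pos T {{positive 0<T}} (begin
      T * (1ℚ - ε)             ≡⟨ solve 2 (λ t e → t :* (con 1ℚ :- e) := t :- e :* t) refl T ε ⟩
      T - ε * T                ≤⟨ +-monoʳ-≤ T (neg-antimono-≤ Ex≤) ⟩
      T - E                    ≤⟨ +-monoˡ-≤ (- E) (markov 0≤q q≤1 (V q₀) T (0≤V q₀)) ⟩
      T * P + E - E            ≡⟨ solve 2 (λ p e → p :+ e :- e := p) refl (T * P) E ⟩
      T * P                    ∎)
      where
      open ≤-Reasoning
      E = Ex q (V q₀)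
      P = Ex q (𝟙 (atMost (V q₀) T))

  ι-sum : ∀ (f : ℕ → ℕ) xs → ι (sum (map f xs)) ≡ Σ xs (λ i → ι (f i))
  ι-sum f []       = refl
  ι-sum f (x ∷ xs) = trans (ι-+ (f x) (sum (map f xs))) (cong (ι (f x) +_) (ι-sum f xs))

  N : Subset n → ℚ
  N R = ι (#zeroSumFree R ℓ)

  N-lower : ∀ R → Y R ≤ N R
  N-lower R = ≤-trans (≤-reflexive (sym (ι-generatorsIn R))) (ι-mono (lower k ℓ big ℓ+ R))

  N-upper : ∀ R {B} → (∀ i → i ℕ.< width → W (2 ℕ.+ i) R ≤ B) → N R ≤ Y R + wordCount * ι width * B
  N-upper R {B} W≤B = begin
    N R
      ≤⟨ ι-mono (upper k ℓ big ℓ+ R) ⟩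
    ι (length (generatorsIn R) ℕ.+ sum (map (λ i → length (generatorPairsIn (2 ℕ.+ i) R) ℕ.* length (words width (2 ℕ.* k))) (upTo width)))
      ≡⟨ ι-+ (length (generatorsIn R)) _ ⟩
    ι (length (generatorsIn R)) + ι (sum (map (λ i → length (generatorPairsIn (2 ℕ.+ i) R) ℕ.* length (words width (2 ℕ.* k))) (upTo width)))
      ≡⟨ cong₂ _+_ (ι-generatorsIn R) (ι-sum _ (upTo width)) ⟩
    Y R + Σ (upTo width) (λ i → ι (length (generatorPairsIn (2 ℕ.+ i) R) ℕ.* length (words width (2 ℕ.* k))))
      ≤⟨ +-monoʳ-≤ (Y R) (Σ-bound (upTo width) (λ {i} i∈ → each i (∈-upTo⁻ i∈))) ⟩
    Y R + ι (length (upTo width)) * (B * wordCount)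
      ≡⟨ cong (λ w → Y R + ι w * (B * wordCount)) (length-upTo width) ⟩
    Y R + ι width * (B * wordCount)
      ≡⟨ cong (Y R +_) (solve 3 (λ w b c → w :* (b :* c) := c :* w :* b) refl (ι width) B wordCount) ⟩
    Y R + wordCount * ι width * B ∎
    where
    open ≤-Reasoning
    each : ∀ i → i ℕ.< width → ι (length (generatorPairsIn (2 ℕ.+ i) R) ℕ.* length (words width (2 ℕ.* k))) ≤ B * wordCount
    each i i<w = ≤-trans (≤-reflexive (trans (ι-* (length (generatorPairsIn (2 ℕ.+ i) R)) _) (cong (_* wordCount) (ι-generatorPairsIn (2 ℕ.+ i) R))))
      (*-monoʳ-≤-nonNeg wordCount {{nonNegative (0≤ι (length (words width (2 ℕ.* k))))}} (W≤B i i<w))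

  module _ {q₀ τ R} (0≤τ : 0ℚ ≤ τ) (V≤ : V q₀ R ≤ τ * τ) where

    private
      Y-close : ∀ {x} → square x ≡ square (Y R - φ′ * q₀) → x ≤ τ
      Y-close eq = square-cancel-≤ 0≤τ (≤-trans (≤-reflexive eq) (≤-trans
        (≤-by (0≤Σ (upTo width) (λ i → 0≤-square (W (2 ℕ.+ i) R - φ′ * (q₀ * q₀)))) refl) V≤))

      W-close : ∀ i → i ℕ.< width → W (2 ℕ.+ i) R ≤ φ′ * (q₀ * q₀) + τ
      W-close i i<w = ≤-by (≤⇒0≤- (square-cancel-≤ 0≤τ (≤-trans
          (Σ-term≤ {f = λ i → square (W (2 ℕ.+ i) R - φ′ * (q₀ * q₀))} (λ i → 0≤-square (W (2 ℕ.+ i) R - φ′ * (q₀ * q₀))) (∈-upTo⁺ i<w))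
          (≤-trans (≤-by (0≤-square (Y R - φ′ * q₀)) (+-comm (square (Y R - φ′ * q₀)) _)) V≤))))
        (solve 3 (λ w b t → b :+ t := w :+ (t :- (w :- b))) refl (W (2 ℕ.+ i) R) (φ′ * (q₀ * q₀)) τ)

    N-close : ∣ N R - φ′ * q₀ ∣ ≤ τ + wordCount * ι width * (φ′ * (q₀ * q₀) + τ)
    N-close = ∣p∣≤-by
      (≤-by (0≤-+ (≤⇒0≤- (N-upper R W-close)) (≤⇒0≤- (Y-close {Y R - φ′ * q₀} refl)))
        (solve 5 (λ N Y a t e → t :+ e := (N :- a) :+ ((Y :+ e :- N) :+ (t :- (Y :- a)))) refl (N R) (Y R) (φ′ * q₀) τ e))
      (≤-by (0≤-+ (0≤-+ (≤⇒0≤- (N-lower R)) (≤⇒0≤- (Y-close { - (Y R - φ′ * q₀)}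
              (solve 1 (λ y → (:- y) :* (:- y) := y :* y) refl (Y R - φ′ * q₀))))) 0≤e)
        (solve 5 (λ N Y a t e → t :+ e := :- (N :- a) :+ ((N :- Y) :+ (t :- (:- (Y :- a))) :+ e)) refl (N R) (Y R) (φ′ * q₀) τ e))
      where
      e = wordCount * ι width * (φ′ * (q₀ * q₀) + τ)
      0≤e : 0ℚ ≤ e
      0≤e = 0≤-* 0≤wordCount*width (0≤-+ (0≤-* 0≤φ′ (0≤-square q₀)) 0≤τ)

  -- Moves a deviation measured with q₀, s₀ and the fixed l to the scales q, s and x, at the cost of
  -- factors 2 in s₀ and q₀. The shape `q * (q * 1ℚ)` is what `p ^ 2` unfolds to.
  deterministic : ∀ {q q₀ s s₀ l x R} → 0ℚ ≤ q → 0ℚ ≤ s → 0ℚ ≤ s₀ → 1ℚ ≤ l → l ≤ x → s₀ ≤ ι 2 * s → 0ℚ ≤ q₀ → q₀ ≤ ι 2 * q →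
    ∣ φ′ * q₀ - φ′ * q ∣ ≤ s → V q₀ R ≤ l * s₀ * (l * s₀) →
    ∣ N R - q * φ′ ∣ ≤ c * (q * (q * 1ℚ) * φ′ + s * x)
  deterministic {q} {q₀} {s} {s₀} {l} {x} {R} 0≤q 0≤s 0≤s₀ 1≤l l≤x s₀≤ 0≤q₀ q₀≤ drift V≤ = begin
    ∣ N R - q * φ′ ∣
      ≡⟨ cong ∣_∣ (solve 4 (λ N q f q₀ → N :- q :* f := (N :- f :* q₀) :+ (f :* q₀ :- f :* q)) refl (N R) q φ′ q₀) ⟩
    ∣ (N R - φ′ * q₀) + (φ′ * q₀ - φ′ * q) ∣
      ≤⟨ ∣p+q∣≤∣p∣+∣q∣ (N R - φ′ * q₀) (φ′ * q₀ - φ′ * q) ⟩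
    ∣ N R - φ′ * q₀ ∣ + ∣ φ′ * q₀ - φ′ * q ∣
      ≤⟨ +-mono-≤ (N-close {q₀} {τ} {R} 0≤τ V≤) drift ⟩
    τ + e * (φ′ * (q₀ * q₀) + τ) + s
      ≤⟨ +-mono-≤ (+-mono-≤ τ≤ (*-monoˡ-≤-nonNeg e {{nonNegative 0≤wordCount*width}} (+-mono-≤ β≤ τ≤))) s≤ ⟩
    ι 2 * z + e * (φ′ * (ι 2 * q * (ι 2 * q)) + ι 2 * z) + z
      ≤⟨ ≤-by (0≤-+ (0≤-* (0≤ι 3) (0≤-* 0≤φ′ (0≤-* 0≤q 0≤q))) (0≤-* (0≤-* (0≤ι 2) 0≤wordCount*width) (≤-trans 0≤s s≤)))
           (solve 4 (λ z e f q → (con (ι 4) :* e :+ con (ι 3)) :* (q :* (q :* con 1ℚ) :* f :+ z)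
              := (con (ι 2) :* z :+ e :* (f :* (con (ι 2) :* q :* (con (ι 2) :* q)) :+ con (ι 2) :* z) :+ z)
                 :+ (con (ι 3) :* (f :* (q :* q)) :+ con (ι 2) :* e :* z)) refl z e φ′ q) ⟩
    c * (q * (q * 1ℚ) * φ′ + s * x) ∎
    where
    open ≤-Reasoning
    τ = l * s₀
    z = s * x
    e = wordCount * ι width
    0≤l = ≤-trans (nonNegative⁻¹ 1ℚ) 1≤l
    0≤τ : 0ℚ ≤ τ
    0≤τ = 0≤-* 0≤l 0≤s₀
    τ≤ : τ ≤ ι 2 * z
    τ≤ = ≤-trans (*-mono-≤-nonNeg 0≤l 0≤s₀ l≤x s₀≤) (≤-reflexive (solve 2 (λ x s → x :* (con (ι 2) :* s) := con (ι 2) :* (s :* x)) refl x s))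
    s≤ : s ≤ z
    s≤ = ≤-trans (≤-reflexive (sym (*-identityʳ s))) (*-monoˡ-≤-nonNeg s {{nonNegative 0≤s}} (≤-trans 1≤l l≤x))
    β≤ : φ′ * (q₀ * q₀) ≤ φ′ * (ι 2 * q * (ι 2 * q))
    β≤ = *-monoˡ-≤-nonNeg φ′ {{nonNegative 0≤φ′}} (*-mono-≤-nonNeg 0≤q₀ 0≤q₀ q₀≤ q₀≤)

-- Positivity of D.

module Floors where

  open Rationals
  open import Defs as Defs using (seq; _IsSqrtOf_; _IsFloorOf_; fromℕ; 1ℝ; ½ℝ)
  open import Data.Nat using (zero; suc)
  import Data.Nat.Properties as ℕ
  open import Data.Product using (_,_)
  open import Data.Rational
  open import Data.Rational.Properties
  open import Data.Rational.Solver using (module +-*-Solver)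
  open import Relation.Binary.PropositionalEquality
  open import Relation.Nullary using (contradiction)
  open +-*-Solver

  0<½* : ∀ {e} → 0ℚ < e → 0ℚ < ½ * e
  0<½* {e} 0<e = subst (_< ½ * e) (*-zeroʳ ½) (*-monoʳ-<-pos ½ 0<e)

  -- With e the gap below 1 and f = e / 2, the bounds -f ≤ s ≤ 1 - 4f force s² + f < 1.
  floor-positive : ∀ k {D s} → s IsSqrtOf fromℕ (1 ℕ.+ 8 ℕ.* k) → D IsFloorOf ((1ℝ Defs.+ s) Defs.* ½ℝ) → 1 ℕ.≤ D
  floor-positive k {suc D} _ _ = ℕ.s≤s ℕ.z≤n
  floor-positive k {zero} {s} (0≤s , _ , ≤s²) (_ , e , 0<e , N , below) =
    impossible (0≤s f 0<f) (≤s² f 0<f)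
    where
    f = ½ * e
    0<f = 0<½* 0<e
    impossible : _ → _ → _
    impossible (N₁ , 0≤s+f) (N₂ , ≤s²+f) = contradiction (≤-<-trans f≤0 0<f) (<-irrefl refl)
      where
      m = N ℕ.⊔ (N₁ ℕ.⊔ N₂)
      x = seq s m
      0≤f = <⇒≤ 0<f
      0≤P : 0ℚ ≤ 1ℚ - ((1ℚ + x) * ½ + e)
      0≤P = ≤⇒0≤- (below m (ℕ.m≤m⊔n N _))
      0≤Q : 0ℚ ≤ x + f
      0≤Q = 0≤s+f m (ℕ.≤-trans (ℕ.m≤m⊔n N₁ N₂) (ℕ.m≤n⊔m N _))
      0≤H : 0ℚ ≤ x * x + f - 1ℚ
      0≤H = ≤⇒0≤- (≤-trans (ι-mono {1} {1 ℕ.+ 8 ℕ.* k} (ℕ.s≤s ℕ.z≤n)) (≤s²+f m (ℕ.≤-trans (ℕ.m≤n⊔m N₁ N₂) (ℕ.m≤n⊔m N _))))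
      P = 1ℚ - ((1ℚ + x) * ½ + e)
      Q = x + f
      Z = ι 2 * P + Q
      0≤Z : 0ℚ ≤ Z
      0≤Z = 0≤-+ (0≤-* (0≤ι 2) 0≤P) 0≤Q
      f≤0 : f ≤ 0ℚ
      f≤0 = ≤-by {d = ι 4 * f + ι 3 * (x * x + f - 1ℚ) + ι 6 * (P * (Z + (f + f))) + ι 6 * (P * Q) + ι 12 * (f * Q) + ι 4 * (f * Z)}
        (0≤-+ (0≤-+ (0≤-+ (0≤-+ (0≤-+ (0≤-* (0≤ι 4) 0≤f) (0≤-* (0≤ι 3) 0≤H))
          (0≤-* (0≤ι 6) (0≤-* 0≤P (0≤-+ 0≤Z (0≤-+ 0≤f 0≤f))))) (0≤-* (0≤ι 6) (0≤-* 0≤P 0≤Q)))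
          (0≤-* (0≤ι 12) (0≤-* 0≤f 0≤Q))) (0≤-* (0≤ι 4) (0≤-* 0≤f 0≤Z)))
        (solve 2 (λ x e →
          let f = con ½ :* e
              P = con 1ℚ :- ((con 1ℚ :+ x) :* con ½ :+ e)
              Q = x :+ f
              Z = con (ι 2) :* P :+ Q
          in con 0ℚ := f :+ (con (ι 4) :* f :+ con (ι 3) :* (x :* x :+ f :- con 1ℚ) :+ con (ι 6) :* (P :* (Z :+ (f :+ f)))
               :+ con (ι 6) :* (P :* Q) :+ con (ι 12) :* (f :* Q) :+ con (ι 4) :* (f :* Z))) refl x e)

-- Rational approximations at late indices.

module Samples where

  open Rationals using (ι)
  open import Data.Rational

  -- q, s and l stand for late terms of the Cauchy sequences of p, √(pφ) and log n, and f for φ(n).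
  record Sample (f η : ℚ) (λ₀ : ℕ) (q s l : ℚ) : Set where
    field
      4η≤q : ι 4 * η ≤ q
      q≤1  : q ≤ 1ℚ
      λ≤l  : ι λ₀ ≤ l
      qφ≤  : q * f ≤ s * s + η
      0≤s+ : 0ℚ ≤ s + η

module Scales (k n : ℕ) {{_ : NonZero n}} (big : 6 ℕ.* k ℕ.+ 2 ℕ.≤ n) (ℓ : ℕ) (ℓ+ : ℓ ℕ.+ ℕ.suc k ≡ n) where

  open Constants k
  open Concentration k n big ℓ ℓ+
  open Samples
  open Rationals
  open Expectation
  open ExponentialSums using (recip; ι*recip; 0≤recip; recip≤1; pow)
  open Variances n using (φ′)
  open import Data.Nat using (zero; suc)
  import Data.Nat.Properties as ℕ
  open import Data.Product using (_,_)
  open import Data.Rational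
  open import Data.Rational.Properties
  open import Data.Rational.Solver using (module +-*-Solver)
  open import Data.Sum using ([_,_]′)
  open import Relation.Binary.PropositionalEquality
  open import Relation.Nullary using (contradiction)
  open +-*-Solver

  module _ {η λ₀} (0<η : 0ℚ < η) (1≤λ₀ : 1 ℕ.≤ λ₀) where

    0≤η : 0ℚ ≤ η
    0≤η = <⇒≤ 0<η

    1≤λ : 1ℚ ≤ ι λ₀
    1≤λ = ι-mono {1} {λ₀} 1≤λ₀

    module _ {q s l} (sample : Sample φ′ η λ₀ q s l) where

      open Sample sample

      0≤q : 0ℚ ≤ q
      0≤q = ≤-trans (0≤-* (0≤ι 4) 0≤η) 4η≤q

      q≤qφ : q ≤ q * φ′
      q≤qφ = ≤-by (0≤-* 0≤q (≤⇒0≤- 1≤φ′)) (solve 2 (λ q f → q :* f := q :+ q :* (f :- con 1ℚ)) refl q φ′)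

      4η≤1 : ι 4 * η ≤ 1ℚ
      4η≤1 = ≤-trans 4η≤q q≤1

      -- Otherwise s lies between -η and 2η, so s² ≤ 4η² ≤ η, whereas s² + η ≥ q φ ≥ q ≥ 4η.
      2η≤s : ι 2 * η ≤ s
      2η≤s = [ (λ 2η≤s → 2η≤s) , (λ s≤2η → contradiction (≤-<-trans (η≤0 s≤2η) 0<η) (<-irrefl refl)) ]′ (≤-total (ι 2 * η) s)
        where
        η≤0 : s ≤ ι 2 * η → η ≤ 0ℚ
        η≤0 s≤2η = ≤-by {d = η + (s * s + η - ι 4 * η) + (ι 2 * η - s) * ((s + η) + η) + η * (1ℚ - ι 4 * η)}
          (0≤-+ (0≤-+ (0≤-+ 0≤η (≤⇒0≤- (≤-trans 4η≤q (≤-trans q≤qφ qφ≤)))) (0≤-* (≤⇒0≤- s≤2η) (0≤-+ 0≤s+ 0≤η)))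
            (0≤-* 0≤η (≤⇒0≤- 4η≤1)))
          (solve 2 (λ η s → con 0ℚ := η :+ (η :+ (s :* s :+ η :- con (ι 4) :* η) :+ (con (ι 2) :* η :- s) :* ((s :+ η) :+ η)
            :+ η :* (con 1ℚ :- con (ι 4) :* η))) refl η s)

      0<s : 0ℚ < s
      0<s = <-≤-trans (subst (_< ι 2 * η) (*-zeroʳ (ι 2)) (*-monoʳ-<-pos (ι 2) 0<η)) 2η≤s

      0≤s : 0ℚ ≤ s
      0≤s = <⇒≤ 0<s

      η≤s : η ≤ s
      η≤s = ≤-trans (≤-by 0≤η (solve 1 (λ η → con (ι 2) :* η := η :+ η) refl η)) 2η≤s

    module _ {q₀ s₀ l₀ q s l} (sample₀ : Sample φ′ η λ₀ q₀ s₀ l₀) (sample : Sample φ′ η λ₀ q s l)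
      (q-close : ∣ q₀ - q ∣ ≤ η * recip n) (s-close : ∣ s₀ - s ∣ ≤ ι 2 * η) where

      open Sample sample

      private
        n*recip≤1 : ι n * recip n ≤ 1ℚ
        n*recip≤1 = ≤-trans (*-monoʳ-≤-nonNeg (recip n) {{nonNegative (0≤recip n)}} (ι-mono (ℕ.n≤1+n n))) (≤-reflexive (ι*recip n))

        -- The factor `recip n` = 1 / (n + 1) in the tolerance for q absorbs the factor φ ≤ n.
        drift : ∣ φ′ * q₀ - φ′ * q ∣ ≤ η
        drift = begin
          ∣ φ′ * q₀ - φ′ * q ∣         ≡⟨ cong ∣_∣ (solve 3 (λ f a b → f :* a :- f :* b := f :* (a :- b)) refl φ′ q₀ q) ⟩
          ∣ φ′ * (q₀ - q) ∣            ≡⟨ ∣p*q∣≡∣p∣*∣q∣ φ′ (q₀ - q) ⟩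
          ∣ φ′ ∣ * ∣ q₀ - q ∣          ≡⟨ cong (_* ∣ q₀ - q ∣) (0≤p⇒∣p∣≡p 0≤φ′) ⟩
          φ′ * ∣ q₀ - q ∣              ≤⟨ *-mono-≤-nonNeg 0≤φ′ (0≤∣p∣ (q₀ - q)) φ′≤n q-close ⟩
          ι n * (η * recip n)          ≡⟨ solve 3 (λ n e r → n :* (e :* r) := e :* (n :* r)) refl (ι n) η (recip n) ⟩
          η * (ι n * recip n)          ≤⟨ *-monoˡ-≤-nonNeg η {{nonNegative 0≤η}} n*recip≤1 ⟩
          η * 1ℚ                       ≡⟨ *-identityʳ η ⟩
          η                            ∎
          where open ≤-Reasoning

        η≤1 : η ≤ 1ℚ
        η≤1 = ≤-trans (≤-by (0≤-* (0≤ι 3) 0≤η) (solve 1 (λ η → con (ι 4) :* η := η :+ con (ι 3) :* η) refl η)) (4η≤1 sample)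

        q₀≤q+η : q₀ ≤ q + η
        q₀≤q+η = ≤-by (0≤-+ (≤⇒0≤- (≤-trans (p≤∣p∣ (q₀ - q)) q-close)) (0≤-* 0≤η (≤⇒0≤- (recip≤1 n))))
          (solve 4 (λ a b e r → b :+ e := a :+ ((e :* r :- (a :- b)) :+ e :* (con 1ℚ :- r))) refl q₀ q η (recip n))

        4η≤φq : ι 4 * η ≤ φ′ * q
        4η≤φq = ≤-trans 4η≤q (≤-trans (q≤qφ sample) (≤-reflexive (*-comm q φ′)))

        small-square : ∀ {x} → ∣ x ∣ ≤ ι 2 * η → square x ≤ φ′ * q
        small-square {x} ∣x∣≤ = begin
          square x                       ≡⟨ 0≤p⇒∣p∣≡p (0≤-square x) ⟨
          ∣ x * x ∣                      ≡⟨ ∣p*q∣≡∣p∣*∣q∣ x x ⟩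
          ∣ x ∣ * ∣ x ∣                  ≤⟨ *-mono-≤-nonNeg (0≤∣p∣ x) (0≤∣p∣ x) ∣x∣≤ ∣x∣≤ ⟩
          ι 2 * η * (ι 2 * η)            ≤⟨ ≤-by (0≤-* (0≤-* (0≤ι 4) 0≤η) (≤⇒0≤- η≤1))
                                              (solve 1 (λ η → con (ι 4) :* η := con (ι 2) :* η :* (con (ι 2) :* η)
                                                 :+ con (ι 4) :* η :* (con 1ℚ :- η)) refl η) ⟩
          ι 4 * η                        ≤⟨ 4η≤φq ⟩
          φ′ * q                         ∎
          where open ≤-Reasoning

        drift-Y : square (φ′ * q - φ′ * q₀) ≤ φ′ * q
        drift-Y = small-square (≤-trans (≤-reflexive (trans (cong ∣_∣
            (solve 2 (λ a b → a :- b := :- (b :- a)) refl (φ′ * q) (φ′ * q₀))) (∣-p∣≡∣p∣ (φ′ * q₀ - φ′ * q))))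
          (≤-trans drift (≤-by 0≤η (solve 1 (λ η → con (ι 2) :* η := η :+ η) refl η))))

        drift-W : square (φ′ * (q * q) - φ′ * (q₀ * q₀)) ≤ φ′ * q
        drift-W = small-square (begin
          ∣ φ′ * (q * q) - φ′ * (q₀ * q₀) ∣
            ≡⟨ cong ∣_∣ (solve 3 (λ f a b → f :* (a :* a) :- f :* (b :* b) := :- ((a :+ b) :* (f :* b :- f :* a))) refl φ′ q q₀) ⟩
          ∣ - ((q + q₀) * (φ′ * q₀ - φ′ * q)) ∣
            ≡⟨ trans (∣-p∣≡∣p∣ ((q + q₀) * (φ′ * q₀ - φ′ * q))) (∣p*q∣≡∣p∣*∣q∣ (q + q₀) (φ′ * q₀ - φ′ * q)) ⟩
          ∣ q + q₀ ∣ * ∣ φ′ * q₀ - φ′ * q ∣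
            ≡⟨ cong (_* ∣ φ′ * q₀ - φ′ * q ∣) (0≤p⇒∣p∣≡p 0≤q+q₀) ⟩
          (q + q₀) * ∣ φ′ * q₀ - φ′ * q ∣
            ≤⟨ *-mono-≤-nonNeg 0≤q+q₀ (0≤∣p∣ (φ′ * q₀ - φ′ * q)) (+-mono-≤ q≤1 (Sample.q≤1 sample₀)) drift ⟩
          ι 2 * η ∎)
          where
          open ≤-Reasoning
          0≤q+q₀ : 0ℚ ≤ q + q₀
          0≤q+q₀ = 0≤-+ (0≤q sample) (0≤q sample₀)

        τ : ℚ
        τ = ι λ₀ * s₀

        0<τ : 0ℚ < τ
        0<τ = positive⁻¹ τ {{pos*pos⇒pos (ι λ₀) {{positive (<-≤-trans (positive⁻¹ 1ℚ) 1≤λ)}} s₀ {{positive (0<s sample₀)}}}}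

        -- Links the variance at q to the threshold at q₀: φ q ≤ φ q₀ + η ≤ s₀² + 2η, and 2η is at
        -- most half of φ q.
        φq≤2s₀² : φ′ * q ≤ ι 2 * (s₀ * s₀)
        φq≤2s₀² = ≤-by {d = ι 2 * (s₀ * s₀ + η - q₀ * φ′) + ι 2 * (η + (φ′ * q₀ - φ′ * q)) + (φ′ * q - ι 4 * η)}
          (0≤-+ (0≤-+ (0≤-* (0≤ι 2) (≤⇒0≤- (Sample.qφ≤ sample₀))) (0≤-* (0≤ι 2)
              (subst (0ℚ ≤_) (solve 2 (λ e u → e :- :- u := e :+ u) refl η (φ′ * q₀ - φ′ * q))
                (≤⇒0≤- (≤-trans (p≤∣p∣ (- (φ′ * q₀ - φ′ * q))) (≤-trans (≤-reflexive (∣-p∣≡∣p∣ (φ′ * q₀ - φ′ * q))) drift))))))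
            (≤⇒0≤- 4η≤φq))
          (solve 5 (λ f q q₀ s e → con (ι 2) :* (s :* s) := f :* q :+ (con (ι 2) :* (s :* s :+ e :- q₀ :* f)
            :+ con (ι 2) :* (e :+ (f :* q₀ :- f :* q)) :+ (f :* q :- con (ι 4) :* e))) refl φ′ q q₀ s₀ η)

      -- One factor λ₀ of the squared threshold pays for 2A / ε, the other is only bounded below by
      -- 1.
      sample-probability : ∀ {ε} → ι 2 * A ≤ ε * ι λ₀ →
        1ℚ - ε ≤ Ex q (𝟙 (atMost (V q₀) (ι λ₀ * s₀ * (ι λ₀ * s₀))))
      sample-probability {ε} 2A≤ = probability (0≤q sample) q≤1 {q₀} {ε} {τ * τ} 0<τ² (begin
        Ex q (V q₀)                       ≤⟨ Ex-V (0≤q sample) q≤1 {q₀} drift-Y drift-W ⟩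
        A * (φ′ * q)                      ≤⟨ *-monoˡ-≤-nonNeg A {{nonNegative 0≤A}} φq≤2s₀² ⟩
        A * (ι 2 * (s₀ * s₀))             ≡⟨ solve 2 (λ a s → a :* (con (ι 2) :* s) := con (ι 2) :* a :* s) refl A (s₀ * s₀) ⟩
        ι 2 * A * (s₀ * s₀)               ≤⟨ *-monoʳ-≤-nonNeg (s₀ * s₀) {{nonNegative (0≤-square s₀)}} 2A≤ ⟩
        ε * ι λ₀ * (s₀ * s₀)              ≤⟨ ≤-by (0≤-* (0≤-* 0≤ελ (≤⇒0≤- 1≤λ)) (0≤-square s₀))
                                               (solve 3 (λ e l s → e :* (l :* s :* (l :* s)) := e :* l :* (s :* s)
                                                 :+ e :* l :* (l :- con 1ℚ) :* (s :* s)) refl ε (ι λ₀) s₀) ⟩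
        ε * (τ * τ)                       ∎)
        where
        open ≤-Reasoning
        0≤ελ : 0ℚ ≤ ε * ι λ₀
        0≤ελ = ≤-trans (0≤-* (0≤ι 2) 0≤A) 2A≤
        0<τ² : 0ℚ < τ * τ
        0<τ² = positive⁻¹ (τ * τ) {{pos*pos⇒pos τ {{positive 0<τ}} τ {{positive 0<τ}}}}

      1≤pow : ∀ d → 1ℚ ≤ pow l d
      1≤pow zero    = ≤-refl
      1≤pow (suc d) = *-mono-≤-nonNeg (nonNegative⁻¹ 1ℚ) (nonNegative⁻¹ 1ℚ) (≤-trans 1≤λ λ≤l) (1≤pow d)

      λ≤pow : ∀ {D} → 1 ℕ.≤ D → ι λ₀ ≤ pow l D
      λ≤pow {suc d} _ = ≤-trans (≤-reflexive (sym (*-identityʳ (ι λ₀))))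
        (*-mono-≤-nonNeg (0≤ι λ₀) (nonNegative⁻¹ 1ℚ) λ≤l (1≤pow d))

      sample-error : ∀ {D R} → 1 ℕ.≤ D → V q₀ R ≤ ι λ₀ * s₀ * (ι λ₀ * s₀) →
        ∣ N R - q * φ′ ∣ ≤ c * (q * (q * 1ℚ) * φ′ + s * pow l D)
      sample-error {D} {R} 1≤D V≤ = deterministic {q} {q₀} {s} {s₀} {ι λ₀} {pow l D} {R}
        (0≤q sample) (0≤s sample) (0≤s sample₀) 1≤λ (λ≤pow 1≤D)
        (≤-by (0≤-+ (≤⇒0≤- (≤-trans (p≤∣p∣ (s₀ - s)) s-close)) (≤⇒0≤- (2η≤s sample)))
          (solve 3 (λ a s e → con (ι 2) :* s := a :+ ((con (ι 2) :* e :- (a :- s)) :+ (s :- con (ι 2) :* e))) refl s₀ s η))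
        (0≤q sample₀)
        (≤-trans q₀≤q+η (≤-by (0≤-+ (≤⇒0≤- 4η≤q) (0≤-* (0≤ι 3) 0≤η))
          (solve 2 (λ q e → con (ι 2) :* q := q :+ e :+ ((q :- con (ι 4) :* e) :+ con (ι 3) :* e)) refl q η)))
        (≤-trans drift (η≤s sample)) V≤

-- From rational estimates to statements about reals.

module Assembly where

  open Rationals
  open Floors using (0<½*)
  open import Defs as Defs using (ℝ; seq; fromℕ; fromℚ; 0ℝ; 1ℝ; ½ℝ; _IsSqrtOf_; _≤Pr[_]_; #zeroSumFree; Pr)
  open import Data.Bool using (true)
  open import Data.Nat using (suc)
  import Data.Nat.Properties as ℕ
  open import Data.Product using (∃; _×_; _,_; proj₁; proj₂)
  open import Data.Rational
  open import Data.Rational.Properties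
  open import Data.Rational.Solver using (module +-*-Solver)
  open import Data.Sum using (inj₁; inj₂)
  open import Relation.Binary.PropositionalEquality
  open import Relation.Nullary using (contradiction)
  open +-*-Solver

  Eventually : (ℕ → Set) → Set
  Eventually P = ∃ λ N → ∀ m → N ℕ.≤ m → P m

  eventually-× : ∀ {P Q} → Eventually P → Eventually Q → Eventually (λ m → P m × Q m)
  eventually-× (M , p) (N , q) = M ℕ.⊔ N , λ m ≤m → p m (ℕ.m⊔n≤o⇒m≤o M N ≤m) , q m (ℕ.m⊔n≤o⇒n≤o M N ≤m)

  eventually-map : ∀ {P Q : ℕ → Set} → (∀ {m} → P m → Q m) → Eventually P → Eventually Q
  eventually-map f (N , p) = N , λ m ≤m → f (p m ≤m)

  eventually-close : ∀ (x : ℝ) {ε} → 0ℚ < ε → ∃ λ N → ∀ m m′ → N ℕ.≤ m → N ℕ.≤ m′ → ∣ seq x m - seq x m′ ∣ ≤ ε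
  eventually-close x 0<ε = Defs.cauchy x _ 0<ε

  -- Late terms have absolute value at least ρ and are at least -ρ / 2, so they are positive.
  eventually-bounded-below : ∀ {p} → 0ℝ Defs.≤ p → 0ℝ Defs.< Defs.∣ p ∣ → ∃ λ ρ → 0ℚ < ρ × Eventually (λ m → ρ ≤ seq p m)
  eventually-bounded-below {p} 0≤p (ρ , 0<ρ , apart) =
    ρ , 0<ρ , eventually-map (λ {m} → decide m) (eventually-× apart (0≤p (½ * ρ) (0<½* 0<ρ)))
    where
    decide : ∀ m → 0ℚ + ρ ≤ ∣ seq p m ∣ × 0ℚ ≤ seq p m + ½ * ρ → ρ ≤ seq p m
    decide m (ρ≤ , 0≤) with ∣p∣≡p∨∣p∣≡-p (seq p m)
    ... | inj₁ eq = ≤-trans (≤-reflexive (sym (+-identityˡ ρ))) (≤-trans ρ≤ (≤-reflexive eq))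
    ... | inj₂ eq = contradiction (≤-<-trans ρ≤0 0<ρ) (<-irrefl refl)
      where
      ρ≤0 : ρ ≤ 0ℚ
      ρ≤0 = ≤-by (0≤-* (0≤ι 2) (0≤-+ (≤⇒0≤- (≤-trans ρ≤ (≤-reflexive eq))) 0≤))
        (solve 2 (λ r x → con 0ℚ := r :+ con (ι 2) :* ((:- x :- (con 0ℚ :+ r)) :+ (x :+ con ½ :* r))) refl ρ (seq p m))

  -- The terms themselves must be probabilities. The real bound ½ leaves room for an approximation
  -- error ½, which p ≤ 1 would not.
  eventually-≤1 : ∀ {p} → Defs.∣ p ∣ Defs.≤ ½ℝ Defs.* Defs.∣ 1ℝ ∣ → Eventually (λ m → seq p m ≤ 1ℚ)
  eventually-≤1 {p} ∣p∣≤½ = eventually-map (λ {m} h → ≤-trans (p≤∣p∣ (seq p m)) h) (∣p∣≤½ ½ (positive⁻¹ ½))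

  module _ (k n : ℕ) {{_ : ℕ.NonZero n}} (big : 6 ℕ.* k ℕ.+ 2 ℕ.≤ n) (ℓ : ℕ) (ℓ+ : ℓ ℕ.+ ℕ.suc k ≡ n) where

    open Constants k
    open Concentration k n big ℓ ℓ+
    open Samples
    open Scales k n big ℓ ℓ+
    open Expectation
    open ExponentialSums using (recip; seq-^)
    open Variances n using (φ′)

    -- The accuracy enters through a rational ε₀ below ε and an integer λ₀ ≥ 2A / ε₀, both
    -- independent of n.
    concentration : ∀ {ε : ℝ} {ε₀ λ₀ D} (p s l : ℝ) → 0ℚ < ε₀ → Eventually (λ m → ε₀ ≤ seq ε m) →
      1 ℕ.≤ λ₀ → ι 2 * A ≤ ε₀ * ι λ₀ → 1 ℕ.≤ D →
      0ℝ Defs.≤ p → 0ℝ Defs.< Defs.∣ p ∣ → Defs.∣ p ∣ Defs.≤ ½ℝ Defs.* Defs.∣ 1ℝ ∣ →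
      s IsSqrtOf (p Defs.* fromℕ (Defs.φ n)) → Eventually (λ m → ι λ₀ ≤ seq l m) →
      (1ℝ Defs.- ε) ≤Pr[ p ] λ R →
        Defs.∣ fromℕ (#zeroSumFree R ℓ) Defs.- p Defs.* fromℕ (Defs.φ n) ∣
          Defs.≤ fromℚ c Defs.* (p Defs.^ 2 Defs.* fromℕ (Defs.φ n) Defs.+ s Defs.* l Defs.^ D)
    concentration {ε} {ε₀} {λ₀} {D} p s l 0<ε₀ ε₀≤ 1≤λ₀ 2A≤ 1≤D 0≤p 0<∣p∣ ∣p∣≤ (0≤s , _ , pφ≤s²) λ≤l =
      F , implies , probable
      where
      below = eventually-bounded-below {p} 0≤p 0<∣p∣
      ρ = proj₁ below
      0<ρ = proj₁ (proj₂ below)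
      -- A quarter of the lower bound ρ for p, so that 4η ≤ q as `Sample` asks.
      η = ½ * (½ * ρ)
      0<η = 0<½* (0<½* 0<ρ)
      4η≡ρ : ι 4 * η ≡ ρ
      4η≡ρ = solve 1 (λ r → con (ι 4) :* (con ½ :* (con ½ :* r)) := r) refl ρ
      0<η*recip : 0ℚ < η * recip n
      0<η*recip = positive⁻¹ (η * recip n) {{pos*pos⇒pos η {{positive 0<η}} (recip n) {{normalize-pos 1 (suc n)}}}}
      samples : Eventually (λ m → Sample φ′ η λ₀ (seq p m) (seq s m) (seq l m) × ε₀ ≤ seq ε m)
      samples = eventually-map
        (λ ((ρ≤q , q≤1) , (λ≤l , qφ≤) , 0≤s+η , ε₀≤ε) → record
          { 4η≤q = ≤-trans (≤-reflexive 4η≡ρ) ρ≤q ; q≤1 = q≤1 ; λ≤l = λ≤l ; qφ≤ = qφ≤ ; 0≤s+ = 0≤s+η } , ε₀≤ε)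
        (eventually-× (eventually-× (proj₂ (proj₂ below)) (eventually-≤1 {p} ∣p∣≤))
          (eventually-× (eventually-× λ≤l (pφ≤s² η 0<η)) (eventually-× (0≤s η 0<η) ε₀≤)))
      p-close = eventually-close p 0<η*recip
      s-close = eventually-close s (subst (_< ι 2 * η) (*-zeroʳ (ι 2)) (*-monoʳ-<-pos (ι 2) 0<η))
      -- The index at which the event is fixed; all estimates hold from here on.
      m₀ = proj₁ samples ℕ.⊔ (proj₁ p-close ℕ.⊔ proj₁ s-close)
      samples≤ = ℕ.m≤m⊔n (proj₁ samples) (proj₁ p-close ℕ.⊔ proj₁ s-close)
      p-close≤ = ℕ.≤-trans (ℕ.m≤m⊔n (proj₁ p-close) (proj₁ s-close)) (ℕ.m≤n⊔m (proj₁ samples) _)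
      s-close≤ = ℕ.≤-trans (ℕ.m≤n⊔m (proj₁ p-close) (proj₁ s-close)) (ℕ.m≤n⊔m (proj₁ samples) _)
      q₀ = seq p m₀
      s₀ = seq s m₀
      sample₀ = proj₁ (proj₂ samples m₀ samples≤)
      T = ι λ₀ * s₀ * (ι λ₀ * s₀)
      F = atMost (V q₀) T
      p-near : ∀ m → m₀ ℕ.≤ m → ∣ q₀ - seq p m ∣ ≤ η * recip n
      p-near m m₀≤m = proj₂ p-close m₀ m p-close≤ (ℕ.≤-trans p-close≤ m₀≤m)
      s-near : ∀ m → m₀ ℕ.≤ m → ∣ s₀ - seq s m ∣ ≤ ι 2 * η
      s-near m m₀≤m = proj₂ s-close m₀ m s-close≤ (ℕ.≤-trans s-close≤ m₀≤m)
      implies : ∀ R → F R ≡ true → _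
      implies R FR δ 0<δ = m₀ , λ m m₀≤m → ≤-trans
        (subst (λ x → ∣ N R - seq p m * φ′ ∣ ≤ c * (seq p m * (seq p m * 1ℚ) * φ′ + seq s m * x)) (sym (seq-^ l D m))
          (sample-error 0<η 1≤λ₀ sample₀ (proj₁ (proj₂ samples m (ℕ.≤-trans samples≤ m₀≤m))) (p-near m m₀≤m) (s-near m m₀≤m)
            {D} {R} 1≤D (atMost⁻ (V q₀) T R FR)))
        (≤-by (<⇒≤ 0<δ) refl)
      probable : (1ℝ Defs.- ε) Defs.≤ Pr p F
      probable δ 0<δ = m₀ , λ m m₀≤m →
        let sample , ε₀≤ε = proj₂ samples m (ℕ.≤-trans samples≤ m₀≤m)
        in ≤-trans (+-monoʳ-≤ 1ℚ (neg-antimono-≤ ε₀≤ε)) (≤-trans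
             (sample-probability 0<η 1≤λ₀ sample₀ sample (p-near m m₀≤m) (s-near m m₀≤m) {ε₀} 2A≤)
             (≤-trans (≤-reflexive (sym (seq-Pr p F m))) (≤-by (<⇒≤ 0<δ) refl)))

  largeMultiple : ∀ {ε} A → 0ℚ < ε → ∃ λ l → 1 ℕ.≤ l × A ≤ ε * ι l
  largeMultiple {ε} A 0<ε = suc l , ℕ.s≤s ℕ.z≤n , (begin
    A                       ≡⟨ *-identityˡ A ⟨
    1ℚ * A                  ≡⟨ cong (_* A) (*-inverseʳ ε) ⟨
    ε * 1/ ε * A            ≡⟨ *-assoc ε (1/ ε) A ⟩
    ε * (1/ ε * A)          ≤⟨ *-monoˡ-≤-nonNeg ε {{nonNegative (<⇒≤ 0<ε)}} (≤-trans (proj₂ bound) (ι-mono (ℕ.n≤1+n l))) ⟩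
    ε * ι (suc l)           ∎)
    where
    open ≤-Reasoning
    instance
      _ = pos⇒nonZero ε {{positive 0<ε}}
    bound = archimedean (1/ ε * A)
    l = proj₁ bound

open import Defs

open Rationals using (ι)
open Assembly using (concentration; largeMultiple)

theorem4 : (k : ℕ) → ∃ λ (c : ℝ) →
    (D : ℕ) (s : ℝ) → s IsSqrtOf fromℕ (1 ℕ.+ 8 ℕ.* k) → D IsFloorOf ((1ℝ + s) * ½ℝ) →
    (log loglog : ℕ → ℝ) →
    (∀ n → 2 ℕ.≤ n → log n IsLogOf fromℕ n × loglog n IsLogOf log n) →
    (p : ℕ → ℝ) → (∀ n → 0ℝ ≤ p n × p n ≤ 1ℝ) →
    (λ n → log n ^ (2 ℕ.* D) * loglog n * 1/ℕ n) ≪ p → p ≪ (λ _ → 1ℝ) →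
    (√pφ : ℕ → ℝ) → (∀ n → √pφ n IsSqrtOf (p n * fromℕ (φ n))) →
    AAS p λ n R →
    ∣ fromℕ (#zeroSumFree R (n ∸ 1 ∸ k)) - p n * fromℕ (φ n) ∣
    ≤ c * (p n ^ 2 * fromℕ (φ n) + √pφ n * log n ^ D)
theorem4 k = fromℚ (Constants.c k) , λ D s s-sqrt D-floor log loglog logs p p-prob p-large p-small √pφ sqrts ε 0<ε →
  let ε₀ , 0<ε₀ , Nε , ε₀≤ε = 0<ε
      l , 1≤l , 2A≤         = largeMultiple (ι 2 ℚ.* Constants.A k) 0<ε₀
      N₁ , log≥l            = ExponentialSums.log-large l
      N₂ , p-positive       = p-large 1ℝ (ℚ.1ℚ , ℚ.positive⁻¹ ℚ.1ℚ , 0 , λ _ _ → ℚ.≤-refl)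
      -- The comparison with 1 is taken at ½, for the sake of `eventually-≤1`.
      N₃ , p≤½              = p-small ½ℝ (ℚ.½ , ℚ.positive⁻¹ ℚ.½ , 0 , λ _ _ → ℚ.≤-refl)
      N₀                    = 6 ℕ.* k ℕ.+ 2
  in (N₀ ℕ.⊔ N₁) ℕ.⊔ (N₂ ℕ.⊔ N₃) , λ n N≤n →
    let N₀₁≤n = ℕ.m⊔n≤o⇒m≤o (N₀ ℕ.⊔ N₁) (N₂ ℕ.⊔ N₃) N≤n
        N₂₃≤n = ℕ.m⊔n≤o⇒n≤o (N₀ ℕ.⊔ N₁) (N₂ ℕ.⊔ N₃) N≤n
        big   = ℕ.m⊔n≤o⇒m≤o N₀ N₁ N₀₁≤n
        2≤n   = ℕ.≤-trans (ℕ.m≤n+m 2 (6 ℕ.* k)) big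
    in concentration k n {{ℕ.>-nonZero (ℕ.≤-trans (ℕ.s≤s ℕ.z≤n) 2≤n)}} big (n ∸ 1 ∸ k) (length+ k n big)
         {ε} {ε₀} {l} {D} (p n) (√pφ n) (log n) 0<ε₀
         (Nε , λ m Nε≤m → ℚ.≤-trans (ℚ.≤-reflexive (sym (ℚ.+-identityˡ ε₀))) (ε₀≤ε m Nε≤m))
         1≤l 2A≤ (Floors.floor-positive k {D} {s} s-sqrt D-floor)
         (proj₁ (p-prob n)) (proj₁ (p-positive n (ℕ.m⊔n≤o⇒m≤o N₂ N₃ N₂₃≤n))) (proj₂ (p≤½ n (ℕ.m⊔n≤o⇒n≤o N₂ N₃ N₂₃≤n)))
         (sqrts n) (log≥l n (ℕ.m⊔n≤o⇒n≤o N₀ N₁ N₀₁≤n) (log n) (proj₁ (logs n 2≤n)))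
  where
  -- Truncated subtraction is genuine here, since n ≥ 6k + 2 exceeds k.
  length+ : ∀ k n → 6 ℕ.* k ℕ.+ 2 ℕ.≤ n → (n ∸ 1 ∸ k) ℕ.+ ℕ.suc k ≡ n
  length+ k n big = trans (cong (ℕ._+ ℕ.suc k) (ℕ.∸-+-assoc n 1 k)) (ℕ.m∸n+n≡m k<n)
    where
    k<n : ℕ.suc k ℕ.≤ n
    k<n = ℕ.≤-trans (ℕ.≤-trans (ℕ.s≤s (ℕ.m≤n*m k 6)) (ℕ.≤-trans (ℕ.n≤1+n _) (ℕ.≤-reflexive (ℕ.+-comm 2 (6 ℕ.* k))))) big
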